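{- Let $G$ and $G'$ be graphs without loops or multiple edges, and let $f: G\to G'$ be a circuit surjection, where $G$ is finite and 3-connected. Then $f$ is induced by a vertex isomorphism, i.e., there is a bijection $\varphi: V(G)\to V(G')$ such that for every edge $uv$ of $G$, $f(uv)=\varphi(u)\varphi(v)$.
   Context: A circuit is a (finite) cycle of a graph, identified with its edge set. A circuit surjection $f: G\to G'$ is a map from the edge set $E(G)$ onto the edge set $E(G')$ such that $f(C)$ is a circuit of $G'$ for every circuit $C$ of $G$; it is also required that $G'$ has no isolated vertices. -}

module Defs where

open import Data.Bool using (Bool; true; false)
open import Data.Nat as ℕ using (ℕ; zero; suc)
open import Data.Fin using (Fin; zero; suc; toℕ; fromℕ; lower₁; _<_)
open import Data.Fin.Subset using (Subset; _∉_; ∣_∣)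
open import Data.Product using (Σ; ∃; ∃-syntax; _×_; _,_; proj₁; proj₂)
open import Data.Sum using (_⊎_)
open import Relation.Nullary using (¬_; yes; no)
open import Relation.Unary using (Pred)
open import Relation.Binary.PropositionalEquality using (_≡_)
open import Relation.Binary.Construct.Closure.ReflexiveTransitive using (Star)
open import Function.Definitions using (Injective; Surjective)
open import Level using (0ℓ)

record Graph (n : ℕ) : Set where
  field
    adj     : Fin n → Fin n → Bool
    sym     : ∀ u v → adj u v ≡ adj v u
    irrefl  : ∀ u → adj u u ≡ false

open Graph public

Adj : ∀ {n} → Graph n → Fin n → Fin n → Set
Adj G u v = adj G u v ≡ true

-- An edge uv is represented uniquely by its endpoints listed with u < v.
Edge : ∀ {n} → Graph n → Set
Edge {n} G = Σ (Fin n × Fin n) λ p → (proj₁ p < proj₂ p) × Adj G (proj₁ p) (proj₂ p)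

ends : ∀ {n} {G : Graph n} → Edge G → Fin n × Fin n
ends = proj₁

Joins : ∀ {n} (G : Graph n) → Edge G → Fin n → Fin n → Set
Joins G e a b = (ends {G = G} e ≡ (a , b)) ⊎ (ends {G = G} e ≡ (b , a))

EdgeSet : ∀ {n} → Graph n → Set₁
EdgeSet G = Pred (Edge G) 0ℓ

next : ∀ {k} → Fin (suc k) → Fin (suc k)
next {k} i with k ℕ.≟ toℕ i
... | yes _ = zero
... | no ne = suc (lower₁ i ne)

IsCircuit : ∀ {n} (G : Graph n) → EdgeSet G → Set
IsCircuit {n} G C =
  Σ ℕ λ k → (2 ℕ.≤ k) × Σ (Fin (suc k) → Fin n) λ v →
    Injective _≡_ _≡_ v
    × (∀ i → Adj G (v i) (v (next i)))
    × (∀ e → (C e → ∃[ i ] Joins G e (v i) (v (next i)))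
           × (∃[ i ] Joins G e (v i) (v (next i)) → C e))

Image : ∀ {n m} {G : Graph n} {G' : Graph m} →
        (Edge G → Edge G') → EdgeSet G → EdgeSet G'
Image {G = G} f C e' = Σ (Edge G) λ e → (C e × f e ≡ e')

NoIsolatedVertices : ∀ {m} → Graph m → Set
NoIsolatedVertices G = ∀ v → ∃[ w ] Adj G v w

IsCircuitSurjection : ∀ {n m} (G : Graph n) (G' : Graph m) →
                      (Edge G → Edge G') → Set₁
IsCircuitSurjection G G' f =
  Surjective _≡_ _≡_ f
  × NoIsolatedVertices G'
  × (∀ (C : EdgeSet G) → IsCircuit G C → IsCircuit G' (Image {G = G} {G'} f C))

StepAvoiding : ∀ {n} → Graph n → Subset n → Fin n → Fin n → Set
StepAvoiding G X u w = Adj G u w × w ∉ X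

ConnectedAvoiding : ∀ {n} → Graph n → Subset n → Set
ConnectedAvoiding {n} G X =
  ∀ (u v : Fin n) → u ∉ X → v ∉ X → Star (StepAvoiding G X) u v

KConnected : ℕ → ∀ {n} → Graph n → Set
KConnected k {n} G = (k ℕ.< n) × (∀ (X : Subset n) → ∣ X ∣ ℕ.< k → ConnectedAvoiding G X)

InducedBy : ∀ {n m} {G : Graph n} {G' : Graph m} →
            (Edge G → Edge G') → (Fin n → Fin m) → Set
InducedBy {G = G} {G'} f φ = ∀ e → Joins G' (f e) (φ (proj₁ (ends {G = G} e))) (φ (proj₂ (ends {G = G} e)))

{-# OPTIONS --safe #-}
module Submission where

-- Injectivity. Suppose f e₁ ≡ f e₂ with e₁ ≢ e₂. A circuit through both edges has an ear separating them;
-- comparing symmetric differences of circuits of G', the three circuits of this theta have the same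
-- image K. If some edge had a colour (that is, a value of f) outside K, an ear of the theta through it and
-- three routes between the ends of the ear would give three circuits whose images pairwise differ by exactly
-- K, which is impossible. So all colours lie in the circuit K, every circuit of G has all the colours of K,
-- and removing any one colour leaves a forest. Three colours give 2|E| ≤ 3(n − 1), against minimum degree 3.
--
-- Vertex map. For injective f the preimage B w of the star of w is a cut which every circuit of G crosses at
-- most twice. By Menger's theorem two such cuts of a 3-connected graph do not cross. If some B w were not
-- the star of a vertex, choose one with a side S of minimal size: each edge inside S is then cut by stars only,
-- and w together with the vertices of G' whose cuts are stars of vertices of S absorbs all edges of G' at any of
-- its members. A circuit through an edge touching S and an edge avoiding S would have a disconnected
-- image. Hence the B w are exactly the stars of G, and φ sends v to the w with B w the star of v.

open import Defs hiding (sym)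
open import Axiom.UniquenessOfIdentityProofs using (module Decidable⇒UIP)
open import Data.Bool using (Bool; true; false; not)
import Data.Bool.Properties as Bool
open import Data.Empty using (⊥; ⊥-elim)
open import Data.Unit using (⊤; tt)
open import Data.Nat as ℕ using (ℕ; zero; suc; _+_; _*_; _≤_; z≤n; s≤s)
import Data.Nat.Properties as ℕ
import Data.Nat.Tactic.RingSolver as ℕ
open import Data.Fin as Fin using (Fin; zero; suc; toℕ; fromℕ; inject₁)
import Data.Fin.Properties as Fin
open import Data.Fin.Subset as Subset using (Subset; ⁅_⁆; _∪_; ∣_∣)
import Data.Fin.Subset.Properties as Subset
open import Data.Fin.Properties using (_≟_; any?; all?)
open import Data.Fin.Relation.Unary.Top using (view; ‵fromℕ; ‵inject₁)
open import Data.Fin.Induction using (<-weakInduction)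
open import Data.List using (List; []; _∷_; _++_; length; lookup; map; filter; allFin; cartesianProduct)
open import Data.List.Properties using (map-++; filter-++; length-++; length-tabulate)
open import Data.List.Membership.Propositional using (_∈_; _∉_; find)
open import Data.List.Membership.Propositional.Properties
open import Data.List.Relation.Unary.All as All using (All; []; _∷_)
import Data.List.Relation.Unary.All.Properties as All
open import Data.List.Relation.Unary.AllPairs using ([]; _∷_)
open import Data.List.Relation.Unary.Any as Any using (Any; here; there)
import Data.List.Relation.Unary.Any.Properties as Any
import Data.List.Relation.Unary.Unique.Propositional.Properties as Unique
open import Data.List.Relation.Unary.Unique.Propositional using (Unique)
open import Data.Product using (Σ; ∃; ∃₂; _×_; _,_; proj₁; proj₂)
import Data.Product.Properties as Product
open import Data.Sum using (_⊎_; inj₁; inj₂; [_,_]′)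
open import Data.Vec as Vec using (Vec; []; _∷_; tabulate)
import Data.Vec.Properties as Vec
import Data.Vec.Membership.Propositional as Vec
import Data.Vec.Membership.Propositional.Properties as Vec
open import Data.Vec.Relation.Unary.Any as VecAny using (here; there)
import Data.Vec.Relation.Unary.Any.Properties as VecAny
open import Function using (_∘_; id; case_of_)
open import Function.Definitions using (Injective; Surjective; Bijective)
open import Relation.Binary using (DecidableEquality; tri<; tri≈; tri>)
open import Relation.Binary.Construct.Closure.ReflexiveTransitive as Star using (Star; ε; _◅_; _◅◅_)
import Relation.Binary.Construct.Closure.ReflexiveTransitive.Properties as Star
open import Relation.Binary.PropositionalEquality using (_≡_; _≢_; refl; sym; trans; cong; cong₂; subst; ≢-sym)
open import Relation.Nullary using (¬_; Dec; yes; no; does; ¬?; _×-dec_; _⊎-dec_; _→-dec_; contradiction)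
open import Relation.Nullary.Decidable using (map′; decidable-stable; dec-true; dec-false)

-- Walks and simple paths

-- About `G'` little is known beyond the images of circuits, and nothing about preimages of
-- circuits. So circuits of `G'` enter only through their local shape: degree two at each vertex,
-- connectedness, three edges. Parity at the vertices shows that a symmetric difference of two
-- circuits inside a third circuit K is empty or all of K. Three circuits whose pairwise differences
-- all equal K cannot exist, because an edge lies in an even number of the three differences. In
-- 2|E| ≤ 3(n - 1) the factor 2 appears because an edge has one colour and so survives in at least
-- two of the three forests; minimum degree three gives 2|E| ≥ 3n.
--
-- `B w` is a cut because the image of a circuit has degree zero or two at w. A minimal side S helps
-- through uncrossing: if the cut of w' splits an edge inside S, then one side of w' lies properly
-- in S and minimality makes the cut a star, or else all four quadrants are occupied. The latter is
-- excluded by 3-connectivity unless both diagonals are adjacent, and then two edges of G would lie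
-- in both cuts while injectivity allows only one.

module _ {V : Set} {R : V → V → Set} where

  steps : ∀ {u v} → Star R u v → List V
  steps ε                 = []
  steps (_◅_ {j = w} r p) = w ∷ steps p

  verts : ∀ {u v} → Star R u v → List V
  verts {u} p = u ∷ steps p

  Simple : ∀ {u v} → Star R u v → Set
  Simple p = Unique (verts p)

  end∈ : ∀ {u v} (p : Star R u v) → v ∈ verts p
  end∈ ε       = here refl
  end∈ (r ◅ p) = there (end∈ p)

  ∈-◅◅⁺ˡ : ∀ {u v w x} (p : Star R u v) (q : Star R v w) → x ∈ verts p → x ∈ verts (p ◅◅ q)
  ∈-◅◅⁺ˡ p       q (here e)  = here e
  ∈-◅◅⁺ˡ (r ◅ p) q (there m) = there (∈-◅◅⁺ˡ p q m)

  ∈-◅◅⁺ʳ : ∀ {u v w x} (p : Star R u v) (q : Star R v w) → x ∈ verts q → x ∈ verts (p ◅◅ q)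
  ∈-◅◅⁺ʳ ε       q m = m
  ∈-◅◅⁺ʳ (r ◅ p) q m = there (∈-◅◅⁺ʳ p q m)

  ∈-◅◅⁻ : ∀ {u v w x} (p : Star R u v) (q : Star R v w) →
          x ∈ verts (p ◅◅ q) → x ∈ verts p ⊎ x ∈ verts q
  ∈-◅◅⁻ ε       q m         = inj₂ m
  ∈-◅◅⁻ (r ◅ p) q (here e)  = inj₁ (here e)
  ∈-◅◅⁻ (r ◅ p) q (there m) with ∈-◅◅⁻ p q m
  ... | inj₁ l = inj₁ (there l)
  ... | inj₂ l = inj₂ l

  split : ∀ {u v x} (p : Star R u v) → x ∈ verts p →
          ∃₂ λ (p₁ : Star R u x) (p₂ : Star R x v) → p ≡ p₁ ◅◅ p₂
  split p       (here refl) = ε , p , refl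
  split (r ◅ p) (there m) with split p m
  ... | p₁ , p₂ , refl = r ◅ p₁ , p₂ , refl

  Simple-◅◅⁻ : ∀ {u v w} (p : Star R u v) (q : Star R v w) → Simple (p ◅◅ q) →
               Simple p × Simple q × (∀ {x} → x ∈ verts p → x ∈ verts q → x ≡ v)
  Simple-◅◅⁻ ε       q s       = [] ∷ [] , s , λ { (here e) _ → e }
  Simple-◅◅⁻ (r ◅ p) q (a ∷ s) with Simple-◅◅⁻ p q s
  ... | sp , sq , d =
    All.tabulate (λ m → All.lookup a (∈-◅◅⁺ˡ p q m)) ∷ sp , sq ,
    λ { (here refl) m → contradiction refl (All.lookup a (∈-◅◅⁺ʳ p q m)) ; (there l) m → d l m }

  Simple-◅◅⁺ : ∀ {u v w} (p : Star R u v) (q : Star R v w) → Simple p → Simple q →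
               (∀ {x} → x ∈ verts p → x ∈ verts q → x ≡ v) → Simple (p ◅◅ q)
  Simple-◅◅⁺ ε       q sp       sq d = sq
  Simple-◅◅⁺ (r ◅ p) q (a ∷ sp) sq d =
    All.tabulate (λ m e → [ (λ l → All.lookup a l e) , (λ l → All.lookup a (end∈ p) (d (here refl) (subst (_∈ verts q) (sym e) l))) ]′ (∈-◅◅⁻ p q m))
    ∷ Simple-◅◅⁺ p q sp sq (λ l m → d (there l) m)

  retarget : ∀ {u v w} (p : Star R u v) → Simple p → v ≡ w →
             Σ (Star R u w) λ q → Simple q × (∀ {z} → z ∈ verts q → z ∈ verts p)
  retarget p s refl = p , s , id

  resource : ∀ {u v w} (p : Star R u v) → Simple p → u ≡ w →
             Σ (Star R w v) λ q → Simple q × (∀ {z} → z ∈ verts q → z ∈ verts p)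
  resource p s refl = p , s , id

module _ {V : Set} {R T : V → V → Set} (g : ∀ {u v} → R u v → T u v) where

  steps-map : ∀ {u v} (p : Star R u v) → steps (Star.map g p) ≡ steps p
  steps-map ε       = refl
  steps-map (r ◅ p) = cong (_ ∷_) (steps-map p)

  verts-map : ∀ {u v} (p : Star R u v) → verts (Star.map g p) ≡ verts p
  verts-map p = cong (_ ∷_) (steps-map p)

  ∈-mapStar⁻ : ∀ {u v x} (p : Star R u v) → x ∈ verts (Star.map g p) → x ∈ verts p
  ∈-mapStar⁻ {x = x} p = subst (x ∈_) (verts-map p)

module _ {V : Set} {R : V → V → Set} (s : ∀ {u v} → R u v → R v u) where

  rev : ∀ {u v} → Star R u v → Star R v u
  rev ε       = ε
  rev (r ◅ p) = rev p ◅◅ (s r ◅ ε)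

  ∈-rev⁺ : ∀ {u v x} (p : Star R u v) → x ∈ verts p → x ∈ verts (rev p)
  ∈-rev⁺ p       (here refl) = end∈ (rev p)
  ∈-rev⁺ (r ◅ p) (there m)   = ∈-◅◅⁺ˡ (rev p) _ (∈-rev⁺ p m)

  ∈-rev⁻ : ∀ {u v x} (p : Star R u v) → x ∈ verts (rev p) → x ∈ verts p
  ∈-rev⁻ ε       m = m
  ∈-rev⁻ (r ◅ p) m with ∈-◅◅⁻ (rev p) (s r ◅ ε) m
  ... | inj₁ l                   = there (∈-rev⁻ p l)
  ... | inj₂ (here refl)         = there (here refl)
  ... | inj₂ (there (here refl)) = here refl

  Simple-rev : ∀ {u v} (p : Star R u v) → Simple p → Simple (rev p)
  Simple-rev ε       sp       = sp
  Simple-rev (_◅_ {i = u} {j = w} r p) (a ∷ sp) =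
    Simple-◅◅⁺ (rev p) (s r ◅ ε) (Simple-rev p sp)
      (((λ e → All.lookup a (here refl) (sym e)) ∷ []) ∷ [] ∷ [])
      λ { l (here e) → e ; l (there (here refl)) → contradiction refl (All.lookup a (∈-rev⁻ p l)) }

module _ {V : Set} (_≟V_ : DecidableEquality V) {R : V → V → Set} where

  open import Data.List.Membership.DecPropositional _≟V_ using (_∈?_)

  record PathInto (B : V → Set) {u b₀ : V} (p₀ : Star R u b₀) : Set where
    constructor pathInto
    field
      {top}   : V
      path    : Star R u top
      top∈B   : B top
      simple  : Simple path
      onlyTop : ∀ {x} → x ∈ verts path → B x → x ≡ top
      inside  : ∀ {x} → x ∈ verts path → x ∈ verts p₀

  -- Loop erasure from the far end: if the start vertex recurs on the path already built, that path
  -- is cut at the recurrence instead of being prolonged. The field `inside` lets avoidance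
  -- properties of the walk pass to the path.
  pathTo : ∀ {B : V → Set} → (∀ x → Dec (B x)) → ∀ {u b} (p : Star R u b) → B b → PathInto B p
  pathTo B? ε       Bb = pathInto ε Bb ([] ∷ []) (λ { (here e) _ → e }) id
  pathTo B? {u} (r ◅ p) Bb with B? u
  ... | yes Bu = pathInto ε Bu ([] ∷ []) (λ { (here e) _ → e }) λ { (here e) → here e }
  ... | no ¬Bu with pathTo B? p Bb
  ...   | pathInto q Bt sq only ins with u ∈? verts q
  ...     | no u∉ = pathInto (r ◅ q) Bt (All.tabulate (λ m e → u∉ (subst (_∈ verts q) (sym e) m)) ∷ sq)
                      (λ { (here refl) Bu → contradiction Bu ¬Bu ; (there m) → only m })
                      (λ { (here e) → here e ; (there m) → there (ins m) })
  ...     | yes u∈ with split q u∈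
  ...       | q₁ , q₂ , refl = pathInto q₂ Bt (proj₁ (proj₂ (Simple-◅◅⁻ q₁ q₂ sq)))
                                 (only ∘ ∈-◅◅⁺ʳ q₁ q₂) (there ∘ ins ∘ ∈-◅◅⁺ʳ q₁ q₂)

  record PathBetween (A B : V → Set) : Set where
    constructor pathBetween
    field
      {bot top} : V
      path      : Star R bot top
      bot∈A     : A bot
      top∈B     : B top
      simple    : Simple path
      onlyBot   : ∀ {x} → x ∈ verts path → A x → x ≡ bot
      onlyTop   : ∀ {x} → x ∈ verts path → B x → x ≡ top

  lastStart : ∀ {A : V → Set} → (∀ x → Dec (A x)) → ∀ {u b} (p : Star R u b) → Simple p → Any A (verts p) →
              ∃₂ λ a (q : Star R a b) → A a × Simple q × (∀ {x} → x ∈ verts q → A x → x ≡ a)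
                                        × (∀ {x} → x ∈ verts q → x ∈ verts p)
  lastStart A? ε       s (here Au) = _ , ε , Au , s , (λ { (here e) _ → e }) , id
  lastStart {A} A? (r ◅ p) s@(_ ∷ sp) m with Any.any? A? (verts p)
  ... | yes m' = let a , q , Aa , sq , only , ins = lastStart A? p sp m' in a , q , Aa , sq , only , there ∘ ins
  ... | no ¬m with m
  ...   | there m'  = contradiction m' ¬m
  ...   | here Au = _ , r ◅ p , Au , s ,
            (λ { (here e) _ → e ; (there l) Ax → contradiction (Any.map (λ { refl → Ax }) l) ¬m }) , id

  opaque
    trim : ∀ {A B : V → Set} → (∀ x → Dec (A x)) → (∀ x → Dec (B x)) →
           ∀ {a b} (p : Star R a b) → A a → B b →
           Σ (PathBetween A B) λ t → ∀ {x} → x ∈ verts (PathBetween.path t) → x ∈ verts p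
    trim {A} A? B? p Aa Bb with pathTo B? p Bb
    ... | pathInto q Bt sq only ins with lastStart A? q sq (here Aa)
    ...   | a , q' , Aa' , sq' , only' , ins' =
            pathBetween q' Aa' Bt sq' only' (only ∘ ins') , ins ∘ ins'

module _ {V : Set} (_≟V_ : DecidableEquality V) {R T : V → V → Set} (g : ∀ {u v} → R u v → T u v) where

  mapBetween : ∀ {A B : V → Set} → PathBetween _≟V_ {R} A B → PathBetween _≟V_ {T} A B
  mapBetween (pathBetween p Aa Bb s onlyB onlyT) =
    pathBetween (Star.map g p) Aa Bb (subst Unique (sym (verts-map g p)) s)
      (λ m → onlyB (∈-mapStar⁻ g p m)) (λ m → onlyT (∈-mapStar⁻ g p m))

-- Menger's theorem

module _ {n : ℕ} where

  private V = Fin n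

  open import Data.Vec.Membership.DecPropositional (_≟_ {n}) using () renaming (_∈?_ to _∈ᵛ?_)

  Arc : List (V × V) → V → V → Set
  Arc L u v = (u , v) ∈ L

  weaken : ∀ {L e u v} → Star (Arc L) u v → Star (Arc (e ∷ L)) u v
  weaken = Star.map there

  -- The second case keeps the prefix before the first use of the arc and the suffix after the last
  -- one. Reachability with one more arc thus reduces to three reachability questions without it,
  -- which makes it decidable by recursion on the arc list.
  splitAtArc : ∀ {L x y u v} → Star (Arc ((x , y) ∷ L)) u v →
               Star (Arc L) u v ⊎ (Star (Arc L) u x × Star (Arc L) y v)
  splitAtArc ε = inj₁ ε
  splitAtArc (here refl ◅ p) with splitAtArc p
  ... | inj₁ q       = inj₂ (ε , q)
  ... | inj₂ (_ , q) = inj₂ (ε , q)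
  splitAtArc (there a ◅ p) with splitAtArc p
  ... | inj₁ q       = inj₁ (a ◅ q)
  ... | inj₂ (q , r) = inj₂ (a ◅ q , r)

  arcStar? : ∀ L u v → Dec (Star (Arc L) u v)
  arcStar? []            u v = map′ (λ { refl → ε }) (λ { ε → refl }) (u ≟ v)
  arcStar? ((x , y) ∷ L) u v =
    map′ (λ { (inj₁ p) → weaken p ; (inj₂ (p , q)) → weaken p ◅◅ here refl ◅ weaken q })
         splitAtArc
         (arcStar? L u v ⊎-dec (arcStar? L u x ×-dec arcStar? L y v))

  arcList : {R : V → V → Set} → (∀ u v → Dec (R u v)) → List (V × V)
  arcList R? = filter (λ (u , v) → R? u v) (cartesianProduct (allFin n) (allFin n))

  ∈-arcs⁺ : {R : V → V → Set} (R? : ∀ u v → Dec (R u v)) → ∀ {u v} → R u v → Arc (arcList R?) u v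
  ∈-arcs⁺ R? {u} {v} = ∈-filter⁺ _ (∈-cartesianProduct⁺ (∈-allFin u) (∈-allFin v))

  ∈-arcs⁻ : {R : V → V → Set} (R? : ∀ u v → Dec (R u v)) → ∀ {u v} → Arc (arcList R?) u v → R u v
  ∈-arcs⁻ R? m = proj₂ (∈-filter⁻ (λ (u , v) → R? u v) {xs = cartesianProduct (allFin n) (allFin n)} m)

  opaque
    star? : {R : V → V → Set} → (∀ u v → Dec (R u v)) → ∀ u v → Dec (Star R u v)
    star? R? u v = map′ (Star.map (∈-arcs⁻ R?)) (Star.map (∈-arcs⁺ R?)) (arcStar? (arcList R?) u v)

  Avoids : ∀ {k} {R : V → V → Set} {u v} → Star R u v → Vec V k → Set
  Avoids p X = ∀ {x} → x ∈ verts p → x Vec.∉ X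

  -- Entries of X may repeat, so the vectors of length k stand for all nonempty sets of at most k
  -- vertices.
  Linked : (V → V → Set) → (A B : V → Set) → ∀ {k} → Vec V k → Set
  Linked R A B X = ∃₂ λ a b → A a × B b × Σ (Star R a b) λ p → Avoids p X

  linked? : ∀ L {A B : V → Set} → (∀ x → Dec (A x)) → (∀ x → Dec (B x)) → ∀ {k} (X : Vec V k) → Dec (Linked (Arc L) A B X)
  linked? L A? B? X = map′
      (λ { (a , b , Aa , Bb , a∉ , p) → a , b , Aa , Bb , Star.map proj₁ p , λ m → avoids a∉ p (∈-mapStar⁻ proj₁ p m) })
      (λ { (a , b , Aa , Bb , p , av) → a , b , Aa , Bb , av (here refl) , restrict p av })
      (any? λ a → any? λ b → A? a ×-dec B? b ×-dec ¬? (a ∈ᵛ? X) ×-dec star? step? a b)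
    where
    open import Data.List.Membership.DecPropositional (Product.≡-dec (_≟_ {n}) (_≟_ {n})) using () renaming (_∈?_ to _∈ᵃ?_)
    Step : V → V → Set
    Step u v = Arc L u v × v Vec.∉ X
    step? : ∀ u v → Dec (Step u v)
    step? u v = ((u , v) ∈ᵃ? L) ×-dec ¬? (v ∈ᵛ? X)
    avoids : ∀ {u v} → u Vec.∉ X → (p : Star Step u v) → Avoids p X
    avoids u∉ p             (here refl) = u∉
    avoids u∉ ((_ , w∉) ◅ p) (there m)  = avoids w∉ p m
    restrict : ∀ {u v} (p : Star (Arc L) u v) → Avoids p X → Star Step u v
    restrict ε       av = ε
    restrict (a ◅ p) av = (a , av (there (here refl))) ◅ restrict p (av ∘ there)

  -- Exhaustive search over vectors. It makes the case distinction in Menger's theorem constructive: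
  -- either every X leaves a link, or an explicit separator is at hand.
  allVec⊎anyVec¬ : ∀ k {P : Vec V k → Set} → (∀ X → Dec (P X)) → (∀ X → P X) ⊎ ∃ λ X → ¬ P X
  allVec⊎anyVec¬ zero P? with P? []
  ... | yes p = inj₁ λ { [] → p }
  ... | no ¬p = inj₂ ([] , ¬p)
  allVec⊎anyVec¬ (suc k) {P} P? with any? {P = λ x → ∃ λ X → ¬ P (x ∷ X)} (λ x → dec (allVec⊎anyVec¬ k (P? ∘ (x ∷_))))
    where
    dec : ∀ {Q : Vec V k → Set} → (∀ X → Q X) ⊎ (∃ λ X → ¬ Q X) → Dec (∃ λ X → ¬ Q X)
    dec (inj₁ all) = no λ (X , ¬q) → ¬q (all X)
    dec (inj₂ ex)  = yes ex
  ... | yes (x , X , ¬p) = inj₂ (x ∷ X , ¬p)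
  ... | no none          = inj₁ λ { (x ∷ X) → decidable-stable (P? (x ∷ X)) λ ¬p → none (x , X , ¬p) }

  injective⇒onto : ∀ {k} (σ : Fin k → Fin k) → Injective _≡_ _≡_ σ → ∀ t → ∃ λ i → σ i ≡ t
  injective⇒onto {suc k} σ inj t with any? (λ i → σ i ≟ t)
  ... | yes hit = hit
  ... | no miss = contradiction (Fin.injective⇒≤ {f = λ i → Fin.punchOut (t≢ i)} λ eq → inj (Fin.punchOut-injective (t≢ _) (t≢ _) eq)) ℕ.1+n≰n
    where
    t≢ : ∀ i → t ≢ σ i
    t≢ i eq = miss (i , sym eq)

  DisjointPaths : (V → V → Set) → (A B : V → Set) → ℕ → Set
  DisjointPaths R A B k = Σ (Fin k → PathBetween _≟_ {R = R} A B) λ F →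
    ∀ {i j x} → x ∈ verts (PathBetween.path (F i)) → x ∈ verts (PathBetween.path (F j)) → i ≡ j

  distinctWitnesses : V → ∀ {A : V → Set} k → (∀ (X : Vec V k) → ∃ λ a → A a × a Vec.∉ X) →
                      Σ (Fin (suc k) → V) λ F → (∀ i → A (F i)) × Injective _≡_ _≡_ F
  distinctWitnesses v₀ zero    H = let a , Aa , _ = H [] in (λ _ → a) , (λ _ → Aa) , λ { {zero} {zero} _ → refl }
  -- The vertex `v₀` pads the shorter vector to the length that `H` expects; the new witness then
  -- avoids all the earlier ones.
  distinctWitnesses v₀ {A} (suc k) H with distinctWitnesses v₀ {A} k (λ X → let a , Aa , a∉ = H (v₀ ∷ X) in a , Aa , a∉ ∘ there)
  ... | F , AF , inj with H (Vec.tabulate F)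
  ...   | a , Aa , a∉ = F' , AF' , inj'
    where
    F' : Fin (suc (suc k)) → V
    F' zero    = a
    F' (suc i) = F i
    AF' : ∀ i → A (F' i)
    AF' zero    = Aa
    AF' (suc i) = AF i
    inj' : Injective _≡_ _≡_ F'
    inj' {zero}  {zero}  e = refl
    inj' {zero}  {suc j} e = contradiction (subst (Vec._∈ Vec.tabulate F) (sym e) (Vec.∈-tabulate⁺ F j)) a∉
    inj' {suc i} {zero}  e = contradiction (subst (Vec._∈ Vec.tabulate F) e (Vec.∈-tabulate⁺ F i)) a∉
    inj' {suc i} {suc j} e = cong suc (inj e)

  -- Cuts a walk in x∷L at its first vertex in P ∋ x: before it the arc (x , y) is not used.
  beforeSeparator : ∀ {L x y k} (P : Vec V k) → x Vec.∈ P → ∀ {a b} (p : Star (Arc ((x , y) ∷ L)) a b) →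
    (∃ λ c → c Vec.∈ P × Σ (Star (Arc L) a c) λ q → ∀ {z} → z ∈ verts q → z ∈ verts p)
    ⊎ (Σ (Star (Arc L) a b) λ q → Avoids q P × (∀ {z} → z ∈ verts q → z ∈ verts p))
  beforeSeparator P x∈ {a} p with a ∈ᵛ? P
  beforeSeparator P x∈ p | yes a∈ = inj₁ (_ , a∈ , ε , λ { (here e) → here e })
  beforeSeparator P x∈ ε | no a∉  = inj₂ (ε , (λ { (here refl) → a∉ }) , id)
  beforeSeparator P x∈ (here refl ◅ p) | no a∉ = contradiction x∈ a∉
  beforeSeparator P x∈ (there r ◅ p)   | no a∉ with beforeSeparator P x∈ p
  ... | inj₁ (c , c∈ , q , ins) = inj₁ (c , c∈ , r ◅ q , λ { (here e) → here e ; (there m) → there (ins m) })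
  ... | inj₂ (q , av , ins)     = inj₂ (r ◅ q , (λ { (here refl) → a∉ ; (there m) → av m }) ,
                                        λ { (here e) → here e ; (there m) → there (ins m) })

  -- The mirror image: the walk is cut at its last vertex in Q. After that the arc (x , y) cannot
  -- occur, since it would lead to y, which is in Q.
  afterSeparator : ∀ {L x y k} (Q : Vec V k) → y Vec.∈ Q → ∀ {a b} (p : Star (Arc ((x , y) ∷ L)) a b) →
    (∃ λ c → c Vec.∈ Q × Σ (Star (Arc L) c b) λ q → ∀ {z} → z ∈ verts q → z ∈ verts p)
    ⊎ (Σ (Star (Arc L) a b) λ q → Avoids q Q × (∀ {z} → z ∈ verts q → z ∈ verts p))
  afterSeparator Q y∈ {a} ε with a ∈ᵛ? Q
  ... | yes a∈ = inj₁ (_ , a∈ , ε , id)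
  ... | no a∉  = inj₂ (ε , (λ { (here refl) → a∉ }) , id)
  afterSeparator Q y∈ {a} (r ◅ p) with afterSeparator Q y∈ p
  ... | inj₁ (c , c∈ , q , ins) = inj₁ (c , c∈ , q , there ∘ ins)
  ... | inj₂ (q , av , ins) with r
  ...   | here refl = contradiction y∈ (av (here refl))
  ...   | there r' with a ∈ᵛ? Q
  ...     | yes a∈ = inj₁ (_ , a∈ , r' ◅ q , λ { (here e) → here e ; (there m) → there (ins m) })
  ...     | no a∉  = inj₂ (r' ◅ q , (λ { (here refl) → a∉ ; (there m) → av m }) ,
                           λ { (here e) → here e ; (there m) → there (ins m) })

  module _ {L x y k} {A B : V → Set} (A? : ∀ x → Dec (A x)) (B? : ∀ x → Dec (B x)) (X : Vec V k)
           (¬link : ¬ Linked (Arc L) A B X)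
           (FP : DisjointPaths (Arc L) A (Vec._∈ (x ∷ X)) (suc k))
           (FQ : DisjointPaths (Arc L) (Vec._∈ (y ∷ X)) B (suc k)) where

    private
      P Q : Vec V (suc k)
      P = x ∷ X
      Q = y ∷ X

      module FP i = PathBetween (proj₁ FP i)
      module FQ i = PathBetween (proj₁ FQ i)

      -- The position in P where a path ends, or in Q where it starts. Disjointness makes both maps
      -- injective and hence permutations, so the two families can be indexed by the positions of P
      -- and Q and matched.
      σ τ : Fin (suc k) → Fin (suc k)
      σ i = VecAny.index (FP.top∈B i)
      τ i = VecAny.index (FQ.bot∈A i)
      σ-top : ∀ i → FP.top i ≡ Vec.lookup P (σ i)
      σ-top i = VecAny.lookup-index (FP.top∈B i)
      τ-bot : ∀ i → FQ.bot i ≡ Vec.lookup Q (τ i)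
      τ-bot i = VecAny.lookup-index (FQ.bot∈A i)

      σ⁻¹ : ∀ t → ∃ λ i → σ i ≡ t
      σ⁻¹ = injective⇒onto σ λ {i} {j} e → proj₂ FP (end∈ (FP.path i))
        (subst (_∈ verts (FP.path j)) (trans (σ-top j) (trans (cong (Vec.lookup P) (sym e)) (sym (σ-top i)))) (end∈ (FP.path j)))
      τ⁻¹ : ∀ t → ∃ λ i → τ i ≡ t
      τ⁻¹ = injective⇒onto τ λ {i} {j} e → proj₂ FQ (here refl)
        (here (trans (τ-bot i) (trans (cong (Vec.lookup Q) e) (sym (τ-bot j)))))

      pre : ∀ t → Σ V λ a → A a × Σ (Star (Arc L) a (Vec.lookup P t)) λ p → Simple p ×
                  ∀ {z} → z ∈ verts p → z ∈ verts (FP.path (proj₁ (σ⁻¹ t)))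
      pre t = let i , e = σ⁻¹ t in
        _ , FP.bot∈A i , retarget (FP.path i) (FP.simple i) (trans (σ-top i) (cong (Vec.lookup P) e))

      post : ∀ t → Σ V λ b → B b × Σ (Star (Arc L) (Vec.lookup Q t) b) λ q → Simple q ×
                   ∀ {z} → z ∈ verts q → z ∈ verts (FQ.path (proj₁ (τ⁻¹ t)))
      post t = let i , e = τ⁻¹ t in
        _ , FQ.top∈B i , resource (FQ.path i) (FQ.simple i) (trans (τ-bot i) (cong (Vec.lookup Q) e))

      pre-path : ∀ t → Star (Arc L) (proj₁ (pre t)) (Vec.lookup P t)
      pre-path t = proj₁ (proj₂ (proj₂ (pre t)))
      post-path : ∀ t → Star (Arc L) (Vec.lookup Q t) (proj₁ (post t))
      post-path t = proj₁ (proj₂ (proj₂ (post t)))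

      pre-disj : ∀ {s t z} → z ∈ verts (pre-path s) → z ∈ verts (pre-path t) → s ≡ t
      pre-disj {s} {t} m m' = trans (sym (proj₂ (σ⁻¹ s))) (trans (cong σ
        (proj₂ FP (proj₂ (proj₂ (proj₂ (proj₂ (pre s)))) m) (proj₂ (proj₂ (proj₂ (proj₂ (pre t)))) m'))) (proj₂ (σ⁻¹ t)))
      post-disj : ∀ {s t z} → z ∈ verts (post-path s) → z ∈ verts (post-path t) → s ≡ t
      post-disj {s} {t} m m' = trans (sym (proj₂ (τ⁻¹ s))) (trans (cong τ
        (proj₂ FQ (proj₂ (proj₂ (proj₂ (proj₂ (post s)))) m) (proj₂ (proj₂ (proj₂ (proj₂ (post t)))) m'))) (proj₂ (τ⁻¹ t)))

      -- Otherwise following the first path to z and the second from z gives a walk from A to B in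
      -- L. If this walk met X at w, disjointness would make w the end of the first path or the
      -- start of the second; simplicity then gives z ≡ w, and this vertex of X lies on both
      -- families at the same position.
      cross : ∀ {s t z} → z ∈ verts (pre-path s) → z ∈ verts (post-path t) → s ≡ t
      cross {s} {t} {z} m m' = decidable-stable (s ≟ t) λ s≢t → ¬link
        (let p₁ , p₂ , ep = split (pre-path s) m
             q₁ , q₂ , eq = split (post-path t) m'
         in _ , _ , proj₁ (proj₂ (pre s)) , proj₁ (proj₂ (post t)) , p₁ ◅◅ q₂ , λ {w} w∈ w∈X →
            let t' = VecAny.index w∈X
                w≡ = VecAny.lookup-index w∈X
            in case ∈-◅◅⁻ p₁ q₂ w∈ of λ
            { (inj₁ w∈p₁) →
                let s≡ = pre-disj (subst (λ p → w ∈ verts p) (sym ep) (∈-◅◅⁺ˡ p₁ p₂ w∈p₁))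
                           (subst (_∈ verts (pre-path (suc t'))) (sym w≡) (end∈ (pre-path (suc t'))))
                    top≡w = trans (cong (Vec.lookup P) s≡) (sym w≡)
                    _ , sp₂ , only = Simple-◅◅⁻ p₁ p₂ (subst Simple ep (proj₁ (proj₂ (proj₂ (proj₂ (pre s))))))
                    w≡z = trans (sym top≡w) (only (subst (_∈ verts p₁) (sym top≡w) w∈p₁) (end∈ p₂))
                in s≢t (trans s≡ (post-disj (here (trans (sym w≡z) w≡)) m'))
            ; (inj₂ w∈q₂) →
                let t≡ = post-disj {t} {suc t'} (subst (λ p → w ∈ verts p) (sym eq) (∈-◅◅⁺ʳ q₁ q₂ w∈q₂)) (here w≡)
                    bot≡w = trans (cong (Vec.lookup Q) t≡) (sym w≡)
                    _ , _ , only = Simple-◅◅⁻ q₁ q₂ (subst Simple eq (proj₁ (proj₂ (proj₂ (proj₂ (post t))))))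
                    w≡z = trans (sym bot≡w) (only (here refl) (subst (_∈ verts q₂) (sym bot≡w) w∈q₂))
                in s≢t (trans (pre-disj m (subst (_∈ verts (pre-path (suc t'))) (trans (sym w≡) w≡z) (end∈ (pre-path (suc t'))))) (sym t≡))
            })

      glued : ∀ t → Σ (Star (Arc ((x , y) ∷ L)) (proj₁ (pre t)) (proj₁ (post t))) λ p →
                    ∀ {z} → z ∈ verts p → z ∈ verts (pre-path t) ⊎ z ∈ verts (post-path t)
      -- Position zero holds x in P and y in Q, joined by the arc being restored; every other
      -- position holds the same vertex of X in both, so there the paths are concatenated directly.
      glued zero = weaken (pre-path zero) ◅◅ (here refl ◅ weaken (post-path zero)) ,
        λ m → case ∈-◅◅⁻ (weaken (pre-path zero)) _ m of λ
        { (inj₁ l)           → inj₁ (∈-mapStar⁻ there (pre-path zero) l)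
        ; (inj₂ (here refl)) → inj₁ (end∈ (pre-path zero))
        ; (inj₂ (there l))   → inj₂ (∈-mapStar⁻ there (post-path zero) l) }
      glued (suc t) = weaken (pre-path (suc t)) ◅◅ weaken (post-path (suc t)) ,
        λ m → case ∈-◅◅⁻ (weaken (pre-path (suc t))) _ m of λ
        { (inj₁ l) → inj₁ (∈-mapStar⁻ there (pre-path (suc t)) l)
        ; (inj₂ l) → inj₂ (∈-mapStar⁻ there (post-path (suc t)) l) }

      trimmed : ∀ t → Σ (PathBetween _≟_ A B) λ g → ∀ {z} → z ∈ verts (PathBetween.path g) → z ∈ verts (proj₁ (glued t))
      trimmed t = trim _≟_ A? B? (proj₁ (glued t)) (proj₁ (proj₂ (pre t))) (proj₁ (proj₂ (post t)))

      G : Fin (suc k) → PathBetween _≟_ A B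
      G t = proj₁ (trimmed t)

      disj : ∀ i j {z} → z ∈ verts (PathBetween.path (G i)) → z ∈ verts (PathBetween.path (G j)) → i ≡ j
      disj i j m m' with proj₂ (glued i) (proj₂ (trimmed i) m) | proj₂ (glued j) (proj₂ (trimmed j) m')
      ... | inj₁ l | inj₁ r = pre-disj l r
      ... | inj₁ l | inj₂ r = cross l r
      ... | inj₂ l | inj₁ r = sym (cross r l)
      ... | inj₂ l | inj₂ r = post-disj l r

    glue : DisjointPaths (Arc ((x , y) ∷ L)) A B (suc k)
    glue = G , λ {i} {j} → disj i j

  -- Göring's proof of Menger's theorem: if deleting the arc (x , y) creates a separator X of size k,
  -- then x ∷ X and y ∷ X separate too, and the linkages from A to x ∷ X and from y ∷ X to B,
  -- which avoid (x , y), can be glued.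
  menger-arcList : V → ∀ L {A B : V → Set} → (∀ x → Dec (A x)) → (∀ x → Dec (B x)) → ∀ k →
                (∀ (X : Vec V k) → Linked (Arc L) A B X) → DisjointPaths (Arc L) A B (suc k)
  menger-arcList v₀ [] {A} {B} A? B? k H with distinctWitnesses v₀ {A = λ v → A v × B v} k
      (λ X → case H X of λ { (a , .a , Aa , Bb , ε , av) → a , (Aa , Bb) , av (here refl) })
  ... | F , AB , inj =
    (λ i → pathBetween ε (proj₁ (AB i)) (proj₂ (AB i)) ([] ∷ []) (λ { (here e) _ → e }) (λ { (here e) _ → e })) ,
    λ { (here e) (here e') → inj (trans (sym e) e') }
  menger-arcList v₀ ((x , y) ∷ L) {A} {B} A? B? k H with allVec⊎anyVec¬ k (linked? L A? B?)
  ... | inj₁ H' with menger-arcList v₀ L A? B? k H'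
  ...   | F , disj = G , λ {i} {j} m m' → disj (conv i m) (conv j m')
    where
    G : Fin (suc k) → PathBetween _≟_ A B
    G i = mapBetween _≟_ there (F i)
    conv : ∀ i {z} → z ∈ verts (PathBetween.path (G i)) → z ∈ verts (PathBetween.path (F i))
    conv i = ∈-mapStar⁻ there (PathBetween.path (F i))
  menger-arcList v₀ ((x , y) ∷ L) {A} {B} A? B? k H | inj₂ (X , ¬link) =
      glue A? B? X ¬link (menger-arcList v₀ L A? (_∈ᵛ? P) k HP) (menger-arcList v₀ L (_∈ᵛ? Q) B? k HQ)
    where
    P Q : Vec V (suc k)
    P = x ∷ X
    Q = y ∷ X

    HP : ∀ Y → Linked (Arc L) A (Vec._∈ P) Y
    HP Y with H Y
    ... | a , b , Aa , Bb , p , av with beforeSeparator P (here refl) p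
    ...   | inj₁ (c , c∈ , q , ins) = a , c , Aa , c∈ , q , av ∘ ins
    ...   | inj₂ (q , avP , _)      = ⊥-elim (¬link (a , b , Aa , Bb , q , λ m m' → avP m (there m')))

    HQ : ∀ Y → Linked (Arc L) (Vec._∈ Q) B Y
    HQ Y with H Y
    ... | a , b , Aa , Bb , p , av with afterSeparator Q (here refl) p
    ...   | inj₁ (c , c∈ , q , ins) = c , b , c∈ , Bb , q , av ∘ ins
    ...   | inj₂ (q , avQ , _)      = ⊥-elim (¬link (a , b , Aa , Bb , q , λ m m' → avQ m (there m')))

  opaque
    menger : V → ∀ {R : V → V → Set} → (∀ u v → Dec (R u v)) → ∀ {A B : V → Set} → (∀ x → Dec (A x)) → (∀ x → Dec (B x)) →
             ∀ k → (∀ (X : Vec V k) → Linked R A B X) → DisjointPaths R A B (suc k)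
    menger v₀ {R} R? {A} {B} A? B? k H with menger-arcList v₀ (arcList R?) A? B? k
        (λ X → let a , b , Aa , Bb , p , av = H X
               in a , b , Aa , Bb , Star.map (∈-arcs⁺ R?) p , av ∘ ∈-mapStar⁻ (∈-arcs⁺ R?) p)
    ... | F , disj = mapBetween _≟_ (∈-arcs⁻ R?) ∘ F ,
                     λ {i} {j} m m' → disj (∈-mapStar⁻ (∈-arcs⁻ R?) (PathBetween.path (F i)) m)
                                           (∈-mapStar⁻ (∈-arcs⁻ R?) (PathBetween.path (F j)) m')

-- Circuits

module _ {k : ℕ} where

  next-view : (i : Fin (suc k)) → (toℕ i ≡ k × next i ≡ zero) ⊎ toℕ (next i) ≡ suc (toℕ i)
  next-view i with k ℕ.≟ toℕ i
  ... | yes e = inj₁ (sym e , refl)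
  ... | no ne = inj₂ (cong suc (Fin.toℕ-lower₁ i ne))

  next-fromℕ : next (fromℕ k) ≡ zero
  next-fromℕ with next-view (fromℕ k)
  ... | inj₁ (_ , e) = e
  ... | inj₂ e       = contradiction (subst (suc k ≤_) (sym (trans e (cong suc (Fin.toℕ-fromℕ k)))) ℕ.≤-refl) (ℕ.<⇒≱ (Fin.toℕ<n (next (fromℕ k))))

  next-inject₁ : (i : Fin k) → next (inject₁ i) ≡ suc i
  next-inject₁ i with next-view (inject₁ i)
  ... | inj₁ (e , _) = contradiction (trans (sym (Fin.toℕ-inject₁ i)) e) (ℕ.<⇒≢ (Fin.toℕ<n i))
  ... | inj₂ e       = Fin.toℕ-injective (trans e (cong suc (Fin.toℕ-inject₁ i)))

  prev : Fin (suc k) → Fin (suc k)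
  prev zero    = fromℕ k
  prev (suc i) = inject₁ i

  next-prev : ∀ i → next (prev i) ≡ i
  next-prev zero    = next-fromℕ
  next-prev (suc i) = next-inject₁ i

  prev-next : ∀ i → prev (next i) ≡ i
  prev-next i with view i
  ... | ‵fromℕ     = cong prev next-fromℕ
  ... | ‵inject₁ j = cong prev (next-inject₁ j)

  next-injective : ∀ {i j} → next i ≡ next j → i ≡ j
  next-injective {i} {j} e = trans (sym (prev-next i)) (trans (cong prev e) (prev-next j))

  next²≢ : 2 ≤ k → ∀ i → next (next i) ≢ i
  next²≢ 2≤k i e with next-view i | next-view (next i)
  ... | inj₂ e₁        | inj₂ e₂        = ℕ.<⇒≢ (ℕ.m<n⇒m<1+n (ℕ.n<1+n (toℕ i))) (trans (cong toℕ (sym e)) (trans e₂ (cong suc e₁)))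
  ... | inj₁ (e₁ , z₁) | inj₁ (e₂ , _) = ℕ.<⇒≢ (ℕ.≤-trans (s≤s z≤n) 2≤k) (trans (cong toℕ (sym z₁)) e₂)
  ... | inj₁ (e₁ , z₁) | inj₂ e₂ =
    ℕ.<⇒≢ 2≤k (trans (sym (trans e₂ (cong (suc ∘ toℕ) z₁))) (trans (cong toℕ e) e₁))
  ... | inj₂ e₁ | inj₁ (e₂ , z₂) =
    ℕ.<⇒≢ 2≤k (trans (cong suc (trans (cong toℕ (sym z₂)) (cong toℕ e))) (trans (sym e₁) e₂))

module _ {A : Set} where

  lookup-injective : ∀ {xs : List A} → Unique xs → Injective _≡_ _≡_ (lookup xs)
  lookup-injective (_ ∷ _)  {zero}  {zero}  eq = refl
  lookup-injective (a ∷ _)  {zero}  {suc j} eq = contradiction eq (All.lookup a (∈-lookup j))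
  lookup-injective (a ∷ _)  {suc i} {zero}  eq = contradiction (sym eq) (All.lookup a (∈-lookup i))
  lookup-injective (_ ∷ us) {suc i} {suc j} eq = cong suc (lookup-injective us eq)

module OnGraph {n : ℕ} (G : Graph n) where

  private V = Fin n

  Inc : V → Edge G → Set
  Inc z e = z ≡ proj₁ (proj₁ e) ⊎ z ≡ proj₂ (proj₁ e)

  Adj-sym : ∀ {u v} → Adj G u v → Adj G v u
  Adj-sym {u} {v} = trans (Graph.sym G v u)

  Adj⇒≢ : ∀ {u v} → Adj G u v → u ≢ v
  Adj⇒≢ {u} a refl with () ← trans (sym (irrefl G u)) a

  adj? : ∀ u v → Dec (Adj G u v)
  adj? u v = adj G u v Bool.≟ true

  edge-≡ : ∀ {e e' : Edge G} → proj₁ e ≡ proj₁ e' → e ≡ e'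
  edge-≡ {p , lt , a} {.p , lt' , a'} refl = cong₂ (λ l b → p , l , b) (Fin.<-irrelevant lt lt') (Decidable⇒UIP.≡-irrelevant Bool._≟_ a a')

  infix 4 _≟ᴱ_
  _≟ᴱ_ : DecidableEquality (Edge G)
  e ≟ᴱ e' = map′ edge-≡ (cong proj₁) (Product.≡-dec _≟_ _≟_ (proj₁ e) (proj₁ e'))

  inc? : ∀ z e → Dec (Inc z e)
  inc? z e = (z ≟ _) ⊎-dec (z ≟ _)

  edge : ∀ {u v} → Adj G u v → Edge G
  edge {u} {v} a with Fin.<-cmp u v
  ... | tri< lt _ _ = (u , v) , lt , a
  ... | tri≈ _ eq _ = contradiction eq (Adj⇒≢ a)
  ... | tri> _ _ gt = (v , u) , gt , Adj-sym a

  joins-edge : ∀ {u v} (a : Adj G u v) → Joins G (edge a) u v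
  joins-edge {u} {v} a with Fin.<-cmp u v
  ... | tri< lt _ _ = inj₁ refl
  ... | tri≈ _ eq _ = contradiction eq (Adj⇒≢ a)
  ... | tri> _ _ gt = inj₂ refl

  edge-adj : (e : Edge G) → Adj G (proj₁ (proj₁ e)) (proj₂ (proj₁ e))
  edge-adj e = proj₂ (proj₂ e)

  Joins-sym : ∀ {e u v} → Joins G e u v → Joins G e v u
  Joins-sym (inj₁ eq) = inj₂ eq
  Joins-sym (inj₂ eq) = inj₁ eq

  Joins⇒Incˡ : ∀ {e u v} → Joins G e u v → Inc u e
  Joins⇒Incˡ (inj₁ refl) = inj₁ refl
  Joins⇒Incˡ (inj₂ refl) = inj₂ refl

  Joins⇒Incʳ : ∀ {e u v} → Joins G e u v → Inc v e
  Joins⇒Incʳ {e} j = Joins⇒Incˡ {e} (Joins-sym {e} j)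

  Inc-Joins : ∀ {e u v z} → Joins G e u v → Inc z e → z ≡ u ⊎ z ≡ v
  Inc-Joins (inj₁ refl) i         = i
  Inc-Joins (inj₂ refl) (inj₁ eq) = inj₂ eq
  Inc-Joins (inj₂ refl) (inj₂ eq) = inj₁ eq

  Joins-unique : ∀ {e e' u v} → Joins G e u v → Joins G e' u v → e ≡ e'
  Joins-unique (inj₁ refl) (inj₁ refl) = edge-≡ refl
  Joins-unique (inj₂ refl) (inj₂ refl) = edge-≡ refl
  Joins-unique {_ , lt , _} {_ , lt' , _} (inj₁ refl) (inj₂ refl) = contradiction lt' (Fin.<-asym lt)
  Joins-unique {_ , lt , _} {_ , lt' , _} (inj₂ refl) (inj₁ refl) = contradiction lt' (Fin.<-asym lt)

  Inc²⇒Joins : ∀ {e u v} → u ≢ v → Inc u e → Inc v e → Joins G e u v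
  Inc²⇒Joins ne (inj₁ refl) (inj₁ refl) = contradiction refl ne
  Inc²⇒Joins ne (inj₁ refl) (inj₂ refl) = inj₁ refl
  Inc²⇒Joins ne (inj₂ refl) (inj₁ refl) = inj₂ refl
  Inc²⇒Joins ne (inj₂ refl) (inj₂ refl) = contradiction refl ne

  edge-unique : ∀ {u v} (a b : Adj G u v) → edge a ≡ edge b
  edge-unique a b = Joins-unique {edge a} {edge b} (joins-edge a) (joins-edge b)

  edge-sym : ∀ {u v} (a : Adj G u v) (b : Adj G v u) → edge a ≡ edge b
  edge-sym a b = Joins-unique {edge a} {edge b} (joins-edge a) (Joins-sym {edge b} (joins-edge b))

  Joins⇒≢ : ∀ {e u v} → Joins G e u v → u ≢ v
  Joins⇒≢ {e} (inj₁ refl) = Adj⇒≢ (edge-adj e)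
  Joins⇒≢ {e} (inj₂ refl) = ≢-sym (Adj⇒≢ (edge-adj e))

  Joins⇒Adj : ∀ {e u v} → Joins G e u v → Adj G u v
  Joins⇒Adj {e} (inj₁ refl) = edge-adj e
  Joins⇒Adj {e} (inj₂ refl) = Adj-sym (edge-adj e)

  edge-Joins : ∀ {e u v} (a : Adj G u v) → Joins G e u v → edge a ≡ e
  edge-Joins {e} a j = Joins-unique {edge a} {e} (joins-edge a) j

  incident : ∀ {z e} → Inc z e → ∃₂ λ t (a : Adj G z t) → edge a ≡ e
  incident {e = e} (inj₁ refl) = _ , edge-adj e , edge-Joins {e} (edge-adj e) (inj₁ refl)
  incident {e = e} (inj₂ refl) = _ , Adj-sym (edge-adj e) , edge-Joins {e} (Adj-sym (edge-adj e)) (inj₂ refl)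

  Path : V → V → Set
  Path = Star (Adj G)

  edges : ∀ {u v} → Path u v → List (Edge G)
  edges ε       = []
  edges (a ◅ p) = edge a ∷ edges p

  edges-◅◅ : ∀ {u v w} (p : Path u v) (q : Path v w) → edges (p ◅◅ q) ≡ edges p ++ edges q
  edges-◅◅ ε       q = refl
  edges-◅◅ (a ◅ p) q = cong (edge a ∷_) (edges-◅◅ p q)

  ∈-edges-◅◅⁻ : ∀ {u v w e} (p : Path u v) (q : Path v w) → e ∈ edges (p ◅◅ q) → e ∈ edges p ⊎ e ∈ edges q
  ∈-edges-◅◅⁻ {e = e} p q m = ∈-++⁻ (edges p) (subst (e ∈_) (edges-◅◅ p q) m)

  ∈-edges-◅◅⁺ˡ : ∀ {u v w e} (p : Path u v) (q : Path v w) → e ∈ edges p → e ∈ edges (p ◅◅ q)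
  ∈-edges-◅◅⁺ˡ {e = e} p q m = subst (e ∈_) (sym (edges-◅◅ p q)) (∈-++⁺ˡ m)

  ∈-edges-◅◅⁺ʳ : ∀ {u v w e} (p : Path u v) (q : Path v w) → e ∈ edges q → e ∈ edges (p ◅◅ q)
  ∈-edges-◅◅⁺ʳ {e = e} p q m = subst (e ∈_) (sym (edges-◅◅ p q)) (∈-++⁺ʳ (edges p) m)

  reverse : ∀ {u v} → Path u v → Path v u
  reverse = rev Adj-sym

  ∈-edges-reverse⁻ : ∀ {u v e} (p : Path u v) → e ∈ edges (reverse p) → e ∈ edges p
  ∈-edges-reverse⁻ (a ◅ p) m with ∈-edges-◅◅⁻ (reverse p) (Adj-sym a ◅ ε) m
  ... | inj₁ l        = there (∈-edges-reverse⁻ p l)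
  ... | inj₂ (here e) = here (trans e (edge-sym (Adj-sym a) a))

  ∈-edges-reverse⁺ : ∀ {u v e} (p : Path u v) → e ∈ edges p → e ∈ edges (reverse p)
  ∈-edges-reverse⁺ (a ◅ p) (here e)  = ∈-edges-◅◅⁺ʳ (reverse p) _ (here (trans e (edge-sym a (Adj-sym a))))
  ∈-edges-reverse⁺ (a ◅ p) (there m) = ∈-edges-◅◅⁺ˡ (reverse p) _ (∈-edges-reverse⁺ p m)

  Inc-edges : ∀ {u v e z} (p : Path u v) → e ∈ edges p → Inc z e → z ∈ verts p
  Inc-edges (a ◅ p) (here refl) i with Inc-Joins {edge a} (joins-edge a) i
  ... | inj₁ e = here e
  ... | inj₂ e = there (here e)
  Inc-edges (a ◅ p) (there m) i = there (Inc-edges p m i)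

  Unique-edges : ∀ {u v} (p : Path u v) → Simple p → Unique (edges p)
  Unique-edges ε       s        = []
  Unique-edges (a ◅ p) (u∉ ∷ s) =
    All.tabulate (λ { m refl → contradiction refl (All.lookup u∉ (Inc-edges p m (Joins⇒Incˡ {edge a} (joins-edge a)))) })
    ∷ Unique-edges p s

  -- The edge must be the first step, since the start is not visited again; after it the path is
  -- already at v, and a simple path from v to v has no edges.
  end-edge : ∀ {u v} (p : Path u v) → Simple p → (a : Adj G u v) → edge a ∈ edges p → ∀ {e} → e ∈ edges p → e ≡ edge a
  end-edge (b ◅ p) (u∉ ∷ s) a (there m) _ =
    contradiction refl (All.lookup u∉ (Inc-edges p m (Joins⇒Incˡ {edge a} (joins-edge a))))
  end-edge (b ◅ p) (u∉ ∷ s) a (here eq) m with Inc-Joins {edge b} (joins-edge b) (subst (Inc _) eq (Joins⇒Incʳ {edge a} (joins-edge a)))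
  ... | inj₁ v≡u = contradiction (sym v≡u) (All.lookup u∉ (end∈ p))
  ... | inj₂ v≡w with m
  ...   | here e   = trans e (sym eq)
  ...   | there m' = contradiction m' (noEdges p s (sym v≡w))
    where
    noEdges : ∀ {u v e} (p : Path u v) → Simple p → u ≡ v → e ∉ edges p
    noEdges (c ◅ q) (u∉ ∷ s) refl _ = All.lookup u∉ (end∈ q) refl

  -- The local description of a circuit, and the only form in which circuits of `G'` are used.
  -- Connectedness is stated as an induction principle along edges that share a vertex.
  record Circ (C : Edge G → Set) : Set₁ where
    field
      two   : ∀ {w e} → C e → Inc w e →
              ∃ λ e' → e' ≢ e × C e' × Inc w e' × (∀ {e''} → C e'' → Inc w e'' → e'' ≡ e ⊎ e'' ≡ e')
      conn  : (D : Edge G → Set) → (∀ {e e' w} → C e → C e' → Inc w e → Inc w e' → D e → D e') →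
              ∀ {e e'} → C e → D e → C e' → D e'
      three : ∃ λ e₀ → ∃ λ e₁ → ∃ λ e₂ → (C e₀ × C e₁ × C e₂) × (e₀ ≢ e₁ × e₀ ≢ e₂ × e₁ ≢ e₂)

    notThree : ∀ {w e e' e''} → C e → C e' → C e'' → Inc w e → Inc w e' → Inc w e'' →
               e ≢ e' → e ≢ e'' → e' ≢ e'' → ⊥
    notThree Ce Ce' Ce'' i i' i'' ne ne' ne'' with two Ce i
    ... | _ , _ , _ , _ , only with only Ce' i' | only Ce'' i''
    ...   | inj₁ eq | _       = ne (sym eq)
    ...   | _       | inj₁ eq = ne' (sym eq)
    ...   | inj₂ eq | inj₂ eq' = ne'' (trans eq (sym eq'))

  module _ {C : Edge G → Set} (circuit : IsCircuit G C) where

    private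
      k = proj₁ circuit
      2≤k = proj₁ (proj₂ circuit)
      v = proj₁ (proj₂ (proj₂ circuit))
      v-inj = proj₁ (proj₂ (proj₂ (proj₂ circuit)))
      adjacent = proj₁ (proj₂ (proj₂ (proj₂ (proj₂ circuit))))
      member = proj₂ (proj₂ (proj₂ (proj₂ (proj₂ circuit))))

      e : Fin (suc k) → Edge G
      e i = edge (adjacent i)

      Ce : ∀ i → C (e i)
      Ce i = proj₂ (member (e i)) (i , joins-edge (adjacent i))

      C⁻ : ∀ {d} → C d → ∃ λ i → d ≡ e i
      C⁻ {d} Cd = let i , j = proj₁ (member d) Cd in i , sym (edge-Joins {e = d} (adjacent i) j)

      inc⁻ : ∀ {z} i → Inc z (e i) → z ≡ v i ⊎ z ≡ v (next i)
      inc⁻ i = Inc-Joins {e = e i} (joins-edge (adjacent i))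

      incˡ : ∀ i → Inc (v i) (e i)
      incˡ i = Joins⇒Incˡ {e = e i} (joins-edge (adjacent i))

      incʳ : ∀ i → Inc (v (next i)) (e i)
      incʳ i = Joins⇒Incʳ {e = e i} (joins-edge (adjacent i))

      e-next≢ : ∀ i → e (next i) ≢ e i
      e-next≢ i eq with inc⁻ i (subst (Inc _) eq (incʳ (next i)))
      ... | inj₁ q = next²≢ 2≤k i (v-inj q)
      ... | inj₂ q = Adj⇒≢ (adjacent (next i)) (sym q)

      at-next : ∀ i {d} → C d → Inc (v (next i)) d → d ≡ e i ⊎ d ≡ e (next i)
      at-next i Cd inc with C⁻ Cd
      ... | j , refl with inc⁻ j inc
      ...   | inj₁ q = inj₂ (cong e (sym (v-inj q)))
      ...   | inj₂ q = inj₁ (cong e (sym (next-injective (v-inj q))))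

      Two : Fin n → Edge G → Set
      Two w d = ∃ λ d' → d' ≢ d × C d' × Inc w d' × (∀ {d''} → C d'' → Inc w d'' → d'' ≡ d ⊎ d'' ≡ d')

      two-next : ∀ i → Two (v (next i)) (e i)
      two-next i = e (next i) , e-next≢ i , Ce (next i) , incˡ (next i) , at-next i

      two-prev : ∀ i → Two (v (next i)) (e (next i))
      two-prev i = e i , ≢-sym (e-next≢ i) , Ce i , incʳ i ,
        λ Cd inc → [ inj₂ , inj₁ ]′ (at-next i Cd inc)

      two' : ∀ {w d} → C d → Inc w d → Two w d
      two' Cd inc with C⁻ Cd
      ... | i , refl with inc⁻ i inc
      ...   | inj₁ refl = subst (λ i → Two (v i) (e i)) (next-prev i) (two-prev (prev i))
      ...   | inj₂ refl = two-next i

      module _ (D : Edge G → Set) (prop : ∀ {d d' w} → C d → C d' → Inc w d → Inc w d' → D d → D d') where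

        up : ∀ j → D (e zero) → D (e j)
        up = <-weakInduction (λ j → D (e zero) → D (e j)) id λ i h D₀ →
          subst (D ∘ e) (next-inject₁ i) (prop (Ce _) (Ce _) (incʳ (inject₁ i)) (incˡ _) (h D₀))

        down : ∀ j → D (e j) → D (e zero)
        down = <-weakInduction (λ j → D (e j) → D (e zero)) id λ i h D₁ →
          h (prop (Ce _) (Ce _) (incˡ _) (incʳ (inject₁ i)) (subst (D ∘ e) (sym (next-inject₁ i)) D₁))

      conn' : (D : Edge G → Set) → (∀ {d d' w} → C d → C d' → Inc w d → Inc w d' → D d → D d') →
              ∀ {d d'} → C d → D d → C d' → D d'
      conn' D prop Cd Dd Cd' with C⁻ Cd | C⁻ Cd'
      ... | i , refl | j , refl = up D prop j (down D prop i Dd)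

      three' : ∃ λ e₀ → ∃ λ e₁ → ∃ λ e₂ → (C e₀ × C e₁ × C e₂) × (e₀ ≢ e₁ × e₀ ≢ e₂ × e₁ ≢ e₂)
      three' = e zero , e i₁ , e i₂ , (Ce zero , Ce i₁ , Ce i₂) , ≢-sym (e-next≢ zero) , e₀≢e₂ , ≢-sym (e-next≢ i₁)
        where
        i₁ = next zero
        i₂ = next i₁
        e₀≢e₂ : e zero ≢ e i₂
        e₀≢e₂ eq with inc⁻ i₂ (subst (Inc _) eq (incʳ zero)) | inc⁻ i₂ (subst (Inc _) eq (incˡ zero))
        ... | inj₁ q | _      = Adj⇒≢ (adjacent i₁) q
        ... | inj₂ q | _      = next²≢ 2≤k i₁ (sym (v-inj q))

    IsCircuit⇒Circ : Circ C
    IsCircuit⇒Circ = record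
      { two   = two'
      ; conn  = conn'
      ; three = three'
      }

  IsCircuit-resp : ∀ {C D : Edge G → Set} → (∀ {e} → C e → D e) → (∀ {e} → D e → C e) → IsCircuit G C → IsCircuit G D
  IsCircuit-resp to from (k , 2≤k , v , inj , adjacent , member) =
    k , 2≤k , v , inj , adjacent , λ e → proj₁ (member e) ∘ from , to ∘ proj₂ (member e)

  lookup-top : ∀ {u v} (p : Path u v) → lookup (verts p) (fromℕ (length (steps p))) ≡ v
  lookup-top ε       = refl
  lookup-top (a ◅ p) = lookup-top p

  lookup-adj : ∀ {u v} (p : Path u v) (j : Fin (length (steps p))) →
               Σ (Adj G (lookup (verts p) (inject₁ j)) (lookup (steps p) j)) λ a → edge a ∈ edges p
  lookup-adj (a ◅ p) zero    = a , here refl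
  lookup-adj (a ◅ p) (suc j) = let b , m = lookup-adj p j in b , there m

  lookup-joins : ∀ {u v} (p : Path u v) {e} → e ∈ edges p →
                 ∃ λ j → Joins G e (lookup (verts p) (inject₁ j)) (lookup (steps p) j)
  lookup-joins (a ◅ p) (here refl) = zero , joins-edge a
  lookup-joins (a ◅ p) (there m)   = let j , h = lookup-joins p m in suc j , h

  -- An edge c outside p rules out closing a single edge by itself, so p has at least two steps and
  -- the circuit at least three vertices.
  closePath : ∀ {u v} (p : Path u v) → Simple p → (c : Adj G v u) → edge c ∉ edges p →
              IsCircuit G (_∈ edge c ∷ edges p)
  closePath {u} {v} p s c long = length (steps p) , 2≤ p c long , vtx , lookup-injective s , adjacent , λ e → to , from
    where
    vtx = lookup (verts p)
    2≤ : ∀ {v} (p : Path u v) → (c : Adj G v u) → edge c ∉ edges p → 2 ≤ length (steps p)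
    2≤ ε           c long = contradiction refl (Adj⇒≢ c)
    2≤ (a ◅ ε)     c long = contradiction (here (edge-sym c a)) long
    2≤ (_ ◅ _ ◅ _) c long = s≤s (s≤s z≤n)
    adjacent : ∀ i → Adj G (vtx i) (vtx (next i))
    adjacent i with view i
    ... | ‵fromℕ rewrite next-fromℕ {length (steps p)} | lookup-top p = c
    ... | ‵inject₁ j rewrite next-inject₁ j = proj₁ (lookup-adj p j)
    to : ∀ {e} → e ∈ edge c ∷ edges p → ∃ λ i → Joins G e (vtx i) (vtx (next i))
    to (here eq) = fromℕ _ , subst (λ d → Joins G d (vtx (fromℕ _)) (vtx (next (fromℕ _)))) (sym eq) joins
      where
      joins : Joins G (edge c) (vtx (fromℕ _)) (vtx (next (fromℕ _)))
      joins rewrite next-fromℕ {length (steps p)} | lookup-top p = joins-edge c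
    to {e} (there m) = let j , h = lookup-joins p m in
      inject₁ j , subst (λ i → Joins G e (vtx (inject₁ j)) (vtx i)) (sym (next-inject₁ j)) h
    from : ∀ {e} → (∃ λ i → Joins G e (vtx i) (vtx (next i))) → e ∈ edge c ∷ edges p
    from {e} (i , h) with view i
    from {e} (_ , h) | ‵fromℕ rewrite next-fromℕ {length (steps p)} | lookup-top p =
      here (sym (edge-Joins {e = e} c h))
    from {e} (_ , h) | ‵inject₁ j rewrite next-inject₁ j =
      let a , m = lookup-adj p j in there (subst (_∈ edges p) (edge-Joins {e = e} a h) m)

  -- The circuit is closed by the first edge of P, the rest being P followed by Q backwards.
  -- Internal disjointness still allows P and Q to be the same single edge; an edge of P outside Q
  -- excludes this.
  joinPaths : ∀ {x y} (P Q : Path x y) → Simple P → Simple Q →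
              (∀ {z} → z ∈ verts P → z ∈ verts Q → z ≡ x ⊎ z ≡ y) →
              (∃ λ e → e ∈ edges P × e ∉ edges Q) → IsCircuit G (_∈ edges P ++ edges Q)
  joinPaths {x} {y} (_◅_ {j = w} a P) Q s@(x∉ ∷ sP) sQ d (e , e∈P , e∉Q) =
    IsCircuit-resp to from (closePath (P ◅◅ reverse Q) simple a long)
    where
    simple = Simple-◅◅⁺ P (reverse Q) sP (Simple-rev Adj-sym Q sQ) λ l r →
      [ (λ { refl → contradiction refl (All.lookup x∉ l) }) , id ]′ (d (there l) (∈-rev⁻ Adj-sym Q r))
    w≢x : w ≢ x
    w≢x = ≢-sym (Adj⇒≢ a)
    long : edge a ∉ edges (P ◅◅ reverse Q)
    long m with ∈-edges-◅◅⁻ P (reverse Q) m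
    ... | inj₁ l = contradiction refl (All.lookup x∉ (Inc-edges P l (Joins⇒Incˡ {e = edge a} (joins-edge a))))
    ... | inj₂ r with d (there (here refl)) (Inc-edges Q (∈-edges-reverse⁻ Q r) (Joins⇒Incʳ {e = edge a} (joins-edge a)))
    ...   | inj₁ w≡x = w≢x w≡x
    ...   | inj₂ refl = e∉Q (subst (_∈ edges Q) (sym (end-edge (a ◅ P) s a (here refl) e∈P)) (∈-edges-reverse⁻ Q r))
    to : ∀ {e} → e ∈ edge a ∷ edges (P ◅◅ reverse Q) → e ∈ edge a ∷ edges P ++ edges Q
    to (here eq) = here eq
    to (there m) with ∈-edges-◅◅⁻ P (reverse Q) m
    ... | inj₁ l = there (∈-++⁺ˡ l)
    ... | inj₂ r = there (∈-++⁺ʳ (edges P) (∈-edges-reverse⁻ Q r))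
    from : ∀ {e} → e ∈ edge a ∷ edges P ++ edges Q → e ∈ edge a ∷ edges (P ◅◅ reverse Q)
    from (here eq) = here eq
    from (there m) with ∈-++⁻ (edges P) m
    ... | inj₁ l = there (∈-edges-◅◅⁺ˡ P (reverse Q) l)
    ... | inj₂ r = there (∈-edges-◅◅⁺ʳ P (reverse Q) (∈-edges-reverse⁺ Q r))

-- Three-connected graphs

module _ {n : ℕ} where

  ∣p∪q∣≤∣p∣+∣q∣ : ∀ {n} (p q : Subset n) → ∣ p ∪ q ∣ ≤ ∣ p ∣ + ∣ q ∣
  ∣p∪q∣≤∣p∣+∣q∣ []          []          = z≤n
  ∣p∪q∣≤∣p∣+∣q∣ (true ∷ p)  (true ∷ q)  = s≤s (ℕ.≤-trans (∣p∪q∣≤∣p∣+∣q∣ p q) (ℕ.+-monoʳ-≤ ∣ p ∣ (ℕ.n≤1+n ∣ q ∣)))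
  ∣p∪q∣≤∣p∣+∣q∣ (true ∷ p)  (false ∷ q) = s≤s (∣p∪q∣≤∣p∣+∣q∣ p q)
  ∣p∪q∣≤∣p∣+∣q∣ (false ∷ p) (true ∷ q)  = ℕ.≤-trans (s≤s (∣p∪q∣≤∣p∣+∣q∣ p q)) (ℕ.≤-reflexive (sym (ℕ.+-suc ∣ p ∣ ∣ q ∣)))
  ∣p∪q∣≤∣p∣+∣q∣ (false ∷ p) (false ∷ q) = ∣p∪q∣≤∣p∣+∣q∣ p q

  ⟦_⟧ : {P : Fin n → Set} → (∀ x → Dec (P x)) → Subset n
  ⟦ P? ⟧ = tabulate (does ∘ P?)

  ∈-⟦⟧⁺ : ∀ {P : Fin n → Set} (P? : ∀ x → Dec (P x)) {x} → P x → x Subset.∈ ⟦ P? ⟧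
  ∈-⟦⟧⁺ P? {x} Px = Vec.lookup⇒[]= x _ (trans (Vec.lookup∘tabulate (does ∘ P?) x) eq)
    where
    eq : does (P? x) ≡ true
    eq with P? x
    ... | yes _ = refl
    ... | no ¬p = contradiction Px ¬p

  ∈-⟦⟧⁻ : ∀ {P : Fin n → Set} (P? : ∀ x → Dec (P x)) {x} → x Subset.∈ ⟦ P? ⟧ → P x
  ∈-⟦⟧⁻ P? {x} m with P? x | trans (sym (Vec.lookup∘tabulate (does ∘ P?) x)) (Vec.[]=⇒lookup m)
  ... | yes p | _ = p

module ThreeConnected {n : ℕ} (G : Graph n) (3-conn : KConnected 3 G) where

  open OnGraph G

  private V = Fin n

  3<n : 3 ℕ.< n
  3<n = proj₁ 3-conn

  opaque
    freshVertex : ∀ (s₁ s₂ s₃ : V) → ∃ λ u → u ≢ s₁ × u ≢ s₂ × u ≢ s₃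
    freshVertex s₁ s₂ s₃ with any? (λ u → ¬? (u ≟ s₁) ×-dec ¬? (u ≟ s₂) ×-dec ¬? (u ≟ s₃))
    ... | yes found = found
    ... | no none   = contradiction (Fin.injective⇒≤ {f = number} number-injective) (ℕ.<⇒≱ 3<n)
      where
      data Which (u : V) : Fin 3 → Set where
        is₁ : u ≡ s₁ → Which u zero
        is₂ : u ≡ s₂ → Which u (suc zero)
        is₃ : u ≡ s₃ → Which u (suc (suc zero))
      which : ∀ u → ∃ (Which u)
      which u with u ≟ s₁ | u ≟ s₂ | u ≟ s₃
      ... | yes e | _     | _     = _ , is₁ e
      ... | no _  | yes e | _     = _ , is₂ e
      ... | no _  | no _  | yes e = _ , is₃ e
      ... | no a  | no b  | no c  = contradiction (u , a , b , c) none
      number : V → Fin 3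
      number u = proj₁ (which u)
      same : ∀ {u u' i} → Which u i → Which u' i → u ≡ u'
      same (is₁ e) (is₁ e') = trans e (sym e')
      same (is₂ e) (is₂ e') = trans e (sym e')
      same (is₃ e) (is₃ e') = trans e (sym e')
      number-injective : Injective _≡_ _≡_ number
      number-injective {u} {u'} e = same (subst (Which u) e (proj₂ (which u))) (proj₂ (which u'))

  opaque
    -- The deleted set is that of s₁ and s₂ without the ends u and v. This permits arbitrary
    -- parameters: callers often repeat a vertex or pass an end.
    connected : ∀ s₁ s₂ u v → Σ (Path u v) λ p → ∀ {x} → x ∈ verts p → x ≡ u ⊎ x ≡ v ⊎ (x ≢ s₁ × x ≢ s₂)
    connected s₁ s₂ u v = Star.map proj₁ walk , λ m → outside⇒ (outside (λ h → proj₁ (proj₂ (∈-⟦⟧⁻ X? h)) refl) walk (∈-mapStar⁻ proj₁ walk m))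
      where
      X? : ∀ x → Dec ((x ≡ s₁ ⊎ x ≡ s₂) × x ≢ u × x ≢ v)
      X? x = ((x ≟ s₁) ⊎-dec (x ≟ s₂)) ×-dec ¬? (x ≟ u) ×-dec ¬? (x ≟ v)
      X : Subset n
      X = ⟦ X? ⟧
      X⊆ : X Subset.⊆ ⁅ s₁ ⁆ ∪ ⁅ s₂ ⁆
      X⊆ m with proj₁ (∈-⟦⟧⁻ X? m)
      ... | inj₁ refl = Subset.x∈p∪q⁺ (inj₁ (Subset.x∈⁅x⁆ s₁))
      ... | inj₂ refl = Subset.x∈p∪q⁺ (inj₂ (Subset.x∈⁅x⁆ s₂))
      ∣X∣<3 : ∣ X ∣ ℕ.< 3
      ∣X∣<3 = s≤s (ℕ.≤-trans (Subset.p⊆q⇒∣p∣≤∣q∣ X⊆) (ℕ.≤-trans (∣p∪q∣≤∣p∣+∣q∣ {n} ⁅ s₁ ⁆ ⁅ s₂ ⁆)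
                (ℕ.≤-reflexive (cong₂ _+_ (Subset.∣⁅x⁆∣≡1 s₁) (Subset.∣⁅x⁆∣≡1 s₂)))))
      walk : Star (StepAvoiding G X) u v
      walk = proj₂ 3-conn X ∣X∣<3 u v (λ m → proj₁ (proj₂ (∈-⟦⟧⁻ X? m)) refl) (λ m → proj₂ (proj₂ (∈-⟦⟧⁻ X? m)) refl)
      outside : ∀ {a b x} → a Subset.∉ X → (p : Star (StepAvoiding G X) a b) → x ∈ verts p → x Subset.∉ X
      outside a∉ p              (here refl) = a∉
      outside a∉ ((_ , w∉) ◅ p) (there m)   = outside w∉ p m
      outside⇒ : ∀ {x} → x Subset.∉ X → x ≡ u ⊎ x ≡ v ⊎ (x ≢ s₁ × x ≢ s₂)
      outside⇒ {x} x∉ with x ≟ u | x ≟ v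
      ... | yes e | _     = inj₁ e
      ... | no _  | yes e = inj₂ (inj₁ e)
      ... | no a  | no b  = inj₂ (inj₂ ((λ e → x∉ (∈-⟦⟧⁺ X? (inj₁ e , a , b))) , λ e → x∉ (∈-⟦⟧⁺ X? (inj₂ e , a , b))))

  opaque
    -- The first step of a path from v to a vertex other than v, s₁ and s₂. Passing two neighbours
    -- already found yields a third one, which is how minimum degree three is used.
    neighbour : ∀ v s₁ s₂ → ∃ λ a → Adj G v a × a ≢ s₁ × a ≢ s₂
    neighbour v s₁ s₂ with freshVertex v s₁ s₂
    ... | u , u≢v , u≢s₁ , u≢s₂ with connected s₁ s₂ v u
    ...   | ε , _ = contradiction refl u≢v
    ...   | (a ◅ p) , av with av (there (here refl))
    ...     | inj₁ refl          = contradiction refl (Adj⇒≢ a)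
    ...     | inj₂ (inj₁ refl)   = _ , a , u≢s₁ , u≢s₂
    ...     | inj₂ (inj₂ (b , c)) = _ , a , b , c

  record FanPath (v : V) (O Ok : V → Set) : Set where
    constructor fanPath
    field
      {top}   : V
      path    : Path v top
      top∈O   : O top
      simple  : Simple path
      onlyTop : ∀ {x} → x ∈ verts path → O x → x ≡ top
      okay    : ∀ {x} → x ∈ verts path → x ≡ v ⊎ Ok x

  opaque
    -- Menger's theorem in the graph without v, from the neighbours of v to O; each path is then
    -- extended back to v. `Ok` confines the paths further: it keeps z off them in `threePaths`.
    fan : ∀ v {O Ok : V → Set} → (∀ x → Dec (O x)) → (∀ x → Dec (Ok x)) → ¬ O v →
          (∀ s₁ s₂ → ∃ λ b → O b × Σ (Path v b) λ p → ∀ {x} → x ∈ verts p → x ≡ v ⊎ (Ok x × x ≢ s₁ × x ≢ s₂)) →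
          Σ (Fin 3 → FanPath v O Ok) λ F → ∀ {i j x} →
            x ∈ verts (FanPath.path (F i)) → x ∈ verts (FanPath.path (F j)) → x ≢ v → i ≡ j
    fan v {O} {Ok} O? Ok? v∉O H = F , disj
      where
      Ok' : V → Set
      Ok' x = Ok x × x ≢ v
      Ok'? : ∀ x → Dec (Ok' x)
      Ok'? x = Ok? x ×-dec ¬? (x ≟ v)
      R : V → V → Set
      R a b = Adj G a b × Ok' a × Ok' b
      R? : ∀ a b → Dec (R a b)
      R? a b = adj? a b ×-dec Ok'? a ×-dec Ok'? b
      A : V → Set
      A x = Adj G v x × Ok' x

      restrict : ∀ {a b} (p : Path a b) → (∀ {x} → x ∈ verts p → Ok' x) → Σ (Star R a b) λ q → ∀ {x} → x ∈ verts q → x ∈ verts p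
      restrict ε       ok = ε , id
      restrict (a ◅ p) ok = let q , ins = restrict p (ok ∘ there) in
        (a , ok (here refl) , ok (there (here refl))) ◅ q , λ { (here e) → here e ; (there m) → there (ins m) }

      ok : ∀ {a b} (p : Star R a b) → Ok' a → ∀ {x} → x ∈ verts p → Ok' x
      ok p                  a (here refl) = a
      ok ((_ , _ , b) ◅ p) a (there m)   = ok p b m

      linked : ∀ (X : Vec V 2) → Linked R A O X
      linked X@(s₁ ∷ s₂ ∷ []) with H s₁ s₂
      ... | b , Ob , p , av with pathTo _≟_ O? p Ob
      ...   | pathInto ε Ov _ _ _ = contradiction Ov v∉O
      ...   | pathInto (a ◅ q) Ot (v∉ ∷ sq) only ins = go (λ m → av (ins (there m)))
        where
        go : (∀ {x} → x ∈ verts q → x ≡ v ⊎ (Ok x × x ≢ s₁ × x ≢ s₂)) → Linked R A O X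
        go av' = _ , _ , (a , okq (here refl)) , Ot , proj₁ (restrict q okq) , λ m → avoid (proj₂ (restrict q okq) m)
          where
          okq : ∀ {x} → x ∈ verts q → Ok' x
          okq m with av' m
          ... | inj₁ e        = contradiction (sym e) (All.lookup v∉ m)
          ... | inj₂ (o , _) = o , λ e → All.lookup v∉ m (sym e)
          avoid : ∀ {x} → x ∈ verts q → x Vec.∉ X
          avoid m x∈X with av' m | x∈X
          ... | inj₁ e            | _                 = All.lookup v∉ m (sym e)
          ... | inj₂ (_ , a , _) | here e            = a e
          ... | inj₂ (_ , _ , b) | there (here e)    = b e

      M : DisjointPaths R A O 3
      M = menger v R? {A} {O} (λ x → adj? v x ×-dec Ok'? x) O? 2 linked
      module M i = PathBetween (proj₁ M i)

      tail-ok : ∀ i {x} → x ∈ verts (Star.map proj₁ (M.path i)) → Ok' x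
      tail-ok i m = ok (M.path i) (proj₂ (M.bot∈A i)) (∈-mapStar⁻ proj₁ (M.path i) m)

      F : Fin 3 → FanPath v O Ok
      F i = fanPath (proj₁ (M.bot∈A i) ◅ Star.map proj₁ (M.path i)) (M.top∈B i)
              (All.tabulate (λ m e → proj₂ (tail-ok i m) (sym e)) ∷ subst Unique (sym (verts-map proj₁ (M.path i))) (M.simple i))
              (λ { (here refl) Ov → contradiction Ov v∉O ; (there m) → M.onlyTop i (∈-mapStar⁻ proj₁ (M.path i) m) })
              λ { (here e) → inj₁ e ; (there m) → inj₂ (proj₁ (tail-ok i m)) }

      disj : ∀ {i j x} → x ∈ verts (FanPath.path (F i)) → x ∈ verts (FanPath.path (F j)) → x ≢ v → i ≡ j
      disj (here e)  _         ne = contradiction e ne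
      disj (there _) (here e)  ne = contradiction e ne
      disj {i} {j} (there m) (there m') ne = proj₂ M (∈-mapStar⁻ proj₁ (M.path i) m) (∈-mapStar⁻ proj₁ (M.path j) m')

  withoutEnd : ∀ {y z} (p : Path y z) → Simple p → y ≢ z →
               ∃ λ b → Adj G b z × Σ (Path y b) λ q → ∀ {x} → x ∈ verts q → x ∈ verts p × x ≢ z
  withoutEnd ε       s y≢z = contradiction refl y≢z
  withoutEnd {y} {z} (_◅_ {j = w} a p) (y∉ ∷ s) y≢z with w ≟ z
  ... | yes refl = _ , a , ε , λ { (here refl) → here refl , y≢z }
  ... | no w≢z with withoutEnd p s w≢z
  ...   | b , c , q , ins = b , c , a ◅ q , λ { (here refl) → here refl , y≢z ; (there m) → let m' , ne = ins m in there m' , ne }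

  opaque
    -- A fan from y to the neighbours of z in the graph without z, each path then extended to z.
    -- Nonadjacency says that the centre of the fan is not itself a target.
    threePaths : ∀ y z → y ≢ z → ¬ Adj G y z →
      Σ (Fin 3 → Σ (Path y z) Simple) λ F → ∀ {i j x} → x ∈ verts (proj₁ (F i)) → x ∈ verts (proj₁ (F j)) → i ≢ j → x ≡ y ⊎ x ≡ z
    threePaths y z y≢z ¬yz = F , disj
      where
      linked : ∀ s₁ s₂ → ∃ λ b → Adj G b z × Σ (Path y b) λ p → ∀ {x} → x ∈ verts p → x ≡ y ⊎ (x ≢ z × x ≢ s₁ × x ≢ s₂)
      linked s₁ s₂ with connected s₁ s₂ y z
      ... | p , av with pathTo _≟_ (_≟ z) p refl
      ...   | pathInto q refl sq only ins with withoutEnd q sq y≢z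
      ...     | b , c , q' , ins' = b , c , q' , λ m → let m' , x≢z = ins' m in
                  case av (ins m') of λ
                  { (inj₁ e) → inj₁ e ; (inj₂ (inj₁ e)) → contradiction e x≢z ; (inj₂ (inj₂ (a , b))) → inj₂ (x≢z , a , b) }
      Φ : Σ (Fin 3 → FanPath y (λ x → Adj G x z) (_≢ z)) λ F → ∀ {i j x} →
          x ∈ verts (FanPath.path (F i)) → x ∈ verts (FanPath.path (F j)) → x ≢ y → i ≡ j
      Φ = fan y (λ x → adj? x z) (λ x → ¬? (x ≟ z)) ¬yz linked
      module Φ i = FanPath (proj₁ Φ i)
      z∉ : ∀ i → z ∉ verts (Φ.path i)
      z∉ i m with Φ.okay i m
      ... | inj₁ e  = y≢z (sym e)
      ... | inj₂ ne = ne refl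
      F : Fin 3 → Σ (Path y z) Simple
      F i = Φ.path i ◅◅ (Φ.top∈O i ◅ ε) , Simple-◅◅⁺ (Φ.path i) (Φ.top∈O i ◅ ε) (Φ.simple i)
        ((Adj⇒≢ (Φ.top∈O i) ∷ []) ∷ [] ∷ []) λ { l (here e) → e ; l (there (here refl)) → contradiction l (z∉ i) }
      disj : ∀ {i j x} → x ∈ verts (proj₁ (F i)) → x ∈ verts (proj₁ (F j)) → i ≢ j → x ≡ y ⊎ x ≡ z
      disj {i} {j} {x} m m' i≢j with ∈-◅◅⁻ (Φ.path i) (Φ.top∈O i ◅ ε) m | ∈-◅◅⁻ (Φ.path j) (Φ.top∈O j ◅ ε) m'
      ... | inj₂ (there (here e)) | _ = inj₂ e
      ... | _ | inj₂ (there (here e)) = inj₂ e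
      ... | inj₁ l | inj₁ r = inj₁ (common l r)
        where
        common : x ∈ verts (Φ.path i) → x ∈ verts (Φ.path j) → x ≡ y
        common l r = decidable-stable (x ≟ y) λ ne → i≢j (proj₂ Φ l r ne)
      ... | inj₂ (here refl) | inj₁ r         = inj₁ (decidable-stable (x ≟ y) λ ne → i≢j (proj₂ Φ (end∈ (Φ.path i)) r ne))
      ... | inj₁ l           | inj₂ (here refl) = inj₁ (decidable-stable (x ≟ y) λ ne → i≢j (proj₂ Φ l (end∈ (Φ.path j)) ne))
      ... | inj₂ (here refl) | inj₂ (here e) = inj₁ (decidable-stable (x ≟ y) λ ne → i≢j (proj₂ Φ (end∈ (Φ.path i)) (subst (_∈ verts (Φ.path j)) (sym e) (end∈ (Φ.path j))) ne))

  record TwoPaths (x y : V) (B : V → Set) : Set where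
    field
      {b b'}   : V
      p        : Path x b
      q        : Path y b'
      b∈B      : B b
      b'∈B     : B b'
      simple-p : Simple p
      simple-q : Simple q
      disjoint : ∀ {z} → z ∈ verts p → z ∉ verts q
      only-p   : ∀ {z} → z ∈ verts p → B z → z ≡ b
      only-q   : ∀ {z} → z ∈ verts q → B z → z ≡ b'

  opaque
    -- Menger's theorem from the pair x, y to B, where one deleted vertex always leaves a start and
    -- a target. Disjoint paths start at different vertices of the pair, and `build` puts them in
    -- order.
    twoPaths : ∀ {x y} {B : V → Set} → (∀ z → Dec (B z)) → x ≢ y → ∀ {b₁ b₂} → B b₁ → B b₂ → b₁ ≢ b₂ → TwoPaths x y B
    twoPaths {x} {y} {B} B? x≢y {b₁} {b₂} Bb₁ Bb₂ b₁≢b₂ =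
        build (M.path i₀) (M.path i₁) (M.bot∈A i₀) (M.bot∈A i₁) (M.top∈B i₀) (M.top∈B i₁) (M.simple i₀) (M.simple i₁)
          (M.onlyTop i₀) (M.onlyTop i₁) (λ m m' → case proj₂ M m m' of λ ())
      where
      A : V → Set
      A z = z ≡ x ⊎ z ≡ y
      other : ∀ {c d : V} (P : V → Set) → P c → P d → c ≢ d → ∀ s → ∃ λ e → P e × e ≢ s
      other {c} {d} P Pc Pd c≢d s with c ≟ s
      ... | no c≢s   = c , Pc , c≢s
      ... | yes refl = d , Pd , ≢-sym c≢d
      linked : ∀ (X : Vec V 1) → Linked (Adj G) A B X
      linked (s ∷ []) with other A (inj₁ refl) (inj₂ refl) x≢y s | other B Bb₁ Bb₂ b₁≢b₂ s
      ... | a , Aa , a≢s | b , Bb , b≢s = let p , av = connected s s a b in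
        a , b , Aa , Bb , p , λ { m (here refl) → case av m of λ
          { (inj₁ e) → a≢s (sym e) ; (inj₂ (inj₁ e)) → b≢s (sym e) ; (inj₂ (inj₂ (ne , _))) → ne refl } }
      M : DisjointPaths (Adj G) A B 2
      M = menger x adj? {A} {B} (λ z → (z ≟ x) ⊎-dec (z ≟ y)) B? 1 linked
      module M i = PathBetween (proj₁ M i)
      i₀ i₁ : Fin 2
      i₀ = zero
      i₁ = suc zero
      build : ∀ {a a' b b'} (p : Path a b) (q : Path a' b') → A a → A a' → B b → B b' → Simple p → Simple q →
              (∀ {z} → z ∈ verts p → B z → z ≡ b) → (∀ {z} → z ∈ verts q → B z → z ≡ b') →
              (∀ {z} → z ∈ verts p → z ∉ verts q) → TwoPaths x y B
      build p q (inj₁ refl) (inj₂ refl) Bb Bb' sp sq op oq d = record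
        { p = p ; q = q ; b∈B = Bb ; b'∈B = Bb' ; simple-p = sp ; simple-q = sq ; disjoint = d ; only-p = op ; only-q = oq }
      build p q (inj₂ refl) (inj₁ refl) Bb Bb' sp sq op oq d = record
        { p = q ; q = p ; b∈B = Bb' ; b'∈B = Bb ; simple-p = sq ; simple-q = sp ; disjoint = λ m m' → d m' m ; only-p = oq ; only-q = op }
      build p q (inj₁ refl) (inj₁ refl) _ _ _ _ _ _ d = contradiction (here refl) (d (here refl))
      build p q (inj₂ refl) (inj₂ refl) _ _ _ _ _ _ d = contradiction (here refl) (d (here refl))

  -- A circuit through e and h, opened at e: `across` runs along p, over h and back along q. Either
  -- path may be trivial when e and h share a vertex, and both may be when e ≡ h, so only `circuit`
  -- asks for e ≢ h.
  record Linkage (e h : Edge G) : Set where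
    field
      {x x' y y'} : V
      joins-e     : Joins G e x y
      joins-h     : Joins G h x' y'
      p           : Path x x'
      q           : Path y y'
      simple-p    : Simple p
      simple-q    : Simple q
      disjoint    : ∀ {z} → z ∈ verts p → z ∉ verts q

    across : Path x y
    across = p ◅◅ Joins⇒Adj {h} joins-h ◅ reverse q

    across-simple : Simple across
    across-simple = Simple-◅◅⁺ p _ simple-p
      (All.tabulate (λ { m refl → disjoint (end∈ p) (∈-rev⁻ Adj-sym q m) }) ∷ Simple-rev Adj-sym q simple-q)
      λ { l (here e) → e ; l (there r) → contradiction (∈-rev⁻ Adj-sym q r) (disjoint l) }

    h∈across : h ∈ edges across
    h∈across = ∈-edges-◅◅⁺ʳ p _ (here (sym (edge-Joins {e = h} (Joins⇒Adj {h} joins-h) joins-h)))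

    circuit : e ≢ h → IsCircuit G (_∈ edges across ++ (e ∷ []))
    circuit e≢h = subst (λ d → IsCircuit G (_∈ edges across ++ (d ∷ []))) a≡e
      (joinPaths across (a ◅ ε) across-simple ((Joins⇒≢ {e} joins-e ∷ []) ∷ [] ∷ [])
        (λ { _ (here e) → inj₁ e ; _ (there (here e)) → inj₂ e })
        (h , h∈across , λ { (here eq) → e≢h (sym (trans eq a≡e)) }))
      where
      a = Joins⇒Adj {e} joins-e
      a≡e : edge a ≡ e
      a≡e = edge-Joins {e = e} a joins-e

  opaque
    linkage : ∀ e h → Linkage e h
    linkage e@((x , y) , _ , a) h@((x' , y') , _ , b) = record
      { joins-e = inj₁ refl ; joins-h = Inc²⇒Joins {h} (λ eq → disjoint (end∈ p) (subst (_∈ verts q) (sym eq) (end∈ q))) b∈B b'∈B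
      ; p = p ; q = q ; simple-p = simple-p ; simple-q = simple-q ; disjoint = disjoint }
      where open TwoPaths (twoPaths (λ z → inc? z h) (Adj⇒≢ a) {x'} {y'} (inj₁ refl) (inj₂ refl) (Adj⇒≢ b))

-- Cuts that every circuit crosses at most twice

pigeonhole₃ : {P Q : Fin 3 → Set} → (∀ i → P i ⊎ Q i) → ∃₂ λ i j → i ≢ j × ((P i × P j) ⊎ (Q i × Q j))
pigeonhole₃ h with h zero | h (suc zero) | h (suc (suc zero))
... | inj₁ a | inj₁ b | _      = zero , suc zero , (λ ()) , inj₁ (a , b)
... | inj₂ a | inj₂ b | _      = zero , suc zero , (λ ()) , inj₂ (a , b)
... | inj₁ a | inj₂ b | inj₁ c = zero , suc (suc zero) , (λ ()) , inj₁ (a , c)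
... | inj₁ a | inj₂ b | inj₂ c = suc zero , suc (suc zero) , (λ ()) , inj₂ (b , c)
... | inj₂ a | inj₁ b | inj₁ c = suc zero , suc (suc zero) , (λ ()) , inj₁ (b , c)
... | inj₂ a | inj₁ b | inj₂ c = zero , suc (suc zero) , (λ ()) , inj₂ (a , c)

pickAvoiding : ∀ {n} {P : Fin n → Set} {a b c} → P a → P b → P c → a ≢ b → a ≢ c → b ≢ c →
               ∀ s₁ s₂ → ∃ λ x → P x × x ≢ s₁ × x ≢ s₂
pickAvoiding {a = a} {b} {c} Pa Pb Pc ab ac bc s₁ s₂ with a ≟ s₁ | a ≟ s₂ | b ≟ s₁ | b ≟ s₂
... | no p     | no q     | _        | _        = a , Pa , p , q
... | yes refl | _        | _        | no q     = b , Pb , ≢-sym ab , q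
... | yes refl | _        | _        | yes refl = c , Pc , ≢-sym ac , ≢-sym bc
... | no _     | yes refl | no p     | _        = b , Pb , p , ≢-sym ab
... | no _     | yes refl | yes refl | _        = c , Pc , ≢-sym bc , ≢-sym ac

bool-≢ : ∀ {a b} → a ≡ true → b ≡ false → a ≢ b
bool-≢ refl refl ()

module Laminar {n : ℕ} (G : Graph n) (3-conn : KConnected 3 G) where

  open OnGraph G
  open ThreeConnected G 3-conn

  private V = Fin n

  -- The circuit p₁ p₂ p₃ closed up by Q would change sides four times.
  CrossesTwice : (V → Bool) → Set
  CrossesTwice S = ∀ {x a b y} (p₁ : Path x a) (p₂ : Path a b) (p₃ : Path b y) (Q : Path x y) →
    Simple (p₁ ◅◅ p₂ ◅◅ p₃) → Simple Q →
    (∀ {z} → z ∈ verts (p₁ ◅◅ p₂ ◅◅ p₃) → z ∈ verts Q → z ≡ x ⊎ z ≡ y) →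
    S x ≢ S a → S a ≢ S b → S b ≢ S y → ⊥

  swapOn : ∀ {y z} {R R' : Path y z} {x : V} → x ∈ verts R ⊎ x ∈ verts R' → x ∈ verts R' ⊎ x ∈ verts R
  swapOn (inj₁ m) = inj₂ m
  swapOn (inj₂ m) = inj₁ m

  -- The arc of the circuit R ∪ R' from o₁ through z to o₂.
  record Arcs {y z} (R R' : Path y z) (o₁ o₂ : V) : Set where
    constructor arcsOf
    field
      A₁       : Path o₁ z
      A₂       : Path o₂ z
      simple₁  : Simple A₁
      simple₂  : Simple A₂
      common   : ∀ {t} → t ∈ verts A₁ → t ∈ verts A₂ → t ≡ z
      on₁      : ∀ {t} → t ∈ verts A₁ → t ∈ verts R ⊎ t ∈ verts R'
      on₂      : ∀ {t} → t ∈ verts A₂ → t ∈ verts R ⊎ t ∈ verts R'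

  swapArcs : ∀ {y z} {R R' : Path y z} {o₁ o₂} → Arcs R R' o₁ o₂ → Arcs R R' o₂ o₁
  swapArcs (arcsOf A₁ A₂ s₁ s₂ c on₁ on₂) = arcsOf A₂ A₁ s₂ s₁ (λ m m' → c m' m) on₂ on₁

  swapPaths : ∀ {y z} {R R' : Path y z} {o₁ o₂} → Arcs R R' o₁ o₂ → Arcs R' R o₁ o₂
  swapPaths {R = R} {R'} (arcsOf A₁ A₂ s₁ s₂ c on₁ on₂) =
    arcsOf A₁ A₂ s₁ s₂ c (swapOn {R = R} {R'} ∘ on₁) (swapOn {R = R} {R'} ∘ on₂)

  -- From o the arc returns along α to y and then follows all of R' to z; from o' it is γ. The
  -- stretch μ is the part of the circuit left out.
  arcs-inOrder : ∀ {y z o o'} (α : Path y o) (μ : Path o o') (γ : Path o' z) (R' : Path y z) →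
    Simple (α ◅◅ μ ◅◅ γ) → Simple R' → (∀ {t} → t ∈ verts (α ◅◅ μ ◅◅ γ) → t ∈ verts R' → t ≡ y ⊎ t ≡ z) →
    o ≢ o' → o ≢ z → Arcs (α ◅◅ μ ◅◅ γ) R' o o'
  arcs-inOrder {y} {z} {o} {o'} α μ γ R' sR sR' d o≢o' o≢z with Simple-◅◅⁻ α (μ ◅◅ γ) sR
  ... | sα , sμγ , cα with Simple-◅◅⁻ μ γ sμγ
  ...   | sμ , sγ , cμ = arcsOf (reverse α ◅◅ R') γ
          (Simple-◅◅⁺ (reverse α) R' (Simple-rev Adj-sym α sα) sR' joint) sγ common
          (λ m → [ (λ l → inj₁ (∈-◅◅⁺ˡ α (μ ◅◅ γ) (∈-rev⁻ Adj-sym α l))) , inj₂ ]′ (∈-◅◅⁻ (reverse α) R' m))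
          (λ m → inj₁ (γ⊆ m))
    where
    γ⊆ : ∀ {t} → t ∈ verts γ → t ∈ verts (α ◅◅ μ ◅◅ γ)
    γ⊆ m = ∈-◅◅⁺ʳ α (μ ◅◅ γ) (∈-◅◅⁺ʳ μ γ m)
    joint : ∀ {t} → t ∈ verts (reverse α) → t ∈ verts R' → t ≡ y
    joint l r with d (∈-◅◅⁺ˡ α (μ ◅◅ γ) (∈-rev⁻ Adj-sym α l)) r
    ... | inj₁ e    = e
    ... | inj₂ refl = contradiction (sym (cα (∈-rev⁻ Adj-sym α l) (end∈ (μ ◅◅ γ)))) o≢z
    o∉γ : o ∉ verts γ
    o∉γ m = o≢o' (cμ (here refl) m)
    common : ∀ {t} → t ∈ verts (reverse α ◅◅ R') → t ∈ verts γ → t ≡ z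
    common m g with ∈-◅◅⁻ (reverse α) R' m
    ... | inj₁ l = contradiction (subst (_∈ verts γ) (cα (∈-rev⁻ Adj-sym α l) (∈-◅◅⁺ʳ μ γ g)) g) o∉γ
    ... | inj₂ r with d (γ⊆ g) r
    ...   | inj₂ e    = e
    ...   | inj₁ refl = contradiction (subst (_∈ verts γ) (cα (here refl) (∈-◅◅⁺ʳ μ γ g)) g) o∉γ

  arcs-same : ∀ {y z o₁ o₂} (R R' : Path y z) → Simple R → Simple R' →
    (∀ {t} → t ∈ verts R → t ∈ verts R' → t ≡ y ⊎ t ≡ z) →
    o₁ ∈ verts R → o₂ ∈ verts R → o₁ ≢ o₂ → o₁ ≢ z → o₂ ≢ z → Arcs R R' o₁ o₂
  arcs-same R R' sR sR' d m₁ m₂ o₁≢o₂ o₁≢z o₂≢z with split R m₁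
  ... | α , β , refl with ∈-◅◅⁻ α β m₂
  ...   | inj₂ r with split β r
  ...     | μ , γ , refl = arcs-inOrder α μ γ R' sR sR' d o₁≢o₂ o₁≢z
  arcs-same R R' sR sR' d m₁ m₂ o₁≢o₂ o₁≢z o₂≢z | α , β , refl | inj₁ l with split α l
  ...     | α₁ , α₂ , refl = subst (λ P → Arcs P R' _ _) assoc
              (swapArcs (arcs-inOrder α₁ α₂ β R' (subst Simple (sym assoc) sR) sR'
                (λ m → d (subst (λ P → _ ∈ verts P) assoc m)) (≢-sym o₁≢o₂) o₂≢z))
    where
    assoc : α₁ ◅◅ α₂ ◅◅ β ≡ (α₁ ◅◅ α₂) ◅◅ β
    assoc = sym (Star.◅◅-assoc α₁ α₂ β)

  arcs-apart : ∀ {y z o₁ o₂} (R R' : Path y z) → Simple R → Simple R' →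
    (∀ {t} → t ∈ verts R → t ∈ verts R' → t ≡ y ⊎ t ≡ z) →
    o₁ ∈ verts R → o₂ ∈ verts R' → o₁ ≢ o₂ → Arcs R R' o₁ o₂
  arcs-apart {y} {z} R R' sR sR' d m₁ m₂ o₁≢o₂ with split R m₁ | split R' m₂
  ... | α₁ , β₁ , refl | α₂ , β₂ , refl with Simple-◅◅⁻ α₁ β₁ sR | Simple-◅◅⁻ α₂ β₂ sR'
  ...   | _ , s₁ , c₁ | _ , s₂ , c₂ = arcsOf β₁ β₂ s₁ s₂ common (inj₁ ∘ ∈-◅◅⁺ʳ α₁ β₁) (inj₂ ∘ ∈-◅◅⁺ʳ α₂ β₂)
    where
    common : ∀ {t} → t ∈ verts β₁ → t ∈ verts β₂ → t ≡ z
    common m m' with d (∈-◅◅⁺ʳ α₁ β₁ m) (∈-◅◅⁺ʳ α₂ β₂ m')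
    ... | inj₂ e    = e
    ... | inj₁ refl = contradiction (trans (sym (c₁ (here refl) m)) (c₂ (here refl) m')) o₁≢o₂

  arcsThrough : ∀ {y z o₁ o₂} (R R' : Path y z) → Simple R → Simple R' →
    (∀ {t} → t ∈ verts R → t ∈ verts R' → t ≡ y ⊎ t ≡ z) →
    (o₁ ∈ verts R ⊎ o₁ ∈ verts R') → (o₂ ∈ verts R ⊎ o₂ ∈ verts R') →
    o₁ ≢ o₂ → o₁ ≢ z → o₂ ≢ z → Arcs R R' o₁ o₂
  arcsThrough R R' s s' d (inj₁ m) (inj₁ m') ne ne₁ ne₂ = arcs-same R R' s s' d m m' ne ne₁ ne₂
  arcsThrough R R' s s' d (inj₁ m) (inj₂ m') ne ne₁ ne₂ = arcs-apart R R' s s' d m m' ne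
  arcsThrough R R' s s' d (inj₂ m) (inj₁ m') ne ne₁ ne₂ = swapPaths (arcs-apart R' R s' s (λ r r' → d r' r) m m' ne)
  arcsThrough R R' s s' d (inj₂ m) (inj₂ m') ne ne₁ ne₂ = swapPaths (arcs-same R' R s' s (λ r r' → d r' r) m m' ne ne₁ ne₂)

  module _ {y z} (R R' : Path y z) (sR : Simple R) (sR' : Simple R')
           (d : ∀ {t} → t ∈ verts R → t ∈ verts R' → t ≡ y ⊎ t ≡ z) where

    private
      O : V → Set
      O x = x ∈ verts R ⊎ x ∈ verts R'

    -- The circuit that leaves v along Φ₁, follows the arc from o₁ through z to o₂ and returns along
    -- Φ₂ visits v, o₁, z, o₂ in this order, and these lie alternately outside and inside S.
    fan-crosses : ∀ {S} → CrossesTwice S → ∀ {v o₁ o₂} → S v ≡ false → S z ≡ false → S o₁ ≡ true → S o₂ ≡ true →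
      (Φ₁ : Path v o₁) (Φ₂ : Path v o₂) → Simple Φ₁ → Simple Φ₂ → O o₁ → O o₂ →
      (∀ {t} → t ∈ verts Φ₁ → O t → t ≡ o₁) → (∀ {t} → t ∈ verts Φ₂ → O t → t ≡ o₂) →
      (∀ {t} → t ∈ verts Φ₁ → t ∈ verts Φ₂ → t ≡ v) → ⊥
    fan-crosses {S} NC {v} {o₁} {o₂} Sv Sz So₁ So₂ Φ₁ Φ₂ s₁ s₂ O₁ O₂ only₁ only₂ c =
      NC Φ₁ A₁ (reverse A₂) Φ₂ simple s₂ disj (≢-sym (bool-≢ So₁ Sv)) (bool-≢ So₁ Sz) (≢-sym (bool-≢ So₂ Sz))
      where
      o₁≢v : o₁ ≢ v
      o₁≢v e = bool-≢ So₁ Sv (cong S e)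
      o₁≢o₂ : o₁ ≢ o₂
      o₁≢o₂ refl = o₁≢v (c (end∈ Φ₁) (end∈ Φ₂))
      arcs : Arcs R R' o₁ o₂
      arcs = arcsThrough R R' sR sR' d O₁ O₂ o₁≢o₂ (λ e → bool-≢ So₁ Sz (cong S e)) (λ e → bool-≢ So₂ Sz (cong S e))
      open Arcs arcs
      onA : ∀ {t} → t ∈ verts (A₁ ◅◅ reverse A₂) → O t
      onA m = [ on₁ , on₂ ∘ ∈-rev⁻ Adj-sym A₂ ]′ (∈-◅◅⁻ A₁ (reverse A₂) m)
      simple : Simple (Φ₁ ◅◅ A₁ ◅◅ reverse A₂)
      simple = Simple-◅◅⁺ Φ₁ _ s₁
        (Simple-◅◅⁺ A₁ (reverse A₂) simple₁ (Simple-rev Adj-sym A₂ simple₂) (λ m m' → common m (∈-rev⁻ Adj-sym A₂ m')))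
        λ m m' → only₁ m (onA m')
      disj : ∀ {t} → t ∈ verts (Φ₁ ◅◅ A₁ ◅◅ reverse A₂) → t ∈ verts Φ₂ → t ≡ v ⊎ t ≡ o₂
      disj m m' with ∈-◅◅⁻ Φ₁ (A₁ ◅◅ reverse A₂) m
      ... | inj₁ l = inj₁ (c l m')
      ... | inj₂ r = inj₂ (only₂ m' (onA r))

  -- A circuit through y and z that misses the quadrant S = S' = false, together with a fan to it
  -- from that quadrant: two ends of the fan lie on the same side of S or of S'.
  module _ {S S' : V → Bool} (NC : CrossesTwice S) (NC' : CrossesTwice S') {y z} (R R' : Path y z)
           (sR : Simple R) (sR' : Simple R')
           (d : ∀ {t} → t ∈ verts R → t ∈ verts R' → t ≡ y ⊎ t ≡ z)
           (Sz : S z ≡ false) (S'y : S' y ≡ false) (y≢z : y ≢ z) (¬yz : ¬ Adj G y z) where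

    private
      O : V → Set
      O x = x ∈ verts R ⊎ x ∈ verts R'

      open import Data.List.Membership.DecPropositional (_≟_ {n}) using (_∈?_)

      O? : ∀ x → Dec (O x)
      O? x = (x ∈? verts R) ⊎-dec (x ∈? verts R')

      interior : (p : Path y z) → Simple p → ∃ λ w → w ∈ verts p × y ≢ w × w ≢ z
      interior ε       s = contradiction refl y≢z
      interior (a ◅ p) s = _ , there (here refl) , Adj⇒≢ a , λ { refl → ¬yz a }

    no-circuit-misses-quadrant : ∀ {v} → S v ≡ false → S' v ≡ false → (∀ {x} → O x → S x ≡ true ⊎ S' x ≡ true) → ⊥
    no-circuit-misses-quadrant {v} Sv S'v quadrant with linkedFan
      where
      v∉O : ¬ O v
      v∉O m with quadrant m
      ... | inj₁ e = bool-≢ e Sv refl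
      ... | inj₂ e = bool-≢ e S'v refl
      linked : ∀ s₁ s₂ → ∃ λ b → O b × Σ (Path v b) λ p → ∀ {x} → x ∈ verts p → x ≡ v ⊎ (⊤ × x ≢ s₁ × x ≢ s₂)
      -- Since y and z are not adjacent, R has an interior vertex. Together with y and z it gives
      -- three targets, so two deleted vertices leave one.
      linked s₁ s₂ with interior R sR
      ... | w , w∈ , y≢w , w≢z with pickAvoiding {P = O} (inj₁ (here refl)) (inj₁ w∈) (inj₁ (end∈ R)) y≢w y≢z w≢z s₁ s₂
      ...   | b , Ob , b≢s₁ , b≢s₂ = let p , av = connected s₁ s₂ v b in b , Ob , p , λ m → case av m of λ
              { (inj₁ e) → inj₁ e ; (inj₂ (inj₁ refl)) → inj₂ (tt , b≢s₁ , b≢s₂) ; (inj₂ (inj₂ (p , q))) → inj₂ (tt , p , q) }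
      linkedFan : ∃₂ λ (F F' : FanPath v O (λ _ → ⊤)) →
        (∀ {t} → t ∈ verts (FanPath.path F) → t ∈ verts (FanPath.path F') → t ≡ v) ×
        ((S (FanPath.top F) ≡ true × S (FanPath.top F') ≡ true) ⊎ (S' (FanPath.top F) ≡ true × S' (FanPath.top F') ≡ true))
      linkedFan with fan v O? (λ _ → yes tt) v∉O linked
      ... | Φ , inter with pigeonhole₃ (λ i → quadrant (FanPath.top∈O (Φ i)))
      ...   | i , j , i≢j , agree = Φ i , Φ j , (λ {t} m m' → decidable-stable (t ≟ v) λ ne → i≢j (inter m m' ne)) , agree
    ... | F , F' , inter , inj₁ (So , So') = fan-crosses R R' sR sR' d NC Sv Sz So So' F.path F'.path F.simple F'.simple F.top∈O F'.top∈O
                F.onlyTop F'.onlyTop inter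
      where module F = FanPath F
            module F' = FanPath F'
    -- For S' the circuit is read backwards: its arc has to pass through y, where S' is false.
    ... | F , F' , inter , inj₂ (So , So') = fan-crosses (reverse R) (reverse R') (Simple-rev Adj-sym R sR) (Simple-rev Adj-sym R' sR')
                (λ m m' → swap (d (∈-rev⁻ Adj-sym R m) (∈-rev⁻ Adj-sym R' m'))) NC' S'v S'y So So'
                F.path F'.path F.simple F'.simple (to F.top∈O) (to F'.top∈O)
                (λ m o → F.onlyTop m (from o)) (λ m o → F'.onlyTop m (from o))
                inter
      where module F = FanPath F
            module F' = FanPath F'
            swap : ∀ {t} → t ≡ y ⊎ t ≡ z → t ≡ z ⊎ t ≡ y
            swap = [ inj₂ , inj₁ ]′
            to : ∀ {t} → O t → t ∈ verts (reverse R) ⊎ t ∈ verts (reverse R')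
            to = [ inj₁ ∘ ∈-rev⁺ Adj-sym R , inj₂ ∘ ∈-rev⁺ Adj-sym R' ]′
            from : ∀ {t} → t ∈ verts (reverse R) ⊎ t ∈ verts (reverse R') → O t
            from = [ inj₁ ∘ ∈-rev⁻ Adj-sym R , inj₂ ∘ ∈-rev⁻ Adj-sym R' ]′

  CrossesTwice-not : ∀ {S} → CrossesTwice S → CrossesTwice (not ∘ S)
  CrossesTwice-not NC p₁ p₂ p₃ Q s s' d ne₁ ne₂ ne₃ =
    NC p₁ p₂ p₃ Q s s' d (ne₁ ∘ cong not) (ne₂ ∘ cong not) (ne₃ ∘ cong not)

  -- Each of three disjoint y–z paths misses one of the quadrants of u and v, and two miss the same.
  laminar-nonadjacent : ∀ {S S'} → CrossesTwice S → CrossesTwice S' → ∀ {y z u v} →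
    S y ≡ true → S' y ≡ false → S z ≡ false → S' z ≡ true → S u ≡ true → S' u ≡ true → S v ≡ false → S' v ≡ false →
    ¬ Adj G y z → ⊥
  laminar-nonadjacent {S} {S'} NC NC' {y} {z} {u} {v} Sy S'y Sz S'z Su S'u Sv S'v ¬yz =
    case pigeonhole₃ (λ i → classify i) of λ
    { (i , j , i≢j , inj₁ (a , b)) → no-circuit-misses-quadrant NC NC' (R i) (R j) (sR i) (sR j)
        (λ m m' → proj₂ F m m' i≢j) Sz S'y y≢z ¬yz Sv S'v [ a , b ]′
    -- Complementing turns the quadrant of u into the one to be missed. The cuts trade places, since
    -- it is the complement of S' that is false at z and that of S that is false at y.
    ; (i , j , i≢j , inj₂ (a , b)) → no-circuit-misses-quadrant (CrossesTwice-not NC') (CrossesTwice-not NC) (R i) (R j) (sR i) (sR j)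
        (λ m m' → proj₂ F m m' i≢j) (cong not S'z) (cong not Sy) y≢z ¬yz (cong not S'u) (cong not Su)
        [ a , b ]′ }
    where
    y≢z : y ≢ z
    y≢z e = bool-≢ Sy Sz (cong S e)
    F = threePaths y z y≢z ¬yz
    R : Fin 3 → Path y z
    R i = proj₁ (proj₁ F i)
    sR : ∀ i → Simple (R i)
    sR i = proj₂ (proj₁ F i)
    another : ∀ i → ∃ λ j → i ≢ j
    another zero    = suc zero , λ ()
    another (suc i) = zero , λ ()

    Neither Both : V → Set
    Neither x = S x ≡ false × S' x ≡ false
    Both x    = S x ≡ true × S' x ≡ true

    -- If p comes before q, then S' reads false, true, false, true along y, p, q, z; if q comes
    -- first, S reads true, false, true, false along y, q, p, z. Another of the three paths closes
    -- the circuit.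
    monotone : ∀ i {p q} → p ∈ verts (R i) → Both p → q ∈ verts (R i) → Neither q → ⊥
    monotone i {p} {q} m (Sp , S'p) m' (Sq , S'q) = go (R i) (sR i) (λ r r' → proj₂ F r r' (proj₂ (another i))) m m'
      where
      j = proj₁ (another i)
      go : (P : Path y z) → Simple P → (∀ {t} → t ∈ verts P → t ∈ verts (R j) → t ≡ y ⊎ t ≡ z) →
           p ∈ verts P → q ∈ verts P → ⊥
      go P s d m m' with split P m
      ... | α , β , refl with ∈-◅◅⁻ α β m'
      ...   | inj₂ r with split β r
      ...     | μ , γ , refl = NC' α μ γ (R j) s (sR j) d (≢-sym (bool-≢ S'p S'y)) (bool-≢ S'p S'q) (≢-sym (bool-≢ S'z S'q))
      go P s d m m' | α , β , refl | inj₁ l with split α l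
      ...     | α₁ , α₂ , refl = NC α₁ α₂ β (R j) (subst Simple assoc s) (sR j) (λ r → d (subst (λ P → _ ∈ verts P) (sym assoc) r))
                  (bool-≢ Sy Sq) (≢-sym (bool-≢ Sp Sq)) (bool-≢ Sp Sz)
        where
        assoc : (α₁ ◅◅ α₂) ◅◅ β ≡ α₁ ◅◅ α₂ ◅◅ β
        assoc = Star.◅◅-assoc α₁ α₂ β

    classify : ∀ i → (∀ {x} → x ∈ verts (R i) → S x ≡ true ⊎ S' x ≡ true)
                   ⊎ (∀ {x} → x ∈ verts (R i) → not (S' x) ≡ true ⊎ not (S x) ≡ true)
    classify i with Any.any? (λ x → (S x Bool.≟ false) ×-dec (S' x Bool.≟ false)) (verts (R i))
    ... | no none = inj₁ λ {x} m → side x (S x) (S' x) refl refl m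
      where
      side : ∀ x b b' → S x ≡ b → S' x ≡ b' → x ∈ verts (R i) → S x ≡ true ⊎ S' x ≡ true
      side x true  _     e _  _ = inj₁ e
      side x false true  _ e  _ = inj₂ e
      side x false false e e' m = contradiction (Any.map (λ { refl → e , e' }) m) none
    ... | yes some = inj₂ λ {x} m → side x (S x) (S' x) refl refl m
      where
      side : ∀ x b b' → S x ≡ b → S' x ≡ b' → x ∈ verts (R i) → not (S' x) ≡ true ⊎ not (S x) ≡ true
      side x _     false _ e  _ = inj₁ (cong not e)
      side x false true  e _  _ = inj₂ (cong not e)
      side x true  true  e e' m = ⊥-elim (let q , q∈ , Nq = findNeither in monotone i m (e , e') q∈ Nq)
        where
        findNeither : ∃ λ q → q ∈ verts (R i) × Neither q
        findNeither = find some

  -- Complementing S' exchanges the two diagonals of the four quadrants, so it is enough that one of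
  -- the pairs y, z and u, v is nonadjacent.
  laminar : ∀ {S S'} → CrossesTwice S → CrossesTwice S' → ∀ {y z u v} →
    S y ≡ true → S' y ≡ false → S z ≡ false → S' z ≡ true → S u ≡ true → S' u ≡ true → S v ≡ false → S' v ≡ false →
    ¬ (Adj G y z × Adj G u v) → ⊥
  laminar {S} {S'} NC NC' {y} {z} {u} {v} Sy S'y Sz S'z Su S'u Sv S'v ¬both with adj? y z
  ... | no ¬yz = laminar-nonadjacent NC NC' Sy S'y Sz S'z Su S'u Sv S'v ¬yz
  ... | yes yz = laminar-nonadjacent NC (CrossesTwice-not NC') Su (cong not S'u) Sv (cong not S'v) Sy (cong not S'y) Sz (cong not S'z)
                   λ uv → ¬both (yz , uv)

-- Injective circuit maps

module InjectiveCase {n m : ℕ} (G : Graph n) (G' : Graph m) (f : Edge G → Edge G') (3-conn : KConnected 3 G)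
  (f-circ : IsCircuitSurjection G G' f) (f-inj : Injective _≡_ _≡_ f) where

  open OnGraph G
  open ThreeConnected G 3-conn
  open Laminar G 3-conn
  private
    module G' = OnGraph G'
    V = Fin n

  B : Fin m → Edge G → Set
  B w e = G'.Inc w (f e)

  B? : ∀ w e → Dec (B w e)
  B? w e = G'.inc? w (f e)

  image : ∀ {xs} → IsCircuit G (_∈ xs) → G'.Circ (Image {G = G} {G'} f (_∈ xs))
  image {xs} c = G'.IsCircuit⇒Circ (proj₂ (proj₂ f-circ) (_∈ xs) c)

  atMostTwo : ∀ {xs w e e' e''} → IsCircuit G (_∈ xs) → e ∈ xs → e' ∈ xs → e'' ∈ xs →
              B w e → B w e' → B w e'' → e ≢ e' → e ≢ e'' → e' ≢ e'' → ⊥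
  atMostTwo c m m' m'' b b' b'' ne ne' ne'' = G'.Circ.notThree (image c) (_ , m , refl) (_ , m' , refl) (_ , m'' , refl)
    b b' b'' (ne ∘ f-inj) (ne' ∘ f-inj) (ne'' ∘ f-inj)

  notOnce : ∀ {xs w e} → IsCircuit G (_∈ xs) → e ∈ xs → B w e → ∃ λ e' → e' ∈ xs × e' ≢ e × B w e'
  notOnce {e = e} c m b with G'.Circ.two (image c) (e , m , refl) b
  ... | _ , ne , (e' , m' , refl) , b' , _ = e' , m' , (λ { refl → ne refl }) , b'

  -- Surjectivity and the absence of isolated vertices enter here. The edge found is the seed from
  -- which the side of w is built.
  someEdge : ∀ w → ∃ (B w)
  someEdge w with proj₁ (proj₂ f-circ) w
  ... | w' , a with proj₁ f-circ (G'.edge a)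
  ...   | e , fe = e , subst (G'.Inc w) (sym (fe refl)) (G'.Joins⇒Incˡ {e = G'.edge a} (G'.joins-edge a))

  crossing : ∀ (S : V → Bool) {u v} (p : Path u v) → S u ≢ S v →
             ∃₂ λ x y → Σ (Adj G x y) λ a → edge a ∈ edges p × S x ≢ S y
  crossing S ε       ne = contradiction refl ne
  crossing S {u} (_◅_ {j = w} a p) ne with S u Bool.≟ S w
  ... | no u≢w = _ , _ , a , here refl , u≢w
  ... | yes eq with crossing S p (ne ∘ trans eq)
  ...   | x , y , b , m , x≢y = x , y , b , there m , x≢y

  record Side (w : Fin m) (S : V → Bool) : Set where
    field
      separates : ∀ {u v} (a : Adj G u v) → B w (edge a) → S u ≢ S v
      cut       : ∀ {u v} (a : Adj G u v) → S u ≢ S v → B w (edge a)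

    separatesJ : ∀ {e u v} → Joins G e u v → B w e → S u ≢ S v
    separatesJ {e} j b = let a = Joins⇒Adj {e} j in separates a (subst (B w) (sym (edge-Joins {e = e} a j)) b)

  Side-not : ∀ {w S} → Side w S → Side w (not ∘ S)
  Side-not s = record
    { separates = λ a b eq → Side.separates s a b (Bool.not-injective eq)
    ; cut       = λ a ne → Side.cut s a (ne ∘ cong not) }

  -- The component of one end of an edge of B w in G − B w is a side of w.
  module _ (w : Fin m) where

    private
      R : V → V → Set
      R u v = Σ (Adj G u v) λ a → ¬ B w (edge a)

      R? : ∀ u v → Dec (R u v)
      R? u v with adj? u v
      ... | no ¬a = no (¬a ∘ proj₁)
      ... | yes a = map′ (a ,_) (λ (a' , ¬b) → ¬b ∘ subst (B w) (edge-unique a a')) (¬? (B? w (edge a)))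

      R-sym : ∀ {u v} → R u v → R v u
      R-sym (a , ¬b) = Adj-sym a , ¬b ∘ subst (B w) (edge-sym (Adj-sym a) a)

      ¬B-edges : ∀ {u v e} (p : Star R u v) → e ∈ edges (Star.map proj₁ p) → ¬ B w e
      ¬B-edges ((a , ¬b) ◅ p) (here refl) = ¬b
      ¬B-edges (_ ◅ p)        (there m)   = ¬B-edges p m

      -- Closing the edge by a path outside `B w` would give a circuit with exactly one edge in
      -- `B w`, but its image has degree zero or two at w.
      B⇒¬reach : ∀ {u v} (a : Adj G u v) → B w (edge a) → ¬ Star R u v
      B⇒¬reach {u} {v} a b p with pathTo _≟_ (_≟ v) p refl
      ... | pathInto q refl sq _ _ with notOnce circuit (here refl) b
        where
        circuit : IsCircuit G (_∈ edge a ∷ edges (Star.map proj₁ q))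
        circuit = joinPaths (a ◅ ε) (Star.map proj₁ q) ((Adj⇒≢ a ∷ []) ∷ [] ∷ [])
          (subst Unique (sym (verts-map proj₁ q)) sq)
          (λ { (here e) _ → inj₁ e ; (there (here e)) _ → inj₂ e })
          (edge a , here refl , λ m → ¬B-edges q m b)
      ...   | e' , here refl , ne , b' = ne refl
      ...   | e' , there m , ne , b'   = ¬B-edges q m b'

      g = proj₁ (someEdge w)
      Bg = proj₂ (someEdge w)
      r = proj₁ (proj₁ g)

    side : V → Bool
    side x = does (star? R? r x)

    private
      side⁺ : ∀ {x} → Star R r x → side x ≡ true
      side⁺ {x} = dec-true (star? R? r x)

      side-false : ∀ {x} → ¬ Star R r x → side x ≡ false
      side-false {x} = dec-false (star? R? r x)

      closed : ∀ {u v} → R u v → side u ≡ side v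
      closed {u} {v} s with star? R? r u | star? R? r v
      ... | yes _ | yes _ = refl
      ... | no _  | no _  = refl
      ... | yes p | no ¬q = contradiction (p ◅◅ s ◅ ε) ¬q
      ... | no ¬p | yes q = contradiction (q ◅◅ R-sym s ◅ ε) ¬p

      g-separated : ∀ {x y} → Joins G g x y → side x ≢ side y
      g-separated (inj₁ refl) eq = bool-≢ (side⁺ ε) (side-false (B⇒¬reach (edge-adj g) (subst (B w) (sym (edge-Joins {e = g} (edge-adj g) (inj₁ refl))) Bg))) eq
      g-separated (inj₂ refl) eq = bool-≢ (side⁺ ε) (side-false (B⇒¬reach (edge-adj g) (subst (B w) (sym (edge-Joins {e = g} (edge-adj g) (inj₁ refl))) Bg))) (sym eq)

    isSide : Side w side
    isSide = record { separates = separates ; cut = cut }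
      where
      cut : ∀ {u v} (a : Adj G u v) → side u ≢ side v → B w (edge a)
      cut a ne = decidable-stable (B? w (edge a)) λ ¬b → ne (closed (a , ¬b))

      -- Suppose h in `B w` had both ends on one side. On a circuit through g and h the part from
      -- one end of g to the other must change sides, at an edge of `B w` other than g and h. That
      -- makes three edges of `B w` on one circuit.
      separates : ∀ {u v} (a : Adj G u v) → B w (edge a) → side u ≢ side v
      separates {u} {v} a b eq = atMostTwo (circuit g≢h) (∈-++⁺ʳ (edges across) (here refl)) (∈-++⁺ˡ h∈across) (∈-++⁺ˡ (proj₁ (proj₂ (proj₂ (proj₂ c)))))
          Bg b (cut (proj₁ (proj₂ (proj₂ c))) c≢) g≢h g≢c h≢c
        where
        open Linkage (linkage g (edge a))
        h = edge a
        g≢h : g ≢ h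
        g≢h e = g-separated (subst (λ d → Joins G d u v) (sym e) (joins-edge a)) eq
        c = crossing side across (g-separated joins-e)
        c≢ = proj₂ (proj₂ (proj₂ (proj₂ c)))
        edge-c = edge (proj₁ (proj₂ (proj₂ c)))
        joins-c : Joins G edge-c (proj₁ c) (proj₁ (proj₂ c))
        joins-c = joins-edge (proj₁ (proj₂ (proj₂ c)))
        h≢c : h ≢ edge-c
        h≢c e with Inc-Joins {h} (joins-edge a) (subst (Inc _) (sym e) (Joins⇒Incˡ {edge-c} joins-c))
                 | Inc-Joins {h} (joins-edge a) (subst (Inc _) (sym e) (Joins⇒Incʳ {edge-c} joins-c))
        ... | inj₁ p | inj₁ q = c≢ (cong side (trans p (sym q)))
        ... | inj₁ p | inj₂ q = c≢ (trans (cong side p) (trans eq (sym (cong side q))))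
        ... | inj₂ p | inj₁ q = c≢ (trans (cong side p) (trans (sym eq) (sym (cong side q))))
        ... | inj₂ p | inj₂ q = c≢ (cong side (trans p (sym q)))
        g≢c : g ≢ edge-c
        g≢c e = g≢h (sym (trans (end-edge across across-simple b' (subst (_∈ edges across) (trans (sym e) (sym b'≡g)) (proj₁ (proj₂ (proj₂ (proj₂ c))))) h∈across) b'≡g))
          where
          b' = Joins⇒Adj {g} joins-e
          b'≡g : edge b' ≡ g
          b'≡g = edge-Joins {e = g} b' joins-e

  apart : ∀ {u v w e e'} (p : Path u v) (q : Path v w) → Simple (p ◅◅ q) → e ∈ edges p → e' ∈ edges q → e ≢ e'
  apart {e = e} p q s m m' refl =
    let _ , _ , c = Simple-◅◅⁻ p q s in
    Adj⇒≢ (edge-adj e) (trans (c (Inc-edges p m (inj₁ refl)) (Inc-edges q m' (inj₁ refl)))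
                        (sym (c (Inc-edges p m (inj₂ refl)) (Inc-edges q m' (inj₂ refl)))))

  Side⇒CrossesTwice : ∀ {w S} → Side w S → CrossesTwice S
  Side⇒CrossesTwice {w} {S} side {x} {a} {b} {y} p₁ p₂ p₃ Q s sQ d ne₁ ne₂ ne₃
    with crossing S p₁ ne₁ | crossing S p₂ ne₂ | crossing S p₃ ne₃
  ... | _ , _ , a₁ , m₁ , c₁ | _ , _ , a₂ , m₂ , c₂ | _ , _ , a₃ , m₃ , c₃ =
    atMostTwo (joinPaths P Q s sQ d private-edge) (∈-++⁺ˡ in₁) (∈-++⁺ˡ in₂) (∈-++⁺ˡ in₃)
      (cut a₁ c₁) (cut a₂ c₂) (cut a₃ c₃) e₁≢e₂ (apart p₁ _ s m₁ (∈-edges-◅◅⁺ʳ p₂ p₃ m₃))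
      (apart p₂ p₃ (proj₁ (proj₂ (Simple-◅◅⁻ p₁ (p₂ ◅◅ p₃) s))) m₂ m₃)
    where
    open Side side
    open import Data.List.Membership.DecPropositional _≟ᴱ_ using (_∈?_)
    P = p₁ ◅◅ p₂ ◅◅ p₃
    in₁ : edge a₁ ∈ edges P
    in₁ = ∈-edges-◅◅⁺ˡ p₁ _ m₁
    in₂ : edge a₂ ∈ edges P
    in₂ = ∈-edges-◅◅⁺ʳ p₁ _ (∈-edges-◅◅⁺ˡ p₂ p₃ m₂)
    in₃ : edge a₃ ∈ edges P
    in₃ = ∈-edges-◅◅⁺ʳ p₁ _ (∈-edges-◅◅⁺ʳ p₂ p₃ m₃)
    e₁≢e₂ : edge a₁ ≢ edge a₂
    e₁≢e₂ = apart p₁ _ s m₁ (∈-edges-◅◅⁺ˡ p₂ p₃ m₂)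
    shared : ∀ {e} → e ∈ edges P → e ∈ edges Q → Joins G e x y
    shared {e} m m' with d (Inc-edges P m (inj₁ refl)) (Inc-edges Q m' (inj₁ refl)) | d (Inc-edges P m (inj₂ refl)) (Inc-edges Q m' (inj₂ refl))
    ... | inj₁ p | inj₁ q = contradiction (trans p (sym q)) (Adj⇒≢ (edge-adj e))
    ... | inj₁ p | inj₂ q = inj₁ (cong₂ _,_ p q)
    ... | inj₂ p | inj₁ q = inj₂ (cong₂ _,_ p q)
    ... | inj₂ p | inj₂ q = contradiction (trans p (sym q)) (Adj⇒≢ (edge-adj e))
    -- Paths that meet only in x and y can share no edge but the one joining x and y, and P has at
    -- least two edges.
    private-edge : ∃ λ e → e ∈ edges P × e ∉ edges Q
    private-edge with edge a₁ ∈? edges Q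
    ... | no ∉₁ = edge a₁ , in₁ , ∉₁
    ... | yes ∈₁ = edge a₂ , in₂ , λ ∈₂ → e₁≢e₂ (Joins-unique {edge a₁} {edge a₂} (shared in₁ ∈₁) (shared in₂ ∈₂))

  IsStar : Fin m → V → Set
  IsStar w v = (∀ {e} → B w e → Inc v e) × (∀ {e} → Inc v e → B w e)

  Single : (V → Bool) → Set
  Single S = ∃ λ v → S v ≡ true × (∀ u → S u ≡ true → u ≡ v)

  single? : ∀ S → Dec (Single S)
  single? S = any? λ v → (S v Bool.≟ true) ×-dec all? λ u → (S u Bool.≟ true) →-dec (u ≟ v)

  Single⇒IsStar : ∀ {w S} → Side w S → Single S → ∃ (IsStar w)
  Single⇒IsStar {w} {S} s (v , Sv , only) = v , to , from
    where
    open Side s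
    false≢ : ∀ {u} → v ≢ u → S u ≢ true
    false≢ ne Su = ne (sym (only _ Su))
    to : ∀ {e} → B w e → Inc v e
    to {e} b with S (proj₁ (proj₁ e)) in p | S (proj₂ (proj₁ e)) in q
    ... | true  | _     = inj₁ (sym (only _ p))
    ... | false | true  = inj₂ (sym (only _ q))
    ... | false | false = contradiction (trans p (sym q)) (separatesJ {e} (inj₁ refl) b)
    cutJ : ∀ {e u} → Joins G e v u → B w e
    cutJ {e} j = let a = Joins⇒Adj {e} j in subst (B w) (edge-Joins {e = e} a j)
      (cut a λ eq → false≢ (Adj⇒≢ a) (trans (sym eq) Sv))
    from : ∀ {e} → Inc v e → B w e
    from {e} (inj₁ refl) = cutJ {e} (inj₁ refl)
    from {e} (inj₂ refl) = cutJ {e} (inj₂ refl)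

  -- Every edge at v would be mapped to the one edge joining w and w', yet v has two edges and f is
  -- injective.
  star-unique : ∀ {w w' v} → IsStar w v → IsStar w' v → w ≡ w'
  star-unique {w} {w'} {v} (_ , from) (_ , from') with neighbour v v v
  ... | x , a , _ with neighbour v x x
  ...   | y , b , y≢x , _ = decidable-stable (w ≟ w') λ w≢w' →
    let ia = Joins⇒Incˡ {edge a} (joins-edge a)
        ib = Joins⇒Incˡ {edge b} (joins-edge b)
        a≡b = f-inj (G'.Joins-unique {f (edge a)} {f (edge b)} (G'.Inc²⇒Joins {f (edge a)} w≢w' (from ia) (from' ia)) (G'.Inc²⇒Joins {f (edge b)} w≢w' (from ib) (from' ib)))
    in case Inc-Joins {edge a} (joins-edge a) (subst (Inc y) (sym a≡b) (Joins⇒Incʳ {edge b} (joins-edge b))) of λ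
       { (inj₁ e) → Adj⇒≢ b (sym e) ; (inj₂ e) → y≢x e }

  star-injective : ∀ {w v v'} → IsStar w v → IsStar w v' → v ≡ v'
  star-injective {w} {v} {v'} (_ , from) (to' , _) with neighbour v v' v'
  ... | x , a , x≢v' , _ with Inc-Joins {edge a} (joins-edge a) (to' {edge a} (from {edge a} (Joins⇒Incˡ {edge a} (joins-edge a))))
  ...   | inj₁ e = sym e
  ...   | inj₂ e = contradiction (sym e) x≢v'

  Starred : V → Set
  Starred v = ∃ λ w → IsStar w v

  -- The image of the edge has two distinct ends in `G'`. Each has the star of x or of y as its cut,
  -- and both cannot have that of y by `star-unique`, so one of them belongs to x.
  starredEnds : ∀ {x y} (a : Adj G x y) → (∀ {w} → B w (edge a) → ∃ (IsStar w)) →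
                Starred x × (∀ {w} → B w (edge a) → IsStar w x ⊎ IsStar w y)
  starredEnds {x} {y} a h = starred (at (inj₁ refl)) (at (inj₂ refl)) , at
    where
    at : ∀ {w} → B w (edge a) → IsStar w x ⊎ IsStar w y
    at b with h b
    ... | v , st with Inc-Joins {edge a} (joins-edge a) (proj₁ st b)
    ...   | inj₁ refl = inj₁ st
    ...   | inj₂ refl = inj₂ st
    e' = f (edge a)
    starred : IsStar (proj₁ (proj₁ e')) x ⊎ IsStar (proj₁ (proj₁ e')) y →
              IsStar (proj₂ (proj₁ e')) x ⊎ IsStar (proj₂ (proj₁ e')) y → Starred x
    starred (inj₁ st) _          = _ , st
    starred (inj₂ _)  (inj₁ st)  = _ , st
    starred (inj₂ st) (inj₂ st') = contradiction (star-unique st st') (G'.Adj⇒≢ (G'.edge-adj e'))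

  size : (V → Bool) → ℕ
  size S = ∣ tabulate S ∣

  size-< : ∀ {S S'} → (∀ x → S x ≡ true → S' x ≡ true) → ∀ {y} → S y ≡ false → S' y ≡ true → size S ℕ.< size S'
  size-< {S} {S'} sub {y} Sy S'y = Subset.p⊂q⇒∣p∣<∣q∣
      ((λ {x} m → in⁺ S' (sub x (in⁻ S m))) , y , in⁺ S' S'y , λ m → bool-≢ (in⁻ S m) Sy refl)
    where
    in⁺ : ∀ (T : V → Bool) {x} → T x ≡ true → x Subset.∈ tabulate T
    in⁺ T {x} e = Vec.lookup⇒[]= x _ (trans (Vec.lookup∘tabulate T x) e)
    in⁻ : ∀ (T : V → Bool) {x} → x Subset.∈ tabulate T → T x ≡ true
    in⁻ T {x} m = trans (sym (Vec.lookup∘tabulate T x)) (Vec.[]=⇒lookup m)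

  -- Otherwise all edges at s cross S; together with a crossing edge away from s they give
  -- a circuit with three crossing edges.
  innerNeighbour : ∀ {w S} → Side w S → ¬ Single S → ∀ {s} → S s ≡ true → ∃ λ s' → Adj G s s' × S s' ≡ true
  innerNeighbour {w} {S} side ¬single {s} Ss with any? (λ s' → adj? s s' ×-dec (S s' Bool.≟ true))
  ... | yes found = found
  ... | no none with any? (λ s' → (S s' Bool.≟ true) ×-dec ¬? (s' ≟ s)) | neighbour s s s
  ...   | no alone | _ = contradiction (s , Ss , λ u Su → decidable-stable (u ≟ s) λ ne → alone (u , Su , ne)) ¬single
  ...   | yes (s' , Ss' , s'≢s) | t , a , t≢s , _ = ⊥-elim (impossible (linkage e (edge c)))
    where
    open Side side
    e = edge a
    outer : ∀ {u} → Adj G s u → S u ≡ false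
    outer {u} b = Bool.¬-not λ Su → none (u , b , Su)
    at-s : ∀ {d} → Inc s d → B w d
    at-s {d} i = let _ , b , eq = incident {e = d} i in subst (B w) eq (cut b (bool-≢ Ss (outer b)))
    walk = connected s s s' t
    cr = crossing S (proj₁ walk) (bool-≢ Ss' (outer a))
    c = proj₁ (proj₂ (proj₂ cr))
    c≢ : S (proj₁ cr) ≢ S (proj₁ (proj₂ cr))
    c≢ = proj₂ (proj₂ (proj₂ (proj₂ cr)))
    s∉c : ¬ Inc s (edge c)
    s∉c i with proj₂ walk (Inc-edges (proj₁ walk) (proj₁ (proj₂ (proj₂ (proj₂ cr)))) i)
    ... | inj₁ e              = s'≢s (sym e)
    ... | inj₂ (inj₁ e)       = t≢s (sym e)
    ... | inj₂ (inj₂ (ne , _)) = ne refl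
    s∈e : Inc s e
    s∈e = Joins⇒Incˡ {e} (joins-edge a)
    e≢c : e ≢ edge c
    e≢c eq = s∉c (subst (Inc s) eq s∈e)
    impossible : Linkage e (edge c) → ⊥
    impossible l with Circ.two (IsCircuit⇒Circ (circuit e≢c)) (∈-++⁺ʳ (edges across) (here refl)) s∈e
      where open Linkage l
    ... | e' , e'≢e , m , i , _ = atMostTwo (circuit e≢c) (∈-++⁺ʳ (edges across) (here refl)) m (∈-++⁺ˡ h∈across)
            (at-s s∈e) (at-s i) (cut c c≢) (≢-sym e'≢e) e≢c (λ eq → s∉c (subst (Inc s) eq i))
      where open Linkage l

  -- If S is a side of w of minimal size among those without a star, then every edge inside S is only
  -- cut by stars, so the vertices of G' given by w and by the stars of S are closed under adjacency.
  module MinimalSide {w S} (S-side : Side w S) (¬single : ¬ Single S) (¬single' : ¬ Single (not ∘ S))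
    (smaller : ∀ {w' S'} → Side w' S' → size S' ℕ.< size S → ∃ (IsStar w')) where

    open Side S-side

    same-edge : ∀ {u v u' v' w'} (a : Adj G u v) (b : Adj G u' v') → w ≢ w' →
                B w (edge a) → B w' (edge a) → B w (edge b) → B w' (edge b) → edge a ≡ edge b
    same-edge a b ne b₁ b₂ b₃ b₄ = f-inj (G'.Joins-unique {f (edge a)} {f (edge b)}
      (G'.Inc²⇒Joins {f (edge a)} ne b₁ b₂) (G'.Inc²⇒Joins {f (edge b)} ne b₃ b₄))

    -- If one of the two quadrants outside S is empty, then S' or its complement lies in S, properly
    -- because of y or x, and minimality applies. Otherwise all four are occupied. By laminarity
    -- both diagonals are then edges, lying in both cuts; such an edge is unique, since its image
    -- joins w and w'.
    inside-cut : ∀ {x y w' S'} (a : Adj G x y) → S x ≡ true → S y ≡ true → B w' (edge a) → Side w' S' →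
                 S' x ≡ true → S' y ≡ false → ∃ (IsStar w')
    inside-cut {x} {y} {w'} {S'} a Sx Sy b side' S'x S'y
      with any? (λ t → (S t Bool.≟ false) ×-dec (S' t Bool.≟ true)) | any? (λ t → (S t Bool.≟ false) ×-dec (S' t Bool.≟ false))
    ... | no none | _ = smaller side' (size-< (λ t S't → Bool.¬-not λ St → none (t , St , S't)) S'y Sy)
    ... | _ | no none = smaller (Side-not side') (size-< (λ t S't → Bool.¬-not λ St → none (t , St , Bool.not-injective S't)) (cong not S'x) Sx)
    ... | yes (z , Sz , S'z) | yes (v , Sv , S'v) = ⊥-elim (laminar (Side⇒CrossesTwice S-side) (Side⇒CrossesTwice side')
            Sy S'y Sz S'z Sx S'x Sv S'v λ (yz , xv) →
              let eq = same-edge yz xv w≢w' (cut yz (bool-≢ Sy Sz)) (Side.cut side' yz (≢-sym (bool-≢ S'z S'y)))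
                                            (cut xv (bool-≢ Sx Sv)) (Side.cut side' xv (bool-≢ S'x S'v))
              in case Inc-Joins {edge xv} (joins-edge xv) (subst (Inc y) eq (Joins⇒Incˡ {edge yz} (joins-edge yz))) of λ
                 { (inj₁ e) → bool-≢ S'x S'y (cong S' (sym e)) ; (inj₂ e) → bool-≢ Sy Sv (cong S e) })
      where
      w≢w' : w ≢ w'
      w≢w' refl = separates a b (trans Sx (sym Sy))

    inside : ∀ {x y w'} (a : Adj G x y) → S x ≡ true → S y ≡ true → B w' (edge a) → ∃ (IsStar w')
    inside {x} {y} {w'} a Sx Sy b with side w' x in p | side w' y in q
    ... | true  | false = inside-cut a Sx Sy b (isSide w') p q
    ... | false | true  = inside-cut a Sx Sy b (Side-not (isSide w')) (cong not p) (cong not q)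
    ... | true  | true  = contradiction (trans p (sym q)) (Side.separates (isSide w') a b)
    ... | false | false = contradiction (trans p (sym q)) (Side.separates (isSide w') a b)

    starred-inside : ∀ {x y} (a : Adj G x y) → S x ≡ true → S y ≡ true → Starred x × (∀ {w'} → B w' (edge a) → IsStar w' x ⊎ IsStar w' y)
    starred-inside a Sx Sy = starredEnds a (inside a Sx Sy)

    starred : ∀ {s} → S s ≡ true → Starred s
    starred Ss = let _ , a , Ss' = innerNeighbour S-side ¬single Ss in proj₁ (starred-inside a Ss Ss')

    ¬star-w : ∀ {s} → S s ≡ true → ¬ IsStar w s
    ¬star-w Ss (_ , from) = let _ , a , Ss' = innerNeighbour S-side ¬single Ss in
      separates a (from (Joins⇒Incˡ {edge a} (joins-edge a))) (trans Ss (sym Ss'))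

    Touches : Edge G → Set
    Touches e = ∃ λ s → S s ≡ true × Inc s e

    Closed : Fin m → Set
    Closed w' = w' ≡ w ⊎ ∃ λ s → S s ≡ true × IsStar w' s

    -- An edge inside S is cut only by the stars of its two ends. An edge from s out of S is cut by
    -- w and by the star of s, and its image has just these two ends.
    forward : ∀ {e w'} → Touches e → B w' e → Closed w'
    forward {e} {w'} (s , Ss , i) b with incident {e = e} i
    ... | t , a , refl with S t in St
    ...   | true  = [ (λ st → inj₂ (s , Ss , st)) , (λ st → inj₂ (t , St , st)) ]′ (proj₂ (starred-inside a Ss St) b)
    ...   | false with starred Ss
    ...     | wₛ , st with G'.Inc-Joins {f (edge a)} (G'.Inc²⇒Joins {f (edge a)} (λ { refl → ¬star-w Ss st }) (cut a (bool-≢ Ss St)) (proj₂ st i)) b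
    ...       | inj₁ e' = inj₁ e'
    ...       | inj₂ refl = inj₂ (s , Ss , st)

    backward : ∀ {e w'} → Closed w' → B w' e → Touches e
    backward {e} (inj₁ refl) b with S (proj₁ (proj₁ e)) in p | S (proj₂ (proj₁ e)) in q
    ... | true  | _     = _ , p , inj₁ refl
    ... | false | true  = _ , q , inj₂ refl
    ... | false | false = contradiction (trans p (sym q)) (separatesJ {e} (inj₁ refl) b)
    backward (inj₂ (s , Ss , st)) b = s , Ss , proj₁ st b

    absurd : ⊥
    absurd with someEdge w
    ... | g , Bg with backward {g} (inj₁ refl) Bg
    ...   | s , Ss , i with incident {e = g} i
    -- The complement of S is not a single vertex, so t has a neighbour there too. This supplies the
    -- edge that avoids S.
    ...     | t , a , refl = go (innerNeighbour (Side-not S-side) ¬single' (cong not St))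
      where
      St : S t ≡ false
      St = Bool.¬-not λ St → separates a Bg (trans Ss (sym St))
      go : (∃ λ t' → Adj G t t' × not (S t') ≡ true) → ⊥
      go (t' , b , St') = impossible (linkage (edge a) h)
        where
        h = edge b
        ¬touches : ¬ Touches h
        ¬touches (u , Su , j) with Inc-Joins {h} (joins-edge b) j
        ... | inj₁ refl = bool-≢ Su St refl
        ... | inj₂ refl = bool-≢ Su (Bool.not-injective St') refl
        g≢h : edge a ≢ h
        g≢h eq = ¬touches (s , Ss , subst (Inc s) eq i)
        impossible : Linkage (edge a) h → ⊥
        impossible l = let e , touches , eq = reached in ¬touches (subst Touches (f-inj eq) touches)
          where
          open Linkage l
          D : Edge G' → Set
          D e' = ∃ λ e → Touches e × f e ≡ e'
          reached : D (f h)
          reached = G'.Circ.conn (image (circuit g≢h)) D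
            (λ { _ (e₂ , _ , refl) i₁ i₂ (e₁ , touches , refl) → e₂ , backward {e₂} (forward {e₁} touches i₁) i₂ , refl })
            (edge a , ∈-++⁺ʳ (edges across) (here refl) , refl) (edge a , (s , Ss , i) , refl) (h , ∈-++⁺ˡ h∈across , refl)

  star-below : ∀ k {w S} → Side w S → size S ℕ.< k → ∃ (IsStar w)
  star-below (suc k) {w} {S} s (s≤s size≤k) with single? S | single? (not ∘ S)
  ... | yes single | _           = Single⇒IsStar s single
  ... | no _       | yes single  = Single⇒IsStar (Side-not s) single
  ... | no ¬single | no ¬single' =
    ⊥-elim (MinimalSide.absurd s ¬single ¬single' λ s' lt → star-below k s' (ℕ.<-≤-trans lt size≤k))

  star-of : ∀ w → ∃ (IsStar w)
  star-of w = star-below _ (isSide w) ℕ.≤-refl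

  starred : ∀ v → Starred v
  starred v = let _ , a , _ = neighbour v v v in proj₁ (starredEnds a λ {w} _ → star-of w)

  φ : V → Fin m
  φ v = proj₁ (starred v)

  φ-star : ∀ v → IsStar (φ v) v
  φ-star v = proj₂ (starred v)

  φ-injective : Injective _≡_ _≡_ φ
  φ-injective {u} {v} eq = star-injective (φ-star u) (subst (λ w → IsStar w v) (sym eq) (φ-star v))

  φ-surjective : Surjective _≡_ _≡_ φ
  φ-surjective w = let v , st = star-of w in v , λ { refl → star-unique (φ-star v) st }

  φ-induces : InducedBy {G = G} {G'} f φ
  φ-induces e = G'.Inc²⇒Joins {f e} (Adj⇒≢ (edge-adj e) ∘ φ-injective) (proj₂ (φ-star _) {e} (inj₁ refl)) (proj₂ (φ-star _) {e} (inj₂ refl))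

  induced : Σ (V → Fin m) λ φ → Bijective _≡_ _≡_ φ × InducedBy {G = G} {G'} f φ
  induced = φ , (φ-injective , φ-surjective) , φ-induces

-- Thetas

module CircuitLists {m : ℕ} (H : Graph m) where

  open OnGraph H
  open import Data.List.Membership.DecPropositional _≟ᴱ_ using (_∈?_)

  private E = Edge H

  -- Lists keep membership decidable. Repetitions, which `map f` creates while f is not known to be
  -- injective, do no harm because only membership counts.
  Circle : List E → Set₁
  Circle xs = Circ (_∈ xs)

  _⊆_ : List E → List E → Set
  xs ⊆ ys = ∀ {e} → e ∈ xs → e ∈ ys

  ++-⊆ : ∀ {xs ys zs} → xs ⊆ zs → ys ⊆ zs → (xs ++ ys) ⊆ zs
  ++-⊆ {xs} p q m = [ p , q ]′ (∈-++⁻ xs m)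

  ⊆-or-not : ∀ xs ys → (xs ⊆ ys) ⊎ ∃ λ e → e ∈ xs × e ∉ ys
  ⊆-or-not xs ys with All.all? (_∈? ys) xs
  ... | yes all = inj₁ (All.lookup all)
  ... | no ¬all = inj₂ (find (All.¬All⇒Any¬ (_∈? ys) xs ¬all))

  Circ-resp : ∀ {C D : E → Set} → (∀ {e} → C e → D e) → (∀ {e} → D e → C e) → Circ C → Circ D
  Circ-resp to from c = record
    { two   = λ De i → let e' , ne , Ce' , i' , only = two (from De) i in e' , ne , to Ce' , i' , only ∘ from
    ; conn  = λ P prop De Pe De' → conn P (λ a b → prop (to a) (to b)) (from De) Pe (from De')
    ; three = let e₀ , e₁ , e₂ , (a , b , c) , ne = three in e₀ , e₁ , e₂ , (to a , to b , to c) , ne }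
    where open Circ c

  -- At a vertex of the smaller circuit both edges of the larger one already belong to the smaller,
  -- so connectedness carries membership around the larger circuit.
  Circle-minimal : ∀ {xs ys} → Circle xs → Circle ys → xs ⊆ ys → ys ⊆ xs
  Circle-minimal {xs} {ys} cx cy sub = Circ.conn cy (_∈ xs) prop (sub e₀∈) e₀∈
    where
    e₀∈ = proj₁ (proj₁ (proj₂ (proj₂ (proj₂ (Circ.three cx)))))
    prop : ∀ {e e' w} → e ∈ ys → e' ∈ ys → Inc w e → Inc w e' → e ∈ xs → e' ∈ xs
    prop ey e'y i i' ex with Circ.two cx ex i | Circ.two cy ey i
    ... | p , p≢e , px , ip , _ | q , _ , _ , _ , only with only e'y i' | only (sub px) ip
    ...   | inj₁ refl | _          = ex
    ...   | inj₂ _    | inj₁ p≡e   = contradiction p≡e p≢e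
    ...   | inj₂ refl | inj₂ refl  = px

  infix 4 _∈_△_
  _∈_△_ : E → List E → List E → Set
  e ∈ xs △ ys = (e ∈ xs × e ∉ ys) ⊎ (e ∈ ys × e ∉ xs)

  △? : ∀ e xs ys → Dec (e ∈ xs △ ys)
  △? e xs ys = ((e ∈? xs) ×-dec ¬? (e ∈? ys)) ⊎-dec ((e ∈? ys) ×-dec ¬? (e ∈? xs))

  △-sym : ∀ {e xs ys} → e ∈ xs △ ys → e ∈ ys △ xs
  △-sym = [ inj₂ , inj₁ ]′

  -- At every vertex the symmetric difference has an even number of edges.
  △-propagates : ∀ {xs ys ks} → Circle xs → Circle ys → Circle ks → (∀ {e} → e ∈ xs △ ys → e ∈ ks) →
    ∀ {e e' w} → e ∈ ks → e' ∈ ks → Inc w e → Inc w e' → e ∈ xs → e ∉ ys → e' ∈ xs △ ys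
  △-propagates {xs} {ys} {ks} cx cy ck sub {e} {e'} {w} ek e'k i i' ex e∉y = decidable-stable (△? e' xs ys) impossible
    where
    module _ (¬D' : ¬ (e' ∈ xs △ ys)) where
      forced : ∀ {d} → d ∈ xs △ ys → Inc w d → d ≢ e → ⊥
      forced {d} Dd id d≢e with Circ.two ck ek i
      ... | _ , _ , _ , _ , only with only (sub Dd) id | only e'k i'
      ...   | inj₁ d≡e | _         = d≢e d≡e
      ...   | _        | inj₁ e'≡e = ¬D' (subst (_∈ xs △ ys) (sym e'≡e) (inj₁ (ex , e∉y)))
      ...   | inj₂ d≡q | inj₂ e'≡q = ¬D' (subst (_∈ xs △ ys) (trans d≡q (sym e'≡q)) Dd)
      impossible : ⊥
      impossible with Circ.two cx ex i
      ... | p , p≢e , px , ip , onlyx with p ∈? ys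
      ...   | no p∉y = forced (inj₁ (px , p∉y)) ip p≢e
      ...   | yes py with Circ.two cy py ip
      ...     | s , s≢p , sy , is , _ = forced (inj₂ (sy , λ sx → [ s≢e , s≢p ]′ (onlyx sx is))) is s≢e
        where
        s≢e : s ≢ e
        s≢e eq = e∉y (subst (_∈ ys) eq sy)

  -- Parity lets the symmetric difference spread from each edge of ks to the next one, so it is all
  -- of ks as soon as it is nonempty.
  △-fills : ∀ {xs ys ks} → Circle xs → Circle ys → Circle ks → (∀ {e} → e ∈ xs △ ys → e ∈ ks) →
            ∀ {e₀} → e₀ ∈ xs △ ys → ∀ {e} → e ∈ ks → e ∈ xs △ ys
  △-fills {xs} {ys} cx cy ck sub D₀ = Circ.conn ck (_∈ xs △ ys)
    (λ { ek e'k i i' (inj₁ (ex , e∉y)) → △-propagates cx cy ck sub ek e'k i i' ex e∉y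
       ; ek e'k i i' (inj₂ (ey , e∉x)) → △-sym (△-propagates cy cx ck (sub ∘ △-sym) ek e'k i i' ey e∉x) })
    (sub D₀) D₀

  -- Otherwise the symmetric difference of the last two circuits is all of the first, yet misses a.
  degenerate : ∀ {xs ys zs a} → Circle (xs ++ ys) → Circle (xs ++ zs) → Circle (ys ++ zs) → a ∈ xs → a ∈ ys → zs ⊆ (xs ++ ys)
  degenerate {xs} {ys} {zs} {a} cxy cxz cyz ax ay with ⊆-or-not zs (xs ++ ys)
  ... | inj₁ sub = sub
  ... | inj₂ (z , z∈ , z∉) = ⊥-elim (case △-fills cxz cyz cxy inside (proj₂ nonempty) (∈-++⁺ˡ ax) of λ
          { (inj₁ (_ , a∉)) → a∉ (∈-++⁺ˡ ay) ; (inj₂ (_ , a∉)) → a∉ (∈-++⁺ˡ ax) })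
    where
    inside : ∀ {e} → e ∈ (xs ++ zs) △ (ys ++ zs) → e ∈ xs ++ ys
    inside (inj₁ (m , e∉)) = [ ∈-++⁺ˡ , (λ ez → contradiction (∈-++⁺ʳ ys ez) e∉) ]′ (∈-++⁻ xs m)
    inside (inj₂ (m , e∉)) = [ ∈-++⁺ʳ xs , (λ ez → contradiction (∈-++⁺ʳ xs ez) e∉) ]′ (∈-++⁻ ys m)
    nonempty : ∃ λ e → e ∈ (xs ++ zs) △ (ys ++ zs)
    nonempty with ⊆-or-not xs (ys ++ zs)
    ... | inj₂ (e , ex , e∉) = e , inj₁ (∈-++⁺ˡ ex , e∉)
    ... | inj₁ sub = contradiction (Circle-minimal cxy cyz (++-⊆ sub ∈-++⁺ˡ) (∈-++⁺ʳ ys z∈)) z∉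

  -- The symmetric differences of the three circuits are all equal to ks, yet they sum to zero.
  three-routes-impossible : ∀ {ks qs q} (rs : Fin 3 → List E) → Circle ks → (∀ i → Circle (qs ++ rs i)) → (∀ i → rs i ⊆ ks) →
    (∀ {i j} → i ≢ j → ks ⊆ (rs i ++ rs j)) → q ∈ qs → q ∉ ks → ⊥
  three-routes-impossible {ks} {qs} {q} rs ck c inside cover q∈ q∉ = parity (e∈△ {zero} {suc zero} λ ()) (e∈△ {zero} {suc (suc zero)} λ ()) (e∈△ {suc zero} {suc (suc zero)} λ ())
    where
    e∈ks = proj₁ (proj₁ (proj₂ (proj₂ (proj₂ (Circ.three ck)))))
    sub : ∀ {i j e} → e ∈ (qs ++ rs i) △ (qs ++ rs j) → e ∈ ks
    sub {i} (inj₁ (m , e∉)) = [ (λ eq → contradiction (∈-++⁺ˡ eq) e∉) , inside i ]′ (∈-++⁻ qs m)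
    sub {_} {j} (inj₂ (m , e∉)) = [ (λ eq → contradiction (∈-++⁺ˡ eq) e∉) , inside j ]′ (∈-++⁻ qs m)
    -- The circuit of route i contains q, which is outside ks, so by minimality it does not contain
    -- ks. An edge of ks that it misses must lie on route j.
    nonempty : ∀ {i j} → i ≢ j → ∃ λ e → e ∈ (qs ++ rs i) △ (qs ++ rs j)
    nonempty {i} {j} i≢j with ⊆-or-not ks (qs ++ rs i)
    ... | inj₁ all = contradiction (Circle-minimal ck (c i) all (∈-++⁺ˡ q∈)) q∉
    ... | inj₂ (e , ek , e∉) = e , inj₂ ([ (λ m → contradiction (∈-++⁺ʳ qs m) e∉) , ∈-++⁺ʳ qs ]′ (∈-++⁻ (rs i) (cover i≢j ek)) , e∉)
    e∈△ : ∀ {i j} → i ≢ j → _ ∈ (qs ++ rs i) △ (qs ++ rs j)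
    e∈△ {i} {j} i≢j = △-fills (c i) (c j) ck (sub {i} {j}) (proj₂ (nonempty i≢j)) e∈ks
    parity : ∀ {e xs ys zs} → e ∈ xs △ ys → e ∈ xs △ zs → e ∈ ys △ zs → ⊥
    parity (inj₁ (_ , ∉y)) (inj₁ (_ , ∉z)) (inj₁ (y , _)) = ∉y y
    parity (inj₁ (_ , ∉y)) (inj₁ (_ , ∉z)) (inj₂ (z , _)) = ∉z z
    parity (inj₁ (x , _))  (inj₂ (_ , ∉x)) _              = ∉x x
    parity (inj₂ (_ , ∉x)) (inj₁ (x , _))  _              = ∉x x
    parity (inj₂ (y , _))  (inj₂ (z , _))  (inj₁ (_ , ∉z)) = ∉z z
    parity (inj₂ (y , _))  (inj₂ (z , _))  (inj₂ (_ , ∉y)) = ∉y y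

-- Three routes between two vertices of a theta

module Thetas {n : ℕ} (G : Graph n) (3-conn : KConnected 3 G) where

  open OnGraph G
  open ThreeConnected G 3-conn

  private V = Fin n

  record Theta : Set where
    field
      {x y}    : V
      x≢y      : x ≢ y
      P        : Fin 3 → Path x y
      simple   : ∀ i → Simple (P i)
      disjoint : ∀ {i j t} → i ≢ j → t ∈ verts (P i) → t ∈ verts (P j) → t ≡ x ⊎ t ≡ y

    On : V → Set
    On t = ∃ λ i → t ∈ verts (P i)

  module _ (Θ : Theta) where

    open Theta Θ

    -- The routes may overlap. What matters is that any two of them cover two paths of the theta: in
    -- a collapsed theta two paths already carry all of K.
    record Routes (s t : V) : Set where
      field
        R      : Fin 3 → Path s t
        simpleR : ∀ i → Simple (R i)
        on     : ∀ i {u} → u ∈ verts (R i) → On u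
        within : ∀ i {e} → e ∈ edges (R i) → ∃ λ k → e ∈ edges (P k)
        cover  : ∀ {i j} → i ≢ j → ∃₂ λ k l → k ≢ l ×
                 (∀ {e} → e ∈ edges (P k) ⊎ e ∈ edges (P l) → e ∈ edges (R i) ⊎ e ∈ edges (R j))

    Routes-sym : ∀ {s t} → Routes s t → Routes t s
    Routes-sym r = record
      { R       = reverse ∘ R
      ; simpleR = λ i → Simple-rev Adj-sym (R i) (simpleR i)
      ; on      = λ i m → on i (∈-rev⁻ Adj-sym (R i) m)
      ; within  = λ i m → within i (∈-edges-reverse⁻ (R i) m)
      ; cover   = λ {i} {j} i≢j → let k , l , k≢l , c = cover i≢j in k , l , k≢l ,
                    λ m → [ inj₁ ∘ ∈-edges-reverse⁺ (R i) , inj₂ ∘ ∈-edges-reverse⁺ (R j) ]′ (c m) }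
      where open Routes r

    module _ {A : Set} where
      triple : A → A → A → Fin 3 → A
      triple a b c zero             = a
      triple a b c (suc zero)       = b
      triple a b c (suc (suc zero)) = c

    mkRoutes : ∀ {s t} (A B C : Path s t) → Simple A → Simple B → Simple C →
      (∀ {u} → u ∈ verts A → On u) → (∀ {u} → u ∈ verts B → On u) → (∀ {u} → u ∈ verts C → On u) →
      (∀ {e} → e ∈ edges A → ∃ λ k → e ∈ edges (P k)) → (∀ {e} → e ∈ edges B → ∃ λ k → e ∈ edges (P k)) →
      (∀ {e} → e ∈ edges C → ∃ λ k → e ∈ edges (P k)) →
      (∃₂ λ k l → k ≢ l × (∀ {e} → e ∈ edges (P k) ⊎ e ∈ edges (P l) → e ∈ edges A ⊎ e ∈ edges B)) →
      (∃₂ λ k l → k ≢ l × (∀ {e} → e ∈ edges (P k) ⊎ e ∈ edges (P l) → e ∈ edges A ⊎ e ∈ edges C)) →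
      (∃₂ λ k l → k ≢ l × (∀ {e} → e ∈ edges (P k) ⊎ e ∈ edges (P l) → e ∈ edges B ⊎ e ∈ edges C)) → Routes s t
    mkRoutes {s} {t} A B C sA sB sC onA onB onC wA wB wC AB AC BC = record { R = R ; simpleR = simpleR ; on = on ; within = within ; cover = λ {i} {j} → cover {i} {j} }
      where
      R : Fin 3 → Path s t
      R = triple A B C
      simpleR : ∀ i → Simple (R i)
      simpleR zero             = sA
      simpleR (suc zero)       = sB
      simpleR (suc (suc zero)) = sC
      on : ∀ i {u} → u ∈ verts (R i) → On u
      on zero             = onA
      on (suc zero)       = onB
      on (suc (suc zero)) = onC
      within : ∀ i {e} → e ∈ edges (R i) → ∃ λ k → e ∈ edges (P k)
      within zero             = wA
      within (suc zero)       = wB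
      within (suc (suc zero)) = wC
      Cover : Fin 3 → Fin 3 → Set
      Cover i j = ∃₂ λ k l → k ≢ l × (∀ {e} → e ∈ edges (P k) ⊎ e ∈ edges (P l) → e ∈ edges (R i) ⊎ e ∈ edges (R j))
      flip : ∀ {i j} → Cover i j → Cover j i
      flip (k , l , ne , c) = k , l , ne , λ m → [ inj₂ , inj₁ ]′ (c m)
      cover : ∀ {i j} → i ≢ j → Cover i j
      cover {zero}           {zero}           ne = contradiction refl ne
      cover {zero}           {suc zero}       _  = AB
      cover {zero}           {suc (suc zero)} _  = AC
      cover {suc zero}       {zero}           _  = flip {zero} {suc zero} AB
      cover {suc zero}       {suc zero}       ne = contradiction refl ne
      cover {suc zero}       {suc (suc zero)} _  = BC
      cover {suc (suc zero)} {zero}           _  = flip {zero} {suc (suc zero)} AC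
      cover {suc (suc zero)} {suc zero}       _  = flip {suc zero} {suc (suc zero)} BC
      cover {suc (suc zero)} {suc (suc zero)} ne = contradiction refl ne

    third : ∀ (i j : Fin 3) → ∃ λ k → k ≢ i × k ≢ j
    third zero             zero             = suc zero , (λ ()) , (λ ())
    third zero             (suc zero)       = suc (suc zero) , (λ ()) , (λ ())
    third zero             (suc (suc zero)) = suc zero , (λ ()) , (λ ())
    third (suc zero)       zero             = suc (suc zero) , (λ ()) , (λ ())
    third (suc zero)       (suc zero)       = zero , (λ ()) , (λ ())
    third (suc zero)       (suc (suc zero)) = zero , (λ ()) , (λ ())
    third (suc (suc zero)) zero             = suc zero , (λ ()) , (λ ())
    third (suc (suc zero)) (suc zero)       = zero , (λ ()) , (λ ())
    third (suc (suc zero)) (suc (suc zero)) = zero , (λ ()) , (λ ())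

    detour : ∀ {s t a b} (α : Path a s) (M : Path a b) (γ : Path t b) → Simple α → Simple M → Simple γ →
      (∀ {u} → u ∈ verts α → u ∈ verts M → u ≡ a) → (∀ {u} → u ∈ verts M → u ∈ verts γ → u ≡ b) →
      (∀ {u} → u ∈ verts α → u ∉ verts γ) → Σ (Path s t) Simple
    detour α M γ sα sM sγ c₁ c₂ c₃ = reverse α ◅◅ M ◅◅ reverse γ ,
      Simple-◅◅⁺ (reverse α) _ (Simple-rev Adj-sym α sα)
        (Simple-◅◅⁺ M (reverse γ) sM (Simple-rev Adj-sym γ sγ) (λ m m' → c₂ m (∈-rev⁻ Adj-sym γ m')))
        λ m m' → [ c₁ (∈-rev⁻ Adj-sym α m) , (λ l → contradiction (∈-rev⁻ Adj-sym γ l) (c₃ (∈-rev⁻ Adj-sym α m))) ]′ (∈-◅◅⁻ M (reverse γ) m')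

    ∈-detour⁻ : ∀ {s t a b u} (α : Path a s) (M : Path a b) (γ : Path t b) →
                u ∈ verts (reverse α ◅◅ M ◅◅ reverse γ) → u ∈ verts α ⊎ u ∈ verts M ⊎ u ∈ verts γ
    ∈-detour⁻ α M γ m with ∈-◅◅⁻ (reverse α) (M ◅◅ reverse γ) m
    ... | inj₁ l = inj₁ (∈-rev⁻ Adj-sym α l)
    ... | inj₂ r = inj₂ ([ inj₁ , inj₂ ∘ ∈-rev⁻ Adj-sym γ ]′ (∈-◅◅⁻ M (reverse γ) r))

    edges-detour⁻ : ∀ {s t a b e} (α : Path a s) (M : Path a b) (γ : Path t b) →
                    e ∈ edges (reverse α ◅◅ M ◅◅ reverse γ) → e ∈ edges α ⊎ e ∈ edges M ⊎ e ∈ edges γ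
    edges-detour⁻ α M γ m with ∈-edges-◅◅⁻ (reverse α) (M ◅◅ reverse γ) m
    ... | inj₁ l = inj₁ (∈-edges-reverse⁻ α l)
    ... | inj₂ r = inj₂ ([ inj₁ , inj₂ ∘ ∈-edges-reverse⁻ γ ]′ (∈-edges-◅◅⁻ M (reverse γ) r))

    edges-detour⁺ : ∀ {s t a b e} (α : Path a s) (M : Path a b) (γ : Path t b) →
                    e ∈ edges α ⊎ e ∈ edges M ⊎ e ∈ edges γ → e ∈ edges (reverse α ◅◅ M ◅◅ reverse γ)
    edges-detour⁺ α M γ (inj₁ m)        = ∈-edges-◅◅⁺ˡ (reverse α) _ (∈-edges-reverse⁺ α m)
    edges-detour⁺ α M γ (inj₂ (inj₁ m)) = ∈-edges-◅◅⁺ʳ (reverse α) _ (∈-edges-◅◅⁺ˡ M _ m)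
    edges-detour⁺ α M γ (inj₂ (inj₂ m)) = ∈-edges-◅◅⁺ʳ (reverse α) _ (∈-edges-◅◅⁺ʳ M _ (∈-edges-reverse⁺ γ m))

    -- The routes are the stretch μ itself and the two ways around, back to x, along another path to
    -- y and on to t. The two ways around share α and γ.
    routes-inOrder : ∀ i {s t} (α : Path x s) (μ : Path s t) (γ : Path t y) → P i ≡ α ◅◅ μ ◅◅ γ → s ≢ t → Routes s t
    routes-inOrder i {s} {t} α μ γ Pi s≢t = mkRoutes μ (proj₁ (via j j≢i)) (proj₁ (via k k≢i)) sμ (proj₂ (via j j≢i)) (proj₂ (via k k≢i))
        (λ m → i , ver (∈-◅◅⁺ʳ α _ (∈-◅◅⁺ˡ μ γ m))) (onVia j) (onVia k)
        (λ m → i , edg (∈-edges-◅◅⁺ʳ α _ (∈-edges-◅◅⁺ˡ μ γ m))) (withinVia j) (withinVia k)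
        (i , j , ≢-sym j≢i , coverVia j) (i , k , ≢-sym k≢i , coverVia k)
        (j , k , ≢-sym k≢j , [ inj₁ ∘ edges-detour⁺ α (P j) γ ∘ inj₂ ∘ inj₁ , inj₂ ∘ edges-detour⁺ α (P k) γ ∘ inj₂ ∘ inj₁ ]′)
      where
      j = proj₁ (third i i)
      j≢i = proj₁ (proj₂ (third i i))
      k = proj₁ (third i j)
      k≢i = proj₁ (proj₂ (third i j))
      k≢j = proj₂ (proj₂ (third i j))
      sPi : Simple (α ◅◅ μ ◅◅ γ)
      sPi = subst Simple Pi (simple i)
      sα = proj₁ (Simple-◅◅⁻ α (μ ◅◅ γ) sPi)
      cα : ∀ {u} → u ∈ verts α → u ∈ verts (μ ◅◅ γ) → u ≡ s
      cα = proj₂ (proj₂ (Simple-◅◅⁻ α (μ ◅◅ γ) sPi))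
      sμγ = proj₁ (proj₂ (Simple-◅◅⁻ α (μ ◅◅ γ) sPi))
      sμ = proj₁ (Simple-◅◅⁻ μ γ sμγ)
      sγ = proj₁ (proj₂ (Simple-◅◅⁻ μ γ sμγ))
      cμ : ∀ {u} → u ∈ verts μ → u ∈ verts γ → u ≡ t
      cμ = proj₂ (proj₂ (Simple-◅◅⁻ μ γ sμγ))
      ver : ∀ {u} → u ∈ verts (α ◅◅ μ ◅◅ γ) → u ∈ verts (P i)
      ver {u} = subst (λ p → u ∈ verts p) (sym Pi)
      edg : ∀ {e} → e ∈ edges (α ◅◅ μ ◅◅ γ) → e ∈ edges (P i)
      edg {e} = subst (λ p → e ∈ edges p) (sym Pi)
      αγ : ∀ {u} → u ∈ verts α → u ∉ verts γ
      αγ m m' = let u≡s = cα m (∈-◅◅⁺ʳ μ γ m') in s≢t (cμ (here refl) (subst (_∈ verts γ) u≡s m'))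
      y∉α : y ∉ verts α
      y∉α m = αγ m (end∈ γ)
      via : ∀ j → j ≢ i → Σ (Path s t) Simple
      via j ne = detour α (P j) γ sα (simple j) sγ
        (λ m m' → [ id , (λ { refl → contradiction m y∉α }) ]′ (disjoint (≢-sym ne) (ver (∈-◅◅⁺ˡ α _ m)) m'))
        (λ m m' → [ (λ { refl → contradiction m' (αγ (here refl)) }) , id ]′ (disjoint ne m (ver (∈-◅◅⁺ʳ α _ (∈-◅◅⁺ʳ μ γ m')))))
        αγ
      onVia : ∀ j {u} → u ∈ verts (reverse α ◅◅ P j ◅◅ reverse γ) → On u
      onVia j m = [ (λ l → i , ver (∈-◅◅⁺ˡ α _ l)) , [ j ,_ , (λ r → i , ver (∈-◅◅⁺ʳ α _ (∈-◅◅⁺ʳ μ γ r))) ]′ ]′ (∈-detour⁻ α (P j) γ m)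
      withinVia : ∀ j {e} → e ∈ edges (reverse α ◅◅ P j ◅◅ reverse γ) → ∃ λ k → e ∈ edges (P k)
      withinVia j m = [ (λ l → i , edg (∈-edges-◅◅⁺ˡ α _ l)) , [ j ,_ , (λ r → i , edg (∈-edges-◅◅⁺ʳ α _ (∈-edges-◅◅⁺ʳ μ γ r))) ]′ ]′ (edges-detour⁻ α (P j) γ m)
      coverVia : ∀ j {e} → e ∈ edges (P i) ⊎ e ∈ edges (P j) → e ∈ edges μ ⊎ e ∈ edges (reverse α ◅◅ P j ◅◅ reverse γ)
      coverVia j (inj₂ m) = inj₂ (edges-detour⁺ α (P j) γ (inj₂ (inj₁ m)))
      coverVia j {e} (inj₁ m) with ∈-edges-◅◅⁻ α (μ ◅◅ γ) (subst (λ p → e ∈ edges p) Pi m)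
      ... | inj₁ l = inj₂ (edges-detour⁺ α (P j) γ (inj₁ l))
      ... | inj₂ r with ∈-edges-◅◅⁻ μ γ r
      ...   | inj₁ l = inj₁ l
      ...   | inj₂ g = inj₂ (edges-detour⁺ α (P j) γ (inj₂ (inj₂ g)))

    routes-same : ∀ i {s t} → s ∈ verts (P i) → t ∈ verts (P i) → s ≢ t → Routes s t
    routes-same i s∈ t∈ s≢t with split (P i) s∈
    ... | α , β , eq with ∈-◅◅⁻ α β (subst (λ p → _ ∈ verts p) eq t∈)
    ...   | inj₂ r with split β r
    ...     | μ , γ , refl = routes-inOrder i α μ γ eq s≢t
    routes-same i s∈ t∈ s≢t | α , β , eq | inj₁ l with split α l
    ...     | α₁ , α₂ , refl = Routes-sym (routes-inOrder i α₁ α₂ β (trans eq (Star.◅◅-assoc α₁ α₂ β)) (≢-sym s≢t))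

    -- One route passes through x, one through y, and the third goes to x, along the remaining path
    -- to y and on to t.
    routes-apart : ∀ {i j s t} → i ≢ j → s ∈ verts (P i) → t ∈ verts (P j) → s ≢ x → s ≢ y → t ≢ x → t ≢ y → Routes s t
    routes-apart {i} {j} {s} {t} i≢j s∈ t∈ s≢x s≢y t≢x t≢y with split (P i) s∈ | split (P j) t∈
    ... | α₁ , β₁ , eq₁ | α₂ , β₂ , eq₂ = mkRoutes A B C
          (Simple-◅◅⁺ (reverse α₁) α₂ (Simple-rev Adj-sym α₁ sα₁) sα₂ (λ m m' → αα (∈-rev⁻ Adj-sym α₁ m) m'))
          (Simple-◅◅⁺ β₁ (reverse β₂) sβ₁ (Simple-rev Adj-sym β₂ sβ₂) (λ m m' → ββ m (∈-rev⁻ Adj-sym β₂ m')))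
          (proj₂ (detour α₁ (P k) β₂ sα₁ (simple k) sβ₂ αk kβ αβ))
          (λ m → [ on-i ∘ ∈-◅◅⁺ˡ α₁ β₁ ∘ ∈-rev⁻ Adj-sym α₁ , on-j ∘ ∈-◅◅⁺ˡ α₂ β₂ ]′ (∈-◅◅⁻ (reverse α₁) α₂ m))
          (λ m → [ on-i ∘ ∈-◅◅⁺ʳ α₁ β₁ , on-j ∘ ∈-◅◅⁺ʳ α₂ β₂ ∘ ∈-rev⁻ Adj-sym β₂ ]′ (∈-◅◅⁻ β₁ (reverse β₂) m))
          (λ m → [ on-i ∘ ∈-◅◅⁺ˡ α₁ β₁ , [ k ,_ , on-j ∘ ∈-◅◅⁺ʳ α₂ β₂ ]′ ]′ (∈-detour⁻ α₁ (P k) β₂ m))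
          (λ m → [ in-i ∘ ∈-edges-◅◅⁺ˡ α₁ β₁ ∘ ∈-edges-reverse⁻ α₁ , in-j ∘ ∈-edges-◅◅⁺ˡ α₂ β₂ ]′ (∈-edges-◅◅⁻ (reverse α₁) α₂ m))
          (λ m → [ in-i ∘ ∈-edges-◅◅⁺ʳ α₁ β₁ , in-j ∘ ∈-edges-◅◅⁺ʳ α₂ β₂ ∘ ∈-edges-reverse⁻ β₂ ]′ (∈-edges-◅◅⁻ β₁ (reverse β₂) m))
          (λ m → [ in-i ∘ ∈-edges-◅◅⁺ˡ α₁ β₁ , [ k ,_ , in-j ∘ ∈-edges-◅◅⁺ʳ α₂ β₂ ]′ ]′ (edges-detour⁻ α₁ (P k) β₂ m))
          (i , j , i≢j , λ { (inj₁ m) → [ inj₁ ∘ α₁A , inj₂ ∘ ∈-edges-◅◅⁺ˡ β₁ _ ]′ (out-i m)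
                           ; (inj₂ m) → [ inj₁ ∘ ∈-edges-◅◅⁺ʳ (reverse α₁) α₂ , inj₂ ∘ β₂B ]′ (out-j m) })
          (j , k , ≢-sym k≢j , λ { (inj₁ m) → [ inj₁ ∘ ∈-edges-◅◅⁺ʳ (reverse α₁) α₂ , inj₂ ∘ edges-detour⁺ α₁ (P k) β₂ ∘ inj₂ ∘ inj₂ ]′ (out-j m)
                                 ; (inj₂ m) → inj₂ (edges-detour⁺ α₁ (P k) β₂ (inj₂ (inj₁ m))) })
          (i , k , ≢-sym k≢i , λ { (inj₁ m) → [ inj₂ ∘ edges-detour⁺ α₁ (P k) β₂ ∘ inj₁ , inj₁ ∘ ∈-edges-◅◅⁺ˡ β₁ _ ]′ (out-i m)
                                 ; (inj₂ m) → inj₂ (edges-detour⁺ α₁ (P k) β₂ (inj₂ (inj₁ m))) })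
      where
      k = proj₁ (third i j)
      k≢i = proj₁ (proj₂ (third i j))
      k≢j = proj₂ (proj₂ (third i j))
      A = reverse α₁ ◅◅ α₂
      B = β₁ ◅◅ reverse β₂
      C = reverse α₁ ◅◅ P k ◅◅ reverse β₂
      S₁ = Simple-◅◅⁻ α₁ β₁ (subst Simple eq₁ (simple i))
      S₂ = Simple-◅◅⁻ α₂ β₂ (subst Simple eq₂ (simple j))
      sα₁ = proj₁ S₁
      sβ₁ = proj₁ (proj₂ S₁)
      sα₂ = proj₁ S₂
      sβ₂ = proj₁ (proj₂ S₂)
      c₁ : ∀ {u} → u ∈ verts α₁ → u ∈ verts β₁ → u ≡ s
      c₁ = proj₂ (proj₂ S₁)
      c₂ : ∀ {u} → u ∈ verts α₂ → u ∈ verts β₂ → u ≡ t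
      c₂ = proj₂ (proj₂ S₂)
      ver-i : ∀ {u} → u ∈ verts (α₁ ◅◅ β₁) → u ∈ verts (P i)
      ver-i {u} = subst (λ p → u ∈ verts p) (sym eq₁)
      ver-j : ∀ {u} → u ∈ verts (α₂ ◅◅ β₂) → u ∈ verts (P j)
      ver-j {u} = subst (λ p → u ∈ verts p) (sym eq₂)
      on-i : ∀ {u} → u ∈ verts (α₁ ◅◅ β₁) → On u
      on-i m = i , ver-i m
      on-j : ∀ {u} → u ∈ verts (α₂ ◅◅ β₂) → On u
      on-j m = j , ver-j m
      in-i : ∀ {e} → e ∈ edges (α₁ ◅◅ β₁) → ∃ λ k → e ∈ edges (P k)
      in-i {e} m = i , subst (λ p → e ∈ edges p) (sym eq₁) m
      in-j : ∀ {e} → e ∈ edges (α₂ ◅◅ β₂) → ∃ λ k → e ∈ edges (P k)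
      in-j {e} m = j , subst (λ p → e ∈ edges p) (sym eq₂) m
      out-i : ∀ {e} → e ∈ edges (P i) → e ∈ edges α₁ ⊎ e ∈ edges β₁
      out-i {e} m = ∈-edges-◅◅⁻ α₁ β₁ (subst (λ p → e ∈ edges p) eq₁ m)
      out-j : ∀ {e} → e ∈ edges (P j) → e ∈ edges α₂ ⊎ e ∈ edges β₂
      out-j {e} m = ∈-edges-◅◅⁻ α₂ β₂ (subst (λ p → e ∈ edges p) eq₂ m)
      α₁A : ∀ {e} → e ∈ edges α₁ → e ∈ edges A
      α₁A m = ∈-edges-◅◅⁺ˡ (reverse α₁) α₂ (∈-edges-reverse⁺ α₁ m)
      β₂B : ∀ {e} → e ∈ edges β₂ → e ∈ edges B
      β₂B m = ∈-edges-◅◅⁺ʳ β₁ _ (∈-edges-reverse⁺ β₂ m)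
      y∉α₁ : y ∉ verts α₁
      y∉α₁ m = s≢y (sym (c₁ m (end∈ β₁)))
      x∉β₁ : x ∉ verts β₁
      x∉β₁ m = s≢x (sym (c₁ (here refl) m))
      x∉β₂ : x ∉ verts β₂
      x∉β₂ m = t≢x (sym (c₂ (here refl) m))
      αα : ∀ {u} → u ∈ verts α₁ → u ∈ verts α₂ → u ≡ x
      αα m m' = [ id , (λ { refl → contradiction m y∉α₁ }) ]′ (disjoint i≢j (ver-i (∈-◅◅⁺ˡ α₁ β₁ m)) (ver-j (∈-◅◅⁺ˡ α₂ β₂ m')))
      ββ : ∀ {u} → u ∈ verts β₁ → u ∈ verts β₂ → u ≡ y
      ββ m m' = [ (λ { refl → contradiction m x∉β₁ }) , id ]′ (disjoint i≢j (ver-i (∈-◅◅⁺ʳ α₁ β₁ m)) (ver-j (∈-◅◅⁺ʳ α₂ β₂ m')))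
      αk : ∀ {u} → u ∈ verts α₁ → u ∈ verts (P k) → u ≡ x
      αk m m' = [ id , (λ { refl → contradiction m y∉α₁ }) ]′ (disjoint (≢-sym k≢i) (ver-i (∈-◅◅⁺ˡ α₁ β₁ m)) m')
      kβ : ∀ {u} → u ∈ verts (P k) → u ∈ verts β₂ → u ≡ y
      kβ m m' = [ (λ { refl → contradiction m' x∉β₂ }) , id ]′ (disjoint k≢j m (ver-j (∈-◅◅⁺ʳ α₂ β₂ m')))
      αβ : ∀ {u} → u ∈ verts α₁ → u ∉ verts β₂
      αβ m m' = [ (λ { refl → x∉β₂ m' }) , (λ { refl → y∉α₁ m }) ]′ (disjoint i≢j (ver-i (∈-◅◅⁺ˡ α₁ β₁ m)) (ver-j (∈-◅◅⁺ʳ α₂ β₂ m')))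

    opaque
      routes : ∀ {s t} → On s → On t → s ≢ t → Routes s t
      routes {s} {t} (i , s∈) (j , t∈) s≢t with i ≟ j | s ≟ x | s ≟ y | t ≟ x | t ≟ y
      ... | yes refl | _        | _        | _        | _        = routes-same i s∈ t∈ s≢t
      ... | no _     | yes refl | _        | _        | _        = routes-same j (here refl) t∈ s≢t
      ... | no _     | no _     | yes refl | _        | _        = routes-same j (end∈ (P j)) t∈ s≢t
      ... | no _     | no _     | no _     | yes refl | _        = routes-same i s∈ (here refl) s≢t
      ... | no _     | no _     | no _     | no _     | yes refl = routes-same i s∈ (end∈ (P i)) s≢t
      ... | no ne    | no a     | no b     | no c     | no d     = routes-apart ne s∈ t∈ a b c d

-- Collapsed thetas of a circuit surjection

module Surjection {n m : ℕ} (G : Graph n) (G' : Graph m) (f : Edge G → Edge G') (3-conn : KConnected 3 G)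
  (f-circ : IsCircuitSurjection G G' f) where

  open OnGraph G
  open ThreeConnected G 3-conn
  open Thetas G 3-conn
  open CircuitLists G'
  private
    V = Fin n
    module G' = OnGraph G'

  open import Data.List.Membership.DecPropositional (_≟_ {n}) using (_∈?_)
  open import Data.List.Membership.DecPropositional G'._≟ᴱ_ using () renaming (_∈?_ to _∈ᴱ?_)

  colours : ∀ {u v} → Path u v → List (Edge G')
  colours p = map f (edges p)

  circle : ∀ {es} → IsCircuit G (_∈ es) → Circle (map f es)
  circle {es} c = Circ-resp to from (G'.IsCircuit⇒Circ (proj₂ (proj₂ f-circ) (_∈ es) c))
    where
    to : ∀ {e'} → Image {G = G} {G'} f (_∈ es) e' → e' ∈ map f es
    to (e , m , refl) = ∈-map⁺ f m
    from : ∀ {e'} → e' ∈ map f es → Image {G = G} {G'} f (_∈ es) e'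
    from m = let e , e∈ , eq = ∈-map⁻ f m in e , e∈ , sym eq

  circle-join : ∀ {u v} (P Q : Path u v) → IsCircuit G (_∈ edges P ++ edges Q) → Circle (colours P ++ colours Q)
  circle-join P Q c = subst Circle (map-++ f (edges P) (edges Q)) (circle c)

  -- Two of the paths share the colour a. The three circuits are separate fields because the
  -- disjointness in `Theta` would allow two paths to be the same single edge.
  record DegenerateTheta : Set where
    field
      Θ : Theta
    open Theta Θ public
    K : List (Edge G')
    K = colours (P zero) ++ colours (P (suc zero))
    field
      circuit₀₁ : IsCircuit G (_∈ edges (P zero) ++ edges (P (suc zero)))
      circuit₀₂ : IsCircuit G (_∈ edges (P zero) ++ edges (P (suc (suc zero))))
      circuit₁₂ : IsCircuit G (_∈ edges (P (suc zero)) ++ edges (P (suc (suc zero))))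
      {a}       : Edge G'
      a∈₀       : a ∈ colours (P zero)
      a∈₁       : a ∈ colours (P (suc zero))

  module Collapsed (D : DegenerateTheta) where

    open DegenerateTheta D public

    private
      C : Fin 3 → List (Edge G')
      C i = colours (P i)

      c₀₂ = circle-join (P zero) (P (suc (suc zero))) circuit₀₂
      c₁₂ = circle-join (P (suc zero)) (P (suc (suc zero))) circuit₁₂

    K-circle : Circle K
    K-circle = circle-join (P zero) (P (suc zero)) circuit₀₁

    inside : ∀ i → C i ⊆ K
    inside zero             = ∈-++⁺ˡ
    inside (suc zero)       = ∈-++⁺ʳ (C zero)
    inside (suc (suc zero)) = degenerate K-circle c₀₂ c₁₂ a∈₀ a∈₁

    -- Each of the three circuits has its image inside K, and no circuit lies properly inside
    -- another, so all three images are K.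
    cover : ∀ {i j} → i ≢ j → K ⊆ (C i ++ C j)
    cover {i} {j} = go i j
      where
      swap : ∀ {xs ys} → (xs ++ ys) ⊆ (ys ++ xs)
      swap {xs} {ys} = ++-⊆ {xs} (∈-++⁺ʳ ys) ∈-++⁺ˡ
      K⊆₀₂ = Circle-minimal c₀₂ K-circle (++-⊆ {C zero} (inside zero) (inside (suc (suc zero))))
      K⊆₁₂ = Circle-minimal c₁₂ K-circle (++-⊆ {C (suc zero)} (inside (suc zero)) (inside (suc (suc zero))))
      go : ∀ i j → i ≢ j → K ⊆ (C i ++ C j)
      go zero             zero             ne = contradiction refl ne
      go zero             (suc zero)       _  = id
      go zero             (suc (suc zero)) _  = K⊆₀₂
      go (suc zero)       zero             _  = swap {C zero}
      go (suc zero)       (suc zero)       ne = contradiction refl ne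
      go (suc zero)       (suc (suc zero)) _  = K⊆₁₂
      go (suc (suc zero)) zero             _  = swap {C zero} ∘ K⊆₀₂
      go (suc (suc zero)) (suc zero)       _  = swap {C (suc zero)} ∘ K⊆₁₂
      go (suc (suc zero)) (suc (suc zero)) ne = contradiction refl ne

    On? : ∀ t → Dec (On t)
    On? t = any? λ i → t ∈? verts (P i)

    -- An edge g with a colour outside K lies on an ear of the theta, between whose ends
    -- the theta contains three routes.
    module _ {u v} (g : Adj G u v) (new : f (edge g) ∉ K) (T : TwoPaths u v On) where

      open TwoPaths T renaming (disjoint to p-q-disjoint)

      ear : Path b b'
      ear = reverse p ◅◅ g ◅ q
      ear-simple : Simple ear
      ear-simple = Simple-◅◅⁺ (reverse p) (g ◅ q) (Simple-rev Adj-sym p simple-p)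
        (All.tabulate (λ { m refl → p-q-disjoint (here refl) m }) ∷ simple-q)
        λ { l (here e) → e ; l (there r) → contradiction r (p-q-disjoint (∈-rev⁻ Adj-sym p l)) }
      g∈ear : edge g ∈ edges ear
      g∈ear = ∈-edges-◅◅⁺ʳ (reverse p) (g ◅ q) (here refl)

      b≢b' : b ≢ b'
      b≢b' eq = p-q-disjoint (end∈ p) (subst (_∈ verts q) (sym eq) (end∈ q))

      module _ (r : Routes Θ b b') where

        open Routes r renaming (cover to routes-cover)

        meets : ∀ i {t} → t ∈ verts ear → t ∈ verts (R i) → t ≡ b ⊎ t ≡ b'
        meets i m m' with ∈-◅◅⁻ (reverse p) (g ◅ q) m
        ... | inj₁ l           = inj₁ (only-p (∈-rev⁻ Adj-sym p l) (on i m'))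
        ... | inj₂ (here refl) = inj₁ (only-p (here refl) (on i m'))
        ... | inj₂ (there r)   = inj₂ (only-q r (on i m'))
        R⊆K : ∀ i → colours (R i) ⊆ K
        R⊆K i m with ∈-map⁻ f m
        ... | e , e∈ , refl = let k , e∈k = within i e∈ in inside k (∈-map⁺ f e∈k)
        g∉R : ∀ i → edge g ∉ edges (R i)
        g∉R i m = new (R⊆K i (∈-map⁺ f m))
        R-cover : ∀ {i j} → i ≢ j → K ⊆ (colours (R i) ++ colours (R j))
        R-cover {i} {j} i≢j m with routes-cover i≢j
        ... | k , l , k≢l , c with ∈-++⁻ (C k) (cover k≢l m)
        ...   | inj₁ m' with ∈-map⁻ f m'
        ...     | e , e∈ , refl = [ ∈-++⁺ˡ ∘ ∈-map⁺ f , ∈-++⁺ʳ (colours (R i)) ∘ ∈-map⁺ f ]′ (c (inj₁ e∈))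
        R-cover {i} {j} i≢j m | k , l , k≢l , c | inj₂ m' with ∈-map⁻ f m'
        ...     | e , e∈ , refl = [ ∈-++⁺ˡ ∘ ∈-map⁺ f , ∈-++⁺ʳ (colours (R i)) ∘ ∈-map⁺ f ]′ (c (inj₂ e∈))

        ear-impossible : ⊥
        ear-impossible = three-routes-impossible (colours ∘ R) K-circle
          (λ i → circle-join ear (R i) (joinPaths ear (R i) ear-simple (simpleR i) (meets i) (edge g , g∈ear , g∉R i)))
          R⊆K R-cover (∈-map⁺ f g∈ear) new

    no-new-colour : ∀ {u v} (g : Adj G u v) → f (edge g) ∉ K → ⊥
    no-new-colour g new = ear-impossible g new T (routes Θ (TwoPaths.b∈B T) (TwoPaths.b'∈B T) (b≢b' g new T))
      where
      T : TwoPaths _ _ On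
      T = twoPaths On? (Adj⇒≢ g) (zero , here refl) (zero , end∈ (P zero)) x≢y

    all-colours : ∀ e → f e ∈ K
    all-colours e = decidable-stable (f e ∈ᴱ? K) λ new → no-new-colour (edge-adj e) (subst (λ d → f d ∉ K) (sym (edge-Joins {e} (edge-adj e) (inj₁ refl))) new)

  -- If f e₁ ≡ f e₂, a circuit through e₁ and e₂ has an ear separating them.
  module _ {e₁ e₂ : Edge G} (e₁≢e₂ : e₁ ≢ e₂) (fe₁≡fe₂ : f e₁ ≡ f e₂) where

    private
      Other : Edge G → Set
      Other e = e ≢ e₁ × e ≢ e₂

      R : V → V → Set
      R u v = Σ (Adj G u v) λ a → Other (edge a)

      toR : ∀ {u v} (p : Path u v) → (∀ {e} → e ∈ edges p → Other e) → Star R u v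
      toR ε       h = ε
      toR (a ◅ p) h = (a , h (here refl)) ◅ toR p (h ∘ there)

      fromR : ∀ {u v} → Star R u v → Path u v
      fromR = Star.map proj₁

      fromR-other : ∀ {u v e} (p : Star R u v) → e ∈ edges (fromR p) → Other e
      fromR-other ((_ , o) ◅ p) (here refl) = o
      fromR-other (_ ◅ p)       (there m)   = fromR-other p m

      not-at : ∀ {u v z e e'} (p : Path u v) → z ∉ verts p → Inc z e' → e ∈ edges p → e ≢ e'
      not-at p z∉ i m refl = z∉ (Inc-edges p m i)

    module _ (L : Linkage e₁ e₂) where

      open Linkage L renaming (x to x₁; y to y₁; x' to x₂; y' to y₂; joins-e to j₁; joins-h to j₂) hiding (circuit)

      private
        x₁∈e₁ = Joins⇒Incˡ {e₁} j₁
        y₁∈e₁ = Joins⇒Incʳ {e₁} j₁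
        x₂∈e₂ = Joins⇒Incˡ {e₂} j₂
        y₂∈e₂ = Joins⇒Incʳ {e₂} j₂

      -- Deleting an end of e₁ and an end of e₂ forces a walk to avoid both edges. With x₁ and y₂
      -- deleted, x₂ is joined to y₁. If p or q is trivial, the edges share a vertex: that vertex
      -- alone is deleted, and the walk reaches it by a third edge there.
      crossWalk : ∃₂ λ s t → s ∈ verts p × t ∈ verts q × Star R s t
      crossWalk with x₁ ≟ x₂ | y₁ ≟ y₂
      ... | yes refl | _ with neighbour x₁ y₁ y₂
      ...   | a , xa , a≢y₁ , a≢y₂ with connected x₁ x₁ a y₁
      ...     | w , av = x₁ , y₁ , here refl , here refl , (xa , first j₁ a≢y₁ , first j₂ a≢y₂) ◅ toR w λ m → not-at w x₁∉ x₁∈e₁ m , not-at w x₁∉ x₂∈e₂ m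
        where
        x₁∉ : x₁ ∉ verts w
        x₁∉ m with av m
        ... | inj₁ e               = Adj⇒≢ xa e
        ... | inj₂ (inj₁ e)        = Joins⇒≢ {e₁} j₁ e
        ... | inj₂ (inj₂ (ne , _)) = ne refl
        first : ∀ {e y} → Joins G e x₁ y → a ≢ y → edge xa ≢ e
        first {e} j a≢y eq = [ (λ a≡x → Adj⇒≢ xa (sym a≡x)) , a≢y ]′ (Inc-Joins {e} j (subst (Inc a) eq (Joins⇒Incʳ {edge xa} (joins-edge xa))))
      crossWalk | no _ | yes refl with neighbour y₁ x₁ x₂
      ...   | a , ya , a≢x₁ , a≢x₂ with connected y₁ y₁ x₁ a
      ...     | w , av = x₁ , y₁ , here refl , here refl , toR w (λ m → not-at w y₁∉ y₁∈e₁ m , not-at w y₁∉ y₂∈e₂ m) ◅◅ (Adj-sym ya , last j₁ a≢x₁ , last j₂ a≢x₂) ◅ ε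
        where
        y₁∉ : y₁ ∉ verts w
        y₁∉ m with av m
        ... | inj₁ e               = Joins⇒≢ {e₁} j₁ (sym e)
        ... | inj₂ (inj₁ e)        = Adj⇒≢ ya e
        ... | inj₂ (inj₂ (ne , _)) = ne refl
        last : ∀ {e x} → Joins G e x y₁ → a ≢ x → edge (Adj-sym ya) ≢ e
        last {e} j a≢x eq = [ a≢x , (λ a≡y → Adj⇒≢ ya (sym a≡y)) ]′ (Inc-Joins {e} j (subst (Inc a) eq (Joins⇒Incˡ {edge (Adj-sym ya)} (joins-edge (Adj-sym ya)))))
      crossWalk | no x₁≢x₂ | no y₁≢y₂ with connected x₁ y₂ x₂ y₁
      ... | w , av = x₂ , y₁ , end∈ p , here refl , toR w λ m → not-at w x₁∉ x₁∈e₁ m , not-at w y₂∉ y₂∈e₂ m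
        where
        x₁∉ : x₁ ∉ verts w
        x₁∉ m with av m
        ... | inj₁ e               = x₁≢x₂ e
        ... | inj₂ (inj₁ e)        = Joins⇒≢ {e₁} j₁ e
        ... | inj₂ (inj₂ (ne , _)) = ne refl
        y₂∉ : y₂ ∉ verts w
        y₂∉ m with av m
        ... | inj₁ e               = Joins⇒≢ {e₂} j₂ (sym e)
        ... | inj₂ (inj₁ e)        = y₁≢y₂ (sym e)
        ... | inj₂ (inj₂ (_ , ne)) = ne refl

      -- The ear attaches at s on p and at t on q, so of the two arcs of the circuit between s and t
      -- one contains e₁ and the other e₂. The common colour is that of these edges.
      degenerateTheta : DegenerateTheta
      degenerateTheta with crossWalk
      ... | s₀ , t₀ , s₀∈ , t₀∈ , w with proj₁ (trim _≟_ (_∈? verts p) (_∈? verts q) w s₀∈ t₀∈)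
      ...   | pathBetween {s} {t} z s∈ t∈ sz onlyS onlyT with split p s∈ | split q t∈
      ...     | p₁ , p₂ , eqp | q₁ , q₂ , eqq = record
        { Θ = record { x≢y = s≢t ; P = triple' ; simple = simple' ; disjoint = λ {i} {j} → disjoint' i j }
        ; circuit₀₁ = joinPaths P₀ P₁ s₀' s₁' d₀₁ (e₁ , e₁∈P₀ , e₁∉P₁)
        ; circuit₀₂ = joinPaths P₀ Z s₀' sZ d₀₂ (e₁ , e₁∈P₀ , λ m → proj₁ (fromR-other z m) refl)
        ; circuit₁₂ = joinPaths P₁ Z s₁' sZ d₁₂ (e₂ , e₂∈P₁ , λ m → proj₂ (fromR-other z m) refl)
        ; a∈₀ = ∈-map⁺ f e₁∈P₀
        ; a∈₁ = subst (_∈ colours P₁) (sym fe₁≡fe₂) (∈-map⁺ f e₂∈P₁) }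
        where
        a₁ = Joins⇒Adj {e₁} j₁
        a₂ = Joins⇒Adj {e₂} j₂
        a₁≡ : edge a₁ ≡ e₁
        a₁≡ = edge-Joins {e₁} a₁ j₁
        a₂≡ : edge a₂ ≡ e₂
        a₂≡ = edge-Joins {e₂} a₂ j₂
        Z : Path s t
        Z = fromR z
        sZ : Simple Z
        sZ = subst Unique (sym (verts-map proj₁ z)) sz
        P₀ P₁ : Path s t
        P₀ = reverse p₁ ◅◅ a₁ ◅ q₁
        P₁ = p₂ ◅◅ a₂ ◅ reverse q₂
        Sp = Simple-◅◅⁻ p₁ p₂ (subst Simple eqp simple-p)
        Sq = Simple-◅◅⁻ q₁ q₂ (subst Simple eqq simple-q)
        p₁⊆ : ∀ {u} → u ∈ verts p₁ → u ∈ verts p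
        p₁⊆ {u} m = subst (λ p → u ∈ verts p) (sym eqp) (∈-◅◅⁺ˡ p₁ p₂ m)
        p₂⊆ : ∀ {u} → u ∈ verts p₂ → u ∈ verts p
        p₂⊆ {u} m = subst (λ p → u ∈ verts p) (sym eqp) (∈-◅◅⁺ʳ p₁ p₂ m)
        q₁⊆ : ∀ {u} → u ∈ verts q₁ → u ∈ verts q
        q₁⊆ {u} m = subst (λ p → u ∈ verts p) (sym eqq) (∈-◅◅⁺ˡ q₁ q₂ m)
        q₂⊆ : ∀ {u} → u ∈ verts q₂ → u ∈ verts q
        q₂⊆ {u} m = subst (λ p → u ∈ verts p) (sym eqq) (∈-◅◅⁺ʳ q₁ q₂ m)
        s≢t : s ≢ t
        s≢t eq = disjoint s∈ (subst (_∈ verts q) (sym eq) t∈)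
        s₀' : Simple P₀
        s₀' = Simple-◅◅⁺ (reverse p₁) (a₁ ◅ q₁) (Simple-rev Adj-sym p₁ (proj₁ Sp))
          (All.tabulate (λ { m refl → disjoint (here refl) (q₁⊆ m) }) ∷ proj₁ Sq)
          λ { l (here e) → e ; l (there r) → contradiction (q₁⊆ r) (disjoint (p₁⊆ (∈-rev⁻ Adj-sym p₁ l))) }
        s₁' : Simple P₁
        s₁' = Simple-◅◅⁺ p₂ (a₂ ◅ reverse q₂) (proj₁ (proj₂ Sp))
          (All.tabulate (λ { m refl → disjoint (end∈ p) (q₂⊆ (∈-rev⁻ Adj-sym q₂ m)) }) ∷ Simple-rev Adj-sym q₂ (proj₁ (proj₂ Sq)))
          λ { l (here e) → e ; l (there r) → contradiction (q₂⊆ (∈-rev⁻ Adj-sym q₂ r)) (disjoint (p₂⊆ l)) }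
        in₀ : ∀ {u} → u ∈ verts P₀ → u ∈ verts p₁ ⊎ u ∈ verts q₁
        in₀ m with ∈-◅◅⁻ (reverse p₁) (a₁ ◅ q₁) m
        ... | inj₁ l           = inj₁ (∈-rev⁻ Adj-sym p₁ l)
        ... | inj₂ (here refl) = inj₁ (here refl)
        ... | inj₂ (there r)   = inj₂ r
        in₁ : ∀ {u} → u ∈ verts P₁ → u ∈ verts p₂ ⊎ u ∈ verts q₂
        in₁ m with ∈-◅◅⁻ p₂ (a₂ ◅ reverse q₂) m
        ... | inj₁ l           = inj₁ l
        ... | inj₂ (here refl) = inj₁ (end∈ p₂)
        ... | inj₂ (there r)   = inj₂ (∈-rev⁻ Adj-sym q₂ r)
        d₀₁ : ∀ {u} → u ∈ verts P₀ → u ∈ verts P₁ → u ≡ s ⊎ u ≡ t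
        d₀₁ m m' with in₀ m | in₁ m'
        ... | inj₁ l | inj₁ r = inj₁ (proj₂ (proj₂ Sp) l r)
        ... | inj₁ l | inj₂ r = contradiction (q₂⊆ r) (disjoint (p₁⊆ l))
        ... | inj₂ l | inj₁ r = contradiction (q₁⊆ l) (disjoint (p₂⊆ r))
        ... | inj₂ l | inj₂ r = inj₂ (proj₂ (proj₂ Sq) l r)
        onZ : ∀ {u} → u ∈ verts Z → u ∈ verts p ⊎ u ∈ verts q → u ≡ s ⊎ u ≡ t
        onZ m = [ inj₁ ∘ onlyS (∈-mapStar⁻ proj₁ z m) , inj₂ ∘ onlyT (∈-mapStar⁻ proj₁ z m) ]′
        d₀₂ : ∀ {u} → u ∈ verts P₀ → u ∈ verts Z → u ≡ s ⊎ u ≡ t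
        d₀₂ m m' = onZ m' ([ inj₁ ∘ p₁⊆ , inj₂ ∘ q₁⊆ ]′ (in₀ m))
        d₁₂ : ∀ {u} → u ∈ verts P₁ → u ∈ verts Z → u ≡ s ⊎ u ≡ t
        d₁₂ m m' = onZ m' ([ inj₁ ∘ p₂⊆ , inj₂ ∘ q₂⊆ ]′ (in₁ m))
        e₁∈P₀ : e₁ ∈ edges P₀
        e₁∈P₀ = ∈-edges-◅◅⁺ʳ (reverse p₁) _ (here (sym a₁≡))
        e₂∈P₁ : e₂ ∈ edges P₁
        e₂∈P₁ = ∈-edges-◅◅⁺ʳ p₂ _ (here (sym a₂≡))
        e₁∉P₁ : e₁ ∉ edges P₁
        e₁∉P₁ m with ∈-edges-◅◅⁻ p₂ (a₂ ◅ reverse q₂) m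
        ... | inj₁ l         = disjoint (p₂⊆ (Inc-edges p₂ l y₁∈e₁)) (here refl)
        ... | inj₂ (here e)  = e₁≢e₂ (trans e a₂≡)
        ... | inj₂ (there r) = disjoint (here refl) (q₂⊆ (Inc-edges q₂ (∈-edges-reverse⁻ q₂ r) x₁∈e₁))
        triple' : Fin 3 → Path s t
        triple' zero             = P₀
        triple' (suc zero)       = P₁
        triple' (suc (suc zero)) = Z
        simple' : ∀ i → Simple (triple' i)
        simple' zero             = s₀'
        simple' (suc zero)       = s₁'
        simple' (suc (suc zero)) = sZ
        disjoint' : ∀ i j {u} → i ≢ j → u ∈ verts (triple' i) → u ∈ verts (triple' j) → u ≡ s ⊎ u ≡ t
        disjoint' zero             zero             ne _ _  = contradiction refl ne
        disjoint' zero             (suc zero)       _  m m' = d₀₁ m m'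
        disjoint' zero             (suc (suc zero)) _  m m' = d₀₂ m m'
        disjoint' (suc zero)       zero             _  m m' = d₀₁ m' m
        disjoint' (suc zero)       (suc zero)       ne _ _  = contradiction refl ne
        disjoint' (suc zero)       (suc (suc zero)) _  m m' = d₁₂ m m'
        disjoint' (suc (suc zero)) zero             _  m m' = d₀₂ m' m
        disjoint' (suc (suc zero)) (suc zero)       _  m m' = d₁₂ m' m
        disjoint' (suc (suc zero)) (suc (suc zero)) ne _ _  = contradiction refl ne

-- Counting edges of forests

-- Edges are added one at a time while ℓ labels the components: an edge inside a component closes
-- a cycle, any other edge merges two labels.
module Forests {n : ℕ} where

  private V = Fin n

  Linked± : List (V × V) → V → V → Set
  Linked± L u v = (u , v) ∈ L ⊎ (v , u) ∈ L

  record Labelling (L : List (V × V)) : Set where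
    field
      {k}       : ℕ
      label     : V → Fin k
      count     : length L + k ≡ n
      connected : ∀ {u v} → label u ≡ label v → Star (Linked± L) u v

  record Cycle (L : List (V × V)) : Set where
    field
      {u v} : V
      rest  : List (V × V)
      uv∈   : (u , v) ∈ L
      uv∉   : (u , v) ∉ rest
      rest⊆ : ∀ {a} → a ∈ rest → a ∈ L
      walk  : Star (Linked± rest) u v

  widen : ∀ {L a u v} → Star (Linked± L) u v → Star (Linked± (a ∷ L)) u v
  widen = Star.map [ inj₁ ∘ there , inj₂ ∘ there ]′

  -- `punchOut` deletes the label of u, and the vertices that carried it take over the label of v.
  merge : ∀ {L u v} (l : Labelling L) → Labelling.label l u ≢ Labelling.label l v → Labelling ((u , v) ∷ L)
  merge {L} {u} {v} record { k = zero ; label = ℓ } ne with () ← ℓ u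
  merge {L} {u} {v} record { k = suc k ; label = ℓ ; count = count ; connected = conn } ne = record
    { label     = ℓ'
    ; count     = trans (sym (ℕ.+-suc (length L) k)) count
    ; connected = conn' }
    where
    ℓ' : V → Fin k
    ℓ' x with ℓ u ≟ ℓ x
    ... | yes _ = Fin.punchOut ne
    ... | no ≢  = Fin.punchOut ≢
    u~v : Star (Linked± ((u , v) ∷ L)) u v
    u~v = inj₁ (here refl) ◅ ε
    v~u : Star (Linked± ((u , v) ∷ L)) v u
    v~u = inj₂ (here refl) ◅ ε
    conn' : ∀ {x y} → ℓ' x ≡ ℓ' y → Star (Linked± ((u , v) ∷ L)) x y
    conn' {x} {y} eq with ℓ u ≟ ℓ x | ℓ u ≟ ℓ y
    ... | yes p | yes q = widen (conn (trans (sym p) q))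
    ... | yes p | no q  = widen (conn (sym p)) ◅◅ u~v ◅◅ widen (conn (Fin.punchOut-injective ne q eq))
    ... | no p  | yes q = widen (conn (Fin.punchOut-injective p ne eq)) ◅◅ v~u ◅◅ widen (conn q)
    ... | no p  | no q  = widen (conn (Fin.punchOut-injective p q eq))

  labelling⊎cycle : ∀ L → Unique L → Labelling L ⊎ Cycle L
  labelling⊎cycle [] _ = inj₁ record { label = id ; count = refl ; connected = λ { refl → ε } }
  labelling⊎cycle ((u , v) ∷ L) (uv∉ ∷ us) with labelling⊎cycle L us
  ... | inj₂ c = inj₂ record { rest = rest ; uv∈ = there uv∈ ; uv∉ = Cycle.uv∉ c ; rest⊆ = there ∘ rest⊆ ; walk = walk }
    where open Cycle c
  ... | inj₁ l with Labelling.label l u ≟ Labelling.label l v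
  ...   | no ne  = inj₁ (merge l ne)
  ...   | yes eq = inj₂ record
          { rest = L ; uv∈ = here refl ; uv∉ = λ m → All.lookup uv∉ m refl ; rest⊆ = there ; walk = Labelling.connected l eq }

  acyclic-bound : ∀ {L} → V → Unique L → ¬ Cycle L → length L ℕ.< n
  acyclic-bound {L} v us ¬c with labelling⊎cycle L us
  ... | inj₂ c = contradiction c ¬c
  ... | inj₁ record { k = zero ; label = ℓ } with () ← ℓ v
  ... | inj₁ record { k = suc k ; count = count } = subst (length L ℕ.<_) count (ℕ.m<m+n (length L) (s≤s z≤n))

module _ {A : Set} where

  count : {P : A → Set} → (∀ x → Dec (P x)) → List A → ℕ
  count P? xs = length (filter P? xs)

  indicator : {P : Set} → Dec P → ℕ
  indicator (yes _) = 1
  indicator (no _)  = 0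

  count-∷ : ∀ {P : A → Set} (P? : ∀ x → Dec (P x)) x xs → count P? (x ∷ xs) ≡ indicator (P? x) + count P? xs
  count-∷ P? x xs with P? x
  ... | yes _ = refl
  ... | no _  = refl

  count-⊎ : ∀ {P Q R : A → Set} (P? : ∀ x → Dec (P x)) (Q? : ∀ x → Dec (Q x)) (R? : ∀ x → Dec (R x)) →
    (∀ x → P x → Q x ⊎ R x) → ∀ xs → count P? xs ≤ count Q? xs + count R? xs
  count-⊎ P? Q? R? h [] = z≤n
  count-⊎ P? Q? R? h (x ∷ xs) rewrite count-∷ P? x xs | count-∷ Q? x xs | count-∷ R? x xs =
    ℕ.≤-trans (ℕ.+-mono-≤ here≤ (count-⊎ P? Q? R? h xs)) (ℕ.≤-reflexive (rearrange (indicator (Q? x)) _ _ _))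
    where
    rearrange : ∀ a b c d → (a + b) + (c + d) ≡ (a + c) + (b + d)
    rearrange = ℕ.solve-∀
    here≤ : indicator (P? x) ≤ indicator (Q? x) + indicator (R? x)
    here≤ with P? x | Q? x | R? x
    ... | no _  | _     | _     = z≤n
    ... | yes _ | yes _ | _     = s≤s z≤n
    ... | yes _ | no _  | yes _ = s≤s z≤n
    ... | yes p | no ¬q | no ¬r = contradiction (h x p) [ ¬q , ¬r ]′

  count-twoOfThree : ∀ {P Q R S : A → Set} (P? : ∀ x → Dec (P x)) (Q? : ∀ x → Dec (Q x)) (R? : ∀ x → Dec (R x)) (S? : ∀ x → Dec (S x)) →
    (∀ x → P x → Q x ⊎ R x) → (∀ x → P x → Q x ⊎ S x) → (∀ x → P x → R x ⊎ S x) →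
    ∀ xs → 2 * count P? xs ≤ count Q? xs + (count R? xs + count S? xs)
  count-twoOfThree P? Q? R? S? qr qs rs [] = z≤n
  count-twoOfThree P? Q? R? S? qr qs rs (x ∷ xs)
    rewrite count-∷ P? x xs | count-∷ Q? x xs | count-∷ R? x xs | count-∷ S? x xs =
    ℕ.≤-trans (ℕ.≤-reflexive (ℕ.*-distribˡ-+ 2 (indicator (P? x)) _))
      (ℕ.≤-trans (ℕ.+-mono-≤ here≤ (count-twoOfThree P? Q? R? S? qr qs rs xs))
        (ℕ.≤-reflexive (rearrange (indicator (Q? x)) (indicator (R? x)) (indicator (S? x)) (count Q? xs) (count R? xs) (count S? xs))))
    where
    rearrange : ∀ a b c d e f → (a + (b + c)) + (d + (e + f)) ≡ (a + d) + ((b + e) + (c + f))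
    rearrange = ℕ.solve-∀
    here≤ : 2 * indicator (P? x) ≤ indicator (Q? x) + (indicator (R? x) + indicator (S? x))
    here≤ with P? x | Q? x | R? x | S? x
    ... | no _  | _     | _     | _     = z≤n
    ... | yes _ | yes _ | yes _ | _     = s≤s (s≤s z≤n)
    ... | yes _ | yes _ | no _  | yes _ = s≤s (s≤s z≤n)
    ... | yes _ | no _  | yes _ | yes _ = s≤s (s≤s z≤n)
    ... | yes p | yes _ | no ¬r | no ¬s = contradiction (rs x p) [ ¬r , ¬s ]′
    ... | yes p | no ¬q | no ¬r | _     = contradiction (qr x p) [ ¬q , ¬r ]′
    ... | yes p | no ¬q | yes _ | no ¬s = contradiction (qs x p) [ ¬q , ¬s ]′

  three≤length : ∀ {xs : List A} {a b c} → a ∈ xs → b ∈ xs → c ∈ xs → a ≢ b → a ≢ c → b ≢ c → 3 ≤ length xs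
  three≤length {xs} {a} {b} {c} ma mb mc ab ac bc = Fin.injective⇒≤ {f = index} index-injective
    where
    member : Fin 3 → ∃ (_∈ xs)
    member zero             = a , ma
    member (suc zero)       = b , mb
    member (suc (suc zero)) = c , mc
    index : Fin 3 → Fin (length xs)
    index i = Any.index (proj₂ (member i))
    member-≡ : ∀ {i j} → index i ≡ index j → proj₁ (member i) ≡ proj₁ (member j)
    member-≡ {i} {j} eq = trans (Any.lookup-index (proj₂ (member i))) (trans (cong (lookup xs) eq) (sym (Any.lookup-index (proj₂ (member j)))))
    index-injective : Injective _≡_ _≡_ index
    index-injective {zero}           {zero}           eq = refl
    index-injective {zero}           {suc zero}       eq = contradiction (member-≡ {zero} {suc zero} eq) ab
    index-injective {zero}           {suc (suc zero)} eq = contradiction (member-≡ {zero} {suc (suc zero)} eq) ac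
    index-injective {suc zero}       {zero}           eq = contradiction (sym (member-≡ {suc zero} {zero} eq)) ab
    index-injective {suc zero}       {suc zero}       eq = refl
    index-injective {suc zero}       {suc (suc zero)} eq = contradiction (member-≡ {suc zero} {suc (suc zero)} eq) bc
    index-injective {suc (suc zero)} {zero}           eq = contradiction (sym (member-≡ {suc (suc zero)} {zero} eq)) ac
    index-injective {suc (suc zero)} {suc zero}       eq = contradiction (sym (member-≡ {suc (suc zero)} {suc zero} eq)) bc
    index-injective {suc (suc zero)} {suc (suc zero)} eq = refl

-- Injectivity by counting colours

module Injectivity {n m : ℕ} (G : Graph n) (G' : Graph m) (f : Edge G → Edge G') (3-conn : KConnected 3 G)
  (f-circ : IsCircuitSurjection G G' f) where

  open OnGraph G
  open ThreeConnected G 3-conn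
  open Surjection G G' f 3-conn f-circ
  open CircuitLists G'
  open Forests {n}
  private
    V = Fin n
    module G' = OnGraph G'

  pairs : List (V × V)
  pairs = cartesianProduct (allFin n) (allFin n)

  arc? : ∀ ((u , v) : V × V) → Dec (Adj G u v)
  arc? (u , v) = adj? u v

  -- If every circuit contained all the colours of a circuit K, deleting one colour would leave a forest.
  -- Summing the bound on forests over three colours of K contradicts the minimum degree three.
  module _ {K : List (Edge G')} (K-circle : Circle K) (all-in-K : ∀ e → f e ∈ K) where

    rainbow : ∀ {es} → IsCircuit G (_∈ es) → K ⊆ map f es
    rainbow {es} c = Circle-minimal (circle c) K-circle λ m → let e , _ , eq = ∈-map⁻ f m in subst (_∈ K) (sym eq) (all-in-K e)

    Avoiding : Edge G' → V × V → Set
    Avoiding a (u , v) = Σ (Adj G u v) λ p → f (edge p) ≢ a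

    avoiding? : ∀ a x → Dec (Avoiding a x)
    avoiding? a (u , v) with adj? u v
    ... | no ¬p = no (¬p ∘ proj₁)
    ... | yes p = map′ (p ,_) (λ (p' , ne) eq → ne (trans (cong f (edge-unique p' p)) eq)) (¬? (f (edge p) G'.≟ᴱ a))

    OtherStep : Edge G → Edge G' → V → V → Set
    OtherStep e₀ a x y = Σ (Adj G x y) λ q → f (edge q) ≢ a × edge q ≢ e₀

    OtherStep-edges : ∀ {a e₀ x y e} (p : Star (OtherStep e₀ a) x y) →
                      e ∈ edges (Star.map proj₁ p) → f e ≢ a × e ≢ e₀
    OtherStep-edges ((_ , h) ◅ p) (here refl) = h
    OtherStep-edges (_ ◅ p)       (there m)   = OtherStep-edges p m

    not-reconnected : ∀ {a} → a ∈ K → ∀ {u v} (p₀ : Adj G u v) → f (edge p₀) ≢ a → ¬ Star (OtherStep (edge p₀) a) u v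
    not-reconnected {a} a∈K {u} {v} p₀ ne walk with pathTo _≟_ (_≟ v) walk refl
    ... | pathInto p refl sp _ _ = misses (rainbow circuit a∈K)
      where
      circuit : IsCircuit G (_∈ edge p₀ ∷ edges (Star.map proj₁ p))
      circuit = joinPaths (p₀ ◅ ε) (Star.map proj₁ p) ((Adj⇒≢ p₀ ∷ []) ∷ [] ∷ []) (subst Unique (sym (verts-map proj₁ p)) sp)
        (λ { (here e) _ → inj₁ e ; (there (here e)) _ → inj₂ e })
        (edge p₀ , here refl , λ m → proj₂ (OtherStep-edges p m) refl)
      misses : a ∉ map f (edge p₀ ∷ edges (Star.map proj₁ p))
      misses (here eq) = ne (sym eq)
      misses (there m) = let _ , m' , eq = ∈-map⁻ f m in proj₁ (OtherStep-edges p m') (sym eq)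

    -- The condition on reversed pairs matters: a pair listed together with its reverse is a `Cycle`
    -- of the list without being a circuit of G.
    acyclic : ∀ {a} → a ∈ K → ∀ {L} → (∀ {x} → x ∈ L → Avoiding a x) → (∀ {u v} → (u , v) ∈ L → (v , u) ∉ L) → ¬ Cycle L
    acyclic {a} a∈K {L} avoid asym record { u = u ; v = v ; rest = rest ; uv∈ = uv∈ ; uv∉ = uv∉ ; rest⊆ = rest⊆ ; walk = walk } =
      go (avoid uv∈)
      where
      go : Avoiding a (u , v) → ⊥
      go (p₀ , ne) = not-reconnected a∈K p₀ ne (Star.map step walk)
        where
        new : ∀ {x y} → (x , y) ∈ rest → (q : Adj G x y) → edge q ≢ edge p₀
        new m q eq with Inc-Joins {edge p₀} (joins-edge p₀) (subst (Inc _) eq (Joins⇒Incˡ {edge q} (joins-edge q)))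
                      | Inc-Joins {edge p₀} (joins-edge p₀) (subst (Inc _) eq (Joins⇒Incʳ {edge q} (joins-edge q)))
        ... | inj₁ refl | inj₁ refl = Adj⇒≢ q refl
        ... | inj₁ refl | inj₂ refl = uv∉ m
        ... | inj₂ refl | inj₁ refl = asym uv∈ (rest⊆ m)
        ... | inj₂ refl | inj₂ refl = Adj⇒≢ q refl
        step : ∀ {x y} → Linked± rest x y → OtherStep (edge p₀) a x y
        step (inj₁ m) = let q , ne = avoid (rest⊆ m) in q , ne , new m q
        step (inj₂ m) = let q , ne = avoid (rest⊆ m)
                            e = edge-sym (Adj-sym q) q
                        in Adj-sym q , (λ eq → ne (trans (cong f (sym e)) eq)) , λ eq → new m q (trans (sym e) eq)

    up? : ∀ a ((u , v) : V × V) → Dec (u Fin.< v × Avoiding a (u , v))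
    up? a (u , v) = (u Fin.<? v) ×-dec avoiding? a (u , v)

    down? : ∀ a ((u , v) : V × V) → Dec (v Fin.< u × Avoiding a (u , v))
    down? a (u , v) = (v Fin.<? u) ×-dec avoiding? a (u , v)

    pairs-unique : Unique pairs
    pairs-unique = Unique.cartesianProduct⁺ (Unique.allFin⁺ n) (Unique.allFin⁺ n)

    -- All ordered pairs are counted, so each edge appears once upwards and once downwards; each
    -- orientation lists a forest and has fewer than n entries.
    avoiding-bound : V → ∀ {a} → a ∈ K → count (avoiding? a) pairs ℕ.< n + n
    avoiding-bound v {a} a∈K = ℕ.≤-<-trans (count-⊎ (avoiding? a) (up? a) (down? a) oriented pairs) (ℕ.+-mono-<
        (acyclic-bound v (Unique.filter⁺ (up? a) pairs-unique)
          (acyclic a∈K (λ m → proj₂ (up m)) λ m m' → Fin.<-asym (proj₁ (up m)) (proj₁ (up m'))))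
        (acyclic-bound v (Unique.filter⁺ (down? a) pairs-unique)
          (acyclic a∈K (λ m → proj₂ (down m)) λ m m' → Fin.<-asym (proj₁ (down m)) (proj₁ (down m')))))
      where
      oriented : ∀ x → Avoiding a x → (proj₁ x Fin.< proj₂ x × Avoiding a x) ⊎ (proj₂ x Fin.< proj₁ x × Avoiding a x)
      oriented (u , v) h with Fin.<-cmp u v
      ... | tri< lt _ _ = inj₁ (lt , h)
      ... | tri≈ _ eq _ = contradiction eq (Adj⇒≢ (proj₁ h))
      ... | tri> _ _ gt = inj₂ (gt , h)
      up : ∀ {x} → x ∈ filter (up? a) pairs → proj₁ x Fin.< proj₂ x × Avoiding a x
      up m = proj₂ (∈-filter⁻ (up? a) {xs = pairs} m)
      down : ∀ {x} → x ∈ filter (down? a) pairs → proj₂ x Fin.< proj₁ x × Avoiding a x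
      down m = proj₂ (∈-filter⁻ (down? a) {xs = pairs} m)

    degree≥3 : ∀ v → 3 ≤ count arc? (map (v ,_) (allFin n))
    degree≥3 v with neighbour v v v
    ... | a , va , _ with neighbour v a a
    ...   | b , vb , b≢a , _ with neighbour v a b
    ...     | c , vc , c≢a , c≢b = three≤length (arc va) (arc vb) (arc vc)
                (b≢a ∘ sym ∘ cong proj₂) (c≢a ∘ sym ∘ cong proj₂) (c≢b ∘ sym ∘ cong proj₂)
      where
      arc : ∀ {t} → Adj G v t → (v , t) ∈ filter arc? (map (v ,_) (allFin n))
      arc {t} = ∈-filter⁺ arc? (∈-map⁺ (v ,_) (∈-allFin t))

    arcs-from : ∀ us → 3 * length us ≤ count arc? (cartesianProduct us (allFin n))
    arcs-from []       = z≤n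
    arcs-from (u ∷ us) = begin
      3 * suc (length us)                ≡⟨ ℕ.*-suc 3 (length us) ⟩
      3 + 3 * length us                  ≤⟨ ℕ.+-mono-≤ (degree≥3 u) (arcs-from us) ⟩
      length (filter arc? row) + length (filter arc? rows)
                                         ≡⟨ length-++ (filter arc? row) ⟨
      length (filter arc? row ++ filter arc? rows)
                                         ≡⟨ cong length (filter-++ arc? row rows) ⟨
      length (filter arc? (row ++ rows)) ∎
      where
      open ℕ.≤-Reasoning
      row = map (u ,_) (allFin n)
      rows = cartesianProduct us (allFin n)

    not-all-in-one-circle : V → ⊥
    not-all-in-one-circle v with G'.Circ.three K-circle
    -- The degree sum is at least 3n, and each ordered pair avoids at least two of the three
    -- colours. So the three forests, each counted in both orientations with fewer than 2n pairs,
    -- would need at least 6n pairs together.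
    ... | a , b , c , (a∈ , b∈ , c∈) , a≢b , a≢c , b≢c = ℕ.<-irrefl refl (begin-strict
      (n + n) + ((n + n) + (n + n)) ≡⟨ rearrange n ⟩
      2 * (3 * n)                   ≡⟨ cong (λ k → 2 * (3 * k)) length-allFin ⟨
      2 * (3 * length (allFin n))   ≤⟨ ℕ.*-monoʳ-≤ 2 (arcs-from (allFin n)) ⟩
      2 * count arc? pairs          ≤⟨ count-twoOfThree arc? (avoiding? a) (avoiding? b) (avoiding? c)
                                         (differs a≢b) (differs a≢c) (differs b≢c) pairs ⟩
      count (avoiding? a) pairs + (count (avoiding? b) pairs + count (avoiding? c) pairs)
                                    <⟨ ℕ.+-mono-< (avoiding-bound v a∈) (ℕ.+-mono-< (avoiding-bound v b∈) (avoiding-bound v c∈)) ⟩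
      (n + n) + ((n + n) + (n + n)) ∎)
      where
      open ℕ.≤-Reasoning
      length-allFin : length (allFin n) ≡ n
      length-allFin = length-tabulate id
      rearrange : ∀ n → (n + n) + ((n + n) + (n + n)) ≡ 2 * (3 * n)
      rearrange = ℕ.solve-∀
      differs : ∀ {a b} → a ≢ b → ∀ ((u , v) : V × V) → Adj G u v → Avoiding a (u , v) ⊎ Avoiding b (u , v)
      differs {a} a≢b _ p with f (edge p) G'.≟ᴱ a
      ... | no ne    = inj₁ (p , ne)
      ... | yes refl = inj₂ (p , a≢b)

  no-degenerateTheta : V → ¬ DegenerateTheta
  no-degenerateTheta v D = not-all-in-one-circle {DegenerateTheta.K D} (Collapsed.K-circle D) (Collapsed.all-colours D) v

  f-injective : Injective _≡_ _≡_ f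
  f-injective {e₁} {e₂} eq = decidable-stable (e₁ ≟ᴱ e₂) λ ne →
    no-degenerateTheta (proj₁ (proj₁ e₁)) (degenerateTheta ne eq (linkage e₁ e₂))

theorem1p2 : ∀ {n m} (G : Graph n) (G' : Graph m) (f : Edge G → Edge G') →
    KConnected 3 G → IsCircuitSurjection G G' f →
    Σ (Fin n → Fin m) λ φ → Bijective _≡_ _≡_ φ × InducedBy {G = G} {G'} f φ
theorem1p2 G G' f 3-conn f-circ =
  InjectiveCase.induced G G' f 3-conn f-circ (Injectivity.f-injective G G' f 3-conn f-circ)
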